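{- Let $q=p^r$ with $p$ an odd prime, $s=2$, $h\in\{0,1\}$, $m\ge2$, $a\in\mathbb{F}_q$, $t\mid m$, and assume $p\nmid m/t$ and $d\mid h$, where $d=\gcd(m/t,2)$. Let $\rho$ be the quadratic character of $\mathbb{F}_q$. Then: If $a=0$: $N_t=\frac12(q^{t-1}-1)$ when $m/t$ and $t$ are odd; $N_t=\frac12\bigl(q^{t-1}-1-(q-1)(-1)^hq^{(t-2)/2}\rho((-1)^{t/2})\bigr)$ when $m/t$ is odd and $t$ even; $N_t=q^{t-1}-1$ when $m/t$ is even. If $a\ne0$: $N_t=\frac12\bigl(q^{t-1}+(-1)^hq^{(t-1)/2}\rho\bigl((-1)^{(t-1)/2}\tfrac{m}{ta}\bigr)\bigr)$ when $m/t$ and $t$ are odd; $N_t=\frac12\bigl(q^{t-1}+(-1)^hq^{(t-2)/2}\rho((-1)^{t/2})\bigr)$ when $m/t$ is odd and $t$ even; $N_t=q^{t-1}$ when $m/t$ is even.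
   Context: $\mathrm{Tr}_m,\mathrm{Nm}_m$ are the trace and norm from $\mathbb{F}_{q^m}$ to $\mathbb{F}_q$; $\gamma_m$ is a fixed primitive element of $\mathbb{F}_{q^m}$ and $g=\mathrm{Nm}_m(\gamma_m)$ (a primitive element of $\mathbb{F}_q$). $N_t$ is the number of $x\in\mathbb{F}_{q^t}$ with $\mathrm{Tr}_m(x)=a$ and $\mathrm{Nm}_m(x)\in g^h\langle g^2\rangle$ (i.e. the norm is a square if $h=0$, a nonsquare if $h=1$). $\frac{m}{ta}$ denotes $(m/t)\cdot a^{ -1}\in\mathbb{F}_q$. -}

module Defs where

open import Data.Nat as ℕ using (ℕ; zero; suc; _∸_; _<_)
open import Data.Integer as ℤ using (ℤ; +_; -[1+_])
open import Data.Bool using (Bool; true; false; if_then_else_; _∧_)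
open import Data.List using (List; filter; length; upTo)
open import Data.Bool.ListAction using (any)
open import Data.List.Membership.Propositional using (_∈_)
open import Data.List.Relation.Unary.Unique.Propositional using (Unique)
open import Data.Product using (Σ; _×_)
open import Relation.Nullary using (¬_; Dec; yes; no)
open import Relation.Nullary.Decidable using (⌊_⌋)
open import Relation.Binary.Definitions using (DecidableEquality)
open import Relation.Binary.PropositionalEquality using (_≡_; _≢_)
open import Algebra.Structures using (IsCommutativeRing)
open import Data.Unit using (tt)
open import Data.Bool using (T)

record FiniteField : Set₁ where
  field
    Carrier : Set
    _+_ _*_ : Carrier → Carrier → Carrier
    -_      : Carrier → Carrier
    0# 1#   : Carrier
    isCommutativeRing : IsCommutativeRing _≡_ _+_ _*_ -_ 0# 1#
    _≟_     : DecidableEquality Carrier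
    0≢1     : 0# ≢ 1#
    _⁻¹     : Carrier → Carrier
    inverse : ∀ x → x ≢ 0# → (x * (x ⁻¹)) ≡ 1#
    elements : List Carrier
    complete : ∀ x → x ∈ elements
    unique   : Unique elements

  infixl 7 _*_
  infixl 6 _+_

  card : ℕ
  card = length elements

  pow : Carrier → ℕ → Carrier
  pow x zero    = 1#
  pow x (suc n) = x * pow x n

  fromℕ : ℕ → Carrier
  fromℕ zero    = 0#
  fromℕ (suc n) = 1# + fromℕ n

  sumTo : ℕ → (ℕ → Carrier) → Carrier
  sumTo zero    f = 0#
  sumTo (suc m) f = sumTo m f + f m

  prodTo : ℕ → (ℕ → Carrier) → Carrier
  prodTo zero    f = 1#
  prodTo (suc m) f = prodTo m f * f m

  -- Let this field be F_{q^m}.  Elements of the subfield F_{q^k}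
  -- are those with x^(q^k) = x.
  inSub : (q k : ℕ) → Carrier → Bool
  inSub q k x = ⌊ pow x (q ℕ.^ k) ≟ x ⌋

  Tr : (q m : ℕ) → Carrier → Carrier
  Tr q m x = sumTo m (λ i → pow x (q ℕ.^ i))

  Nm : (q m : ℕ) → Carrier → Carrier
  Nm q m x = prodTo m (λ i → pow x (q ℕ.^ i))

  Primitive : Carrier → Set
  Primitive γ = γ ≢ 0# × (∀ k → 0 < k → k < card ∸ 1 → pow γ k ≢ 1#)

  -- membership of z in the coset g^h ⟨g^2⟩ of F_q^*  (g ∈ F_q^*, |⟨g^2⟩| ≤ q - 1)
  inCoset : (q : ℕ) → (g : Carrier) → (h : ℕ) → Carrier → Bool
  inCoset q g h z = any (λ k → ⌊ z ≟ pow g (h ℕ.+ 2 ℕ.* k) ⌋) (upTo q)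

  Nt : (q m t : ℕ) (γ a : Carrier) (h : ℕ) → ℕ
  Nt q m t γ a h =
    length (filter (λ x → T? (inSub q t x ∧ ⌊ Tr q m x ≟ a ⌋ ∧ inCoset q (Nm q m γ) h (Nm q m x))) elements)
    where
      T? : (b : Bool) → Dec (T b)
      T? true  = yes tt
      T? false = no (λ ())

  ρ : (q : ℕ) → Carrier → ℤ
  ρ q z with z ≟ 0#
  ... | yes _ = + 0
  ... | no _  = if any (λ y → inSub q 1 y ∧ ⌊ (y * y) ≟ z ⌋) elements then + 1 else -[1+ 0 ]

{-# OPTIONS --safe #-}
module Submission where

-- Write K = 𝔽_q ⊂ L = 𝔽_{q^t} and e = m/t.  For x in L one has Tr_m x = e Tr_t x, and when e is odd Nm_m x lies
-- in g^h⟨g²⟩ exactly when η(x) = (−1)^h, η being the quadratic character of L; so all that matters is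
-- S(c) = ∑ η(x) over the x in L with Tr_t x = c, where c = a/e.
--
-- Let θ generate L, with conjugates θ_i and minimal polynomial f, and put s(x) = Tr_t(x / f′(θ)).  Euler's identity
-- ∑ θ_i^k / f′(θ_i) = 0 for k < t − 1, and = 1 for k = t − 1, makes span(1, θ, …, θ^(n−1)) totally isotropic for the
-- quadratic form s(y²) whenever 2n ≤ t.  The number of y with s(y²) = c follows by averaging over translations.
-- Substituting x = y², that number is also q^(t−1) + η(f′(θ)) S(c).
--
-- The remaining sign is η(f′(θ)) = ρ(Nm f′(θ)) with Nm f′(θ) = (−1)^(t(t−1)/2) Δ², where Δ is the Vandermonde product of
-- the conjugates.  Frobenius permutes these cyclically, so Δ^q = (−1)^(t−1) Δ, and Δ² is a square in K iff t is odd.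

-- Classically S is evaluated by Gauss sums and the Davenport-Hasse relation. No complex characters
-- occur here; everything is a count with values in ℤ, and identities are multiplied by 2 or by q so
-- that no division is ever made. Dividing by f′(θ) gives the form s(y²) in the basis 1, θ, ...,
-- θ^(t-1) a Hankel matrix with zeros above the antidiagonal and ones on it. The form is therefore
-- hyperbolic for t even, and hyperbolic plus the one-dimensional form c² for t odd. That is why
-- S(c) involves the indicator of c = 0 in the first case and ρ(c) in the second. The division is
-- undone by x ↦ f′(θ) x at the price of η(f′(θ)), so that all remaining arithmetic sits in one
-- sign. If e is even, the norm of every nonzero x in L is an even power of g: S does not occur, and
-- the condition d ∣ h excludes the nonsquare coset, which no norm from L meets.

open import Defs
open import Level using (0ℓ)
open import Algebra.Bundles using (CommutativeRing; RawRing)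
open import Algebra.Structures using (IsCommutativeRing)
open import Algebra.Solver.Ring.AlmostCommutativeRing
  using (AlmostCommutativeRing; fromCommutativeRing; _-Raw-AlmostCommutative⟶_; Induced-equivalence)
import Algebra.Solver.Ring
import Algebra.Properties.Ring
import Algebra.Properties.CommutativeSemiring.Binomial
import Algebra.Properties.CommutativeSemiring.Exp
import Algebra.Properties.Monoid.Mult
import Algebra.Properties.Monoid.Sum
import Algebra.Properties.Semiring.Exp
import Algebra.Properties.Semiring.Mult.TCOptimised
open import Data.Bool using (Bool; true; false; T; _∧_; if_then_else_)
open import Data.Bool.ListAction using (any)
open import Data.Bool.Properties using (T-≡; T-∧; T?)
open import Data.Fin as Fin using (Fin)
import Data.Fin.Properties as Fin
open import Data.Integer as ℤ using (ℤ; -[1+_]; 0ℤ; 1ℤ; -1ℤ)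
import Data.Integer.Properties as ℤ
open import Data.Integer.Tactic.RingSolver using (solve-∀)
open import Data.List using (List; []; _∷_; _∷ʳ_; filter; foldr; length; map; upTo)
open import Data.List.Properties using (length-map; length-upTo)
import Data.List.Membership.DecPropositional
open import Data.List.Membership.Propositional using (_∈_; _∉_; find; lose)
open import Data.List.Membership.Propositional.Properties
  using (∈-map⁺; ∈-map⁻; ∈-upTo⁺; ∈-upTo⁻; ∈-filter⁺; ∈-filter⁻)
open import Data.List.Membership.Propositional.Properties.WithK using (unique∧set⇒bag)
open import Data.List.Relation.Binary.BagAndSetEquality using (∼bag⇒↭)
open import Data.List.Relation.Binary.Permutation.Propositional using (_↭_; ↭⇒↭ₛ)
import Data.List.Relation.Binary.Permutation.Setoid.Properties as Permutationₛ
open import Data.List.Relation.Unary.All as All using (All; []; _∷_)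
open import Data.List.Relation.Unary.Any using (here; there)
open import Data.List.Relation.Unary.Any.Properties using (any⁺; any⁻)
open import Data.List.Relation.Unary.Unique.Propositional using (Unique; []; _∷_)
import Data.List.Relation.Unary.Unique.Propositional.Properties as Unique
open import Data.Maybe as Maybe using (Maybe)
open import Data.Nat as ℕ using (ℕ; zero; suc; _≤_; _<_)
import Data.Nat.Properties as ℕ
import Data.Nat.Tactic.RingSolver as ℕ-solver
open import Data.Nat.Combinatorics using (_C_; nCk≡n!/k![n-k]!; k![n∸k]!∣n!; nCn≡1)
open import Data.Nat.Coprimality using (Coprime; coprime-Bézout)
open import Data.Nat.DivMod using (_%_; _/_; m≡m%n+[m/n]*n; m%n<n; m*n/n≡m; m/n*n≡m)
open import Data.Nat.Divisibility using (_∣_; divides; ∣⇒≤; ∣-refl; ∣-trans; m∣m*n; m%n≡0⇒n∣m; *-cancelˡ-∣)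
open import Data.Nat.GCD using (gcd; gcd-greatest; module Bézout)
open import Data.Nat.Primality using (Prime; euclidsLemma; prime⇒irreducible; prime⇒nonTrivial; prime⇒nonZero)
open import Data.Product using (_×_; _,_; proj₁; proj₂; ∃)
open import Data.Sum using (_⊎_; inj₁; inj₂; [_,_]′)
import Data.Vec.Functional as Vector
open import Function using (_∘_; id; mk⇔; Equivalence)
open import Relation.Binary.Definitions using (DecidableEquality; tri<; tri≈; tri>)
open import Relation.Binary.PropositionalEquality
open import Relation.Nullary using (¬_; Dec; yes; no; contradiction)
open import Relation.Nullary.Decidable using (dec⇒maybe; fromWitness; toWitness; ⌊_⌋)
open import Relation.Unary using (Pred; Decidable)
open import Algebra.Properties.AbelianGroup ℤ.+-0-abelianGroup using () renaming (∙-cancelˡ to +-cancelˡ)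

-- Integer-valued sums over lists

module _ {P : Set} where

  ι : Dec P → ℤ
  ι (yes _) = 1ℤ
  ι (no _)  = 0ℤ

  ι-yes : (d : Dec P) → P → ι d ≡ 1ℤ
  ι-yes (yes _) _ = refl
  ι-yes (no ¬p) p = contradiction p ¬p

  ι-no : (d : Dec P) → ¬ P → ι d ≡ 0ℤ
  ι-no (yes p) ¬p = contradiction p ¬p
  ι-no (no _)  _  = refl

ι-⇔ : {P Q : Set} (d : Dec P) (d′ : Dec Q) → (P → Q) → (Q → P) → ι d ≡ ι d′
ι-⇔ (yes p) d′ f g = sym (ι-yes d′ (f p))
ι-⇔ (no ¬p) d′ f g = sym (ι-no d′ (¬p ∘ g))

∑ : {A : Set} → List A → (A → ℤ) → ℤ
∑ []       f = 0ℤ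
∑ (x ∷ xs) f = f x ℤ.+ ∑ xs f

module _ {A : Set} where

  ∑-cong : (xs : List A) {f g : A → ℤ} → (∀ {x} → x ∈ xs → f x ≡ g x) → ∑ xs f ≡ ∑ xs g
  ∑-cong []       eq = refl
  ∑-cong (x ∷ xs) eq = cong₂ ℤ._+_ (eq (here refl)) (∑-cong xs (eq ∘ there))

  ∑-cong′ : (xs : List A) {f g : A → ℤ} → (∀ x → f x ≡ g x) → ∑ xs f ≡ ∑ xs g
  ∑-cong′ xs eq = ∑-cong xs (λ {x} _ → eq x)

  ∑-0 : (xs : List A) → ∑ xs (λ _ → 0ℤ) ≡ 0ℤ
  ∑-0 []       = refl
  ∑-0 (x ∷ xs) = trans (ℤ.+-identityˡ _) (∑-0 xs)

  ∑-+ : (xs : List A) (f g : A → ℤ) → ∑ xs (λ x → f x ℤ.+ g x) ≡ ∑ xs f ℤ.+ ∑ xs g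
  ∑-+ []       f g = refl
  ∑-+ (x ∷ xs) f g = trans (cong (ℤ._+_ (f x ℤ.+ g x)) (∑-+ xs f g)) (interchange (f x) (g x) (∑ xs f) (∑ xs g))
    where
    interchange : ∀ a b c d → a ℤ.+ b ℤ.+ (c ℤ.+ d) ≡ a ℤ.+ c ℤ.+ (b ℤ.+ d)
    interchange = solve-∀

  ∑-*ˡ : (xs : List A) (c : ℤ) (f : A → ℤ) → ∑ xs (λ x → c ℤ.* f x) ≡ c ℤ.* ∑ xs f
  ∑-*ˡ []       c f = sym (ℤ.*-zeroʳ c)
  ∑-*ˡ (x ∷ xs) c f = trans (cong (ℤ._+_ (c ℤ.* f x)) (∑-*ˡ xs c f)) (sym (ℤ.*-distribˡ-+ c _ _))

  ∑-*ʳ : (xs : List A) (f : A → ℤ) (c : ℤ) → ∑ xs (λ x → f x ℤ.* c) ≡ ∑ xs f ℤ.* c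
  ∑-*ʳ xs f c = trans (∑-cong′ xs (λ x → ℤ.*-comm (f x) c)) (trans (∑-*ˡ xs c f) (ℤ.*-comm c _))

  ∑-const : (xs : List A) (c : ℤ) → ∑ xs (λ _ → c) ≡ ℤ.+ length xs ℤ.* c
  ∑-const []       c = refl
  ∑-const (x ∷ xs) c = trans (cong (ℤ._+_ c) (∑-const xs c)) (sym (ℤ.suc-* (ℤ.+ length xs) c))

  ∑-filter : {P : Pred A _} (P? : Decidable P) (xs : List A) (f : A → ℤ) →
             ∑ (filter P? xs) f ≡ ∑ xs (λ x → ι (P? x) ℤ.* f x)
  ∑-filter P? []       f = refl
  ∑-filter P? (x ∷ xs) f with P? x
  ... | yes _ = cong₂ ℤ._+_ (sym (ℤ.*-identityˡ (f x))) (∑-filter P? xs f)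
  ... | no _  = trans (∑-filter P? xs f) (sym (ℤ.+-identityˡ _))

  ∑-mono : (xs : List A) {f g : A → ℤ} → (∀ {x} → x ∈ xs → f x ℤ.≤ g x) → ∑ xs f ℤ.≤ ∑ xs g
  ∑-mono []       le = ℤ.≤-refl
  ∑-mono (x ∷ xs) le = ℤ.+-mono-≤ (le (here refl)) (∑-mono xs (le ∘ there))

  -- A single strict inequality would survive in the sums. This turns a bound by one together with
  -- the right total into an exact count.
  ∑-squeeze : (xs : List A) {f g : A → ℤ} → (∀ {x} → x ∈ xs → f x ℤ.≤ g x) →
              ∑ xs f ≡ ∑ xs g → ∀ {x} → x ∈ xs → f x ≡ g x
  ∑-squeeze (x ∷ xs) {f} {g} le eq = λ where
      (here refl) → head≡
      (there x∈)  → ∑-squeeze xs (le ∘ there) tail≡ x∈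
    where
    head≡ : f x ≡ g x
    head≡ = ℤ.≤-antisym (le (here refl)) (ℤ.≮⇒≥ λ lt →
      ℤ.<-irrefl eq (ℤ.+-mono-<-≤ lt (∑-mono xs (le ∘ there))))
    tail≡ : ∑ xs f ≡ ∑ xs g
    tail≡ = +-cancelˡ (f x) _ _ (trans eq (cong (ℤ._+ ∑ xs g) (sym head≡)))

∑-swap : {A B : Set} (xs : List A) (ys : List B) (f : A → B → ℤ) →
         ∑ xs (λ x → ∑ ys (f x)) ≡ ∑ ys (λ y → ∑ xs (λ x → f x y))
∑-swap []       ys f = sym (∑-0 ys)
∑-swap (x ∷ xs) ys f =
  trans (cong (ℤ._+_ (∑ ys (f x))) (∑-swap xs ys f)) (sym (∑-+ ys (f x) _))

module Reindexing {A : Set} (_≟_ : DecidableEquality A) where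
  open import Data.List.Membership.DecPropositional _≟_ using (_∈?_)

  ∑-δ : {xs : List A} → Unique xs → ∀ {z} → z ∈ xs → (f : A → ℤ) →
        ∑ xs (λ x → ι (z ≟ x) ℤ.* f x) ≡ f z
  ∑-δ {x ∷ xs} (x∉ ∷ u) (here refl) f = begin
    ι (x ≟ x) ℤ.* f x ℤ.+ ∑ xs (λ y → ι (x ≟ y) ℤ.* f y)
      ≡⟨ cong₂ ℤ._+_ (cong (ℤ._* f x) (ι-yes (x ≟ x) refl))
           (∑-cong xs λ {y} y∈ → cong (ℤ._* f y) (ι-no (x ≟ y) (All.lookup x∉ y∈))) ⟩
    1ℤ ℤ.* f x ℤ.+ ∑ xs (λ y → 0ℤ)
      ≡⟨ cong₂ ℤ._+_ (ℤ.*-identityˡ (f x)) (∑-0 xs) ⟩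
    f x ℤ.+ 0ℤ
      ≡⟨ ℤ.+-identityʳ (f x) ⟩
    f x ∎
    where open ≡-Reasoning
  ∑-δ {x ∷ xs} (x∉ ∷ u) {z} (there z∈) f = trans
    (cong₂ ℤ._+_ (cong (ℤ._* f x) (ι-no (z ≟ x) λ { refl → All.lookup x∉ z∈ refl })) (∑-δ u z∈ f))
    (ℤ.+-identityˡ (f z))

  ∑-∉ : {xs : List A} → ∀ {z} → z ∉ xs → ∑ xs (λ x → ι (z ≟ x)) ≡ 0ℤ
  ∑-∉ {xs} {z} z∉ = trans
    (∑-cong xs λ {x} x∈ → ι-no (z ≟ x) λ z≡x → z∉ (subst (_∈ xs) (sym z≡x) x∈)) (∑-0 xs)

  -- The general change of variables: `φ` need not be injective. Bijections have fibre counts 1, and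
  -- the squaring map has fibre counts 1 + η.
  ∑-fibre : {B : Set} (as : List B) {ys : List A} (φ : B → A) → Unique ys →
            (∀ {b} → b ∈ as → φ b ∈ ys) → (f : A → ℤ) →
            ∑ as (f ∘ φ) ≡ ∑ ys (λ y → ∑ as (λ b → ι (φ b ≟ y)) ℤ.* f y)
  ∑-fibre as {ys} φ u φ∈ f = begin
    ∑ as (f ∘ φ)                                         ≡⟨ ∑-cong as (λ b∈ → sym (∑-δ u (φ∈ b∈) f)) ⟩
    ∑ as (λ b → ∑ ys (λ y → ι (φ b ≟ y) ℤ.* f y))       ≡⟨ ∑-swap as ys _ ⟩
    ∑ ys (λ y → ∑ as (λ b → ι (φ b ≟ y) ℤ.* f y))       ≡⟨ ∑-cong′ ys (λ y → ∑-*ʳ as _ (f y)) ⟩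
    ∑ ys (λ y → ∑ as (λ b → ι (φ b ≟ y)) ℤ.* f y)       ∎
    where open ≡-Reasoning

  ∑-count : {xs : List A} → Unique xs → ∀ {z} → z ∈ xs → ∑ xs (λ x → ι (z ≟ x)) ≡ 1ℤ
  ∑-count {xs} u z∈ =
    trans (∑-cong′ xs (λ x → sym (ℤ.*-identityʳ _))) (∑-δ u z∈ (λ _ → 1ℤ))

  ∑-reindex : {xs : List A} → Unique xs → (φ ψ : A → A) →
              (∀ {x} → x ∈ xs → φ x ∈ xs) → (∀ {x} → x ∈ xs → ψ x ∈ xs) →
              (∀ x → ψ (φ x) ≡ x) → (∀ x → φ (ψ x) ≡ x) →
              (f : A → ℤ) → ∑ xs (f ∘ φ) ≡ ∑ xs f
  ∑-reindex {xs} u φ ψ φ∈ ψ∈ ψφ φψ f = trans (∑-fibre xs φ u φ∈ f) (∑-cong xs fibre≡1)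
    where
    fibre≡1 : ∀ {y} → y ∈ xs → ∑ xs (λ x → ι (φ x ≟ y)) ℤ.* f y ≡ f y
    fibre≡1 {y} y∈ = begin
      ∑ xs (λ x → ι (φ x ≟ y)) ℤ.* f y
        ≡⟨ cong (ℤ._* f y) (∑-cong′ xs λ x → ι-⇔ (φ x ≟ y) (ψ y ≟ x)
             (λ eq → trans (cong ψ (sym eq)) (ψφ x)) (λ eq → trans (cong φ (sym eq)) (φψ y))) ⟩
      ∑ xs (λ x → ι (ψ y ≟ x)) ℤ.* f y
        ≡⟨ cong (ℤ._* f y) (∑-count u (ψ∈ y∈)) ⟩
      1ℤ ℤ.* f y
        ≡⟨ ℤ.*-identityˡ (f y) ⟩
      f y ∎
      where open ≡-Reasoning

  ∑-⊆⊇ : {xs ys : List A} → Unique xs → Unique ys → (∀ {x} → x ∈ xs → x ∈ ys) → (∀ {x} → x ∈ ys → x ∈ xs) →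
         (f : A → ℤ) → ∑ xs f ≡ ∑ ys f
  ∑-⊆⊇ {xs} {ys} u v xs⊆ys ys⊆xs f = trans (∑-fibre xs (λ x → x) v xs⊆ys f)
    (∑-cong ys λ {y} y∈ → trans
      (cong (ℤ._* f y) (trans (∑-cong′ xs λ x → ι-⇔ (x ≟ y) (y ≟ x) sym sym) (∑-count u (ys⊆xs y∈))))
      (ℤ.*-identityˡ (f y)))

  ∑-ι≤1 : {xs : List A} → Unique xs → ∀ z → ∑ xs (λ x → ι (z ≟ x)) ℤ.≤ 1ℤ
  ∑-ι≤1 {xs} u z with z ∈? xs
  ... | yes z∈ = ℤ.≤-reflexive (∑-count u z∈)
  ... | no  z∉ = subst (ℤ._≤ 1ℤ) (sym (∑-∉ z∉)) (ℤ.+≤+ ℕ.z≤n)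

  -- Both lists contribute the same number of incidences x = y, and each x in ys accounts for at most one.
  pigeonhole : {xs ys : List A} → Unique xs → Unique ys → (∀ {x} → x ∈ xs → x ∈ ys) →
               length xs ≡ length ys → ∀ {y} → y ∈ ys → y ∈ xs
  pigeonhole {xs} {ys} u v xs⊆ys len {y} y∈ with y ∈? xs
  ... | yes y∈xs = y∈xs
  ... | no  y∉xs = contradiction (trans (sym (∑-∉ y∉xs)) incidences≡1) λ ()
    where
    open ≡-Reasoning
    totals : ∑ ys (λ y → ∑ xs (λ x → ι (y ≟ x))) ≡ ∑ ys (λ _ → 1ℤ)
    totals = begin
      ∑ ys (λ y → ∑ xs (λ x → ι (y ≟ x)))  ≡⟨ ∑-swap ys xs _ ⟩
      ∑ xs (λ x → ∑ ys (λ y → ι (y ≟ x)))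
        ≡⟨ ∑-cong xs (λ {x} x∈ → trans (∑-cong′ ys λ y → ι-⇔ (y ≟ x) (x ≟ y) sym sym) (∑-count v (xs⊆ys x∈))) ⟩
      ∑ xs (λ _ → 1ℤ)                       ≡⟨ ∑-const xs 1ℤ ⟩
      ℤ.+ length xs ℤ.* 1ℤ                  ≡⟨ cong (λ n → ℤ.+ n ℤ.* 1ℤ) len ⟩
      ℤ.+ length ys ℤ.* 1ℤ                  ≡⟨ sym (∑-const ys 1ℤ) ⟩
      ∑ ys (λ _ → 1ℤ)                       ∎
    incidences≡1 : ∑ xs (λ x → ι (y ≟ x)) ≡ 1ℤ
    incidences≡1 = ∑-squeeze ys (λ {z} _ → ∑-ι≤1 u z) totals y∈

-- Arithmetic in a finite field

module FieldProperties (E : FiniteField) where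
  open FiniteField E
  open IsCommutativeRing isCommutativeRing public
    using (+-assoc; +-comm; +-identityˡ; +-identityʳ; -‿inverseʳ;
           *-assoc; *-comm; *-identityˡ; *-identityʳ; distribˡ; distribʳ; zeroˡ; zeroʳ)

  commutativeRing : CommutativeRing 0ℓ 0ℓ
  commutativeRing = record { isCommutativeRing = isCommutativeRing }

  private
    module R = CommutativeRing commutativeRing
    module P = Algebra.Properties.Ring R.ring
    module Exp = Algebra.Properties.Semiring.Exp R.semiring
    module CExp = Algebra.Properties.CommutativeSemiring.Exp R.commutativeSemiring
    module Mult′ = Algebra.Properties.Semiring.Mult.TCOptimised R.semiring

  -- The ring solver needs coefficients with computing arithmetic, hence the map from ℤ.
  private
    acr : AlmostCommutativeRing 0ℓ 0ℓ
    acr = fromCommutativeRing commutativeRing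

    -- With the optimised multiple, 1 × x reduces to x itself, so `con 1ℤ` denotes `1#` on the nose
    -- and the unit laws of `int-homo` are `refl`.
    nat : ℕ → Carrier
    nat n = n Mult′.× 1#

    int : ℤ → Carrier
    int (ℤ.+ n)      = nat n
    int (-[1+ n ]) = - nat (suc n)

    open ≡-Reasoning

    int-⊖ : ∀ m n → int (m ℤ.⊖ n) ≡ nat m + - nat n
    int-⊖ m zero = sym (trans (cong (nat m +_) P.-0#≈0#) (+-identityʳ _))
    int-⊖ zero (suc n) = sym (+-identityˡ _)
    int-⊖ (suc m) (suc n) = begin
      int (suc m ℤ.⊖ suc n)            ≡⟨ cong int (ℤ.[1+m]⊖[1+n]≡m⊖n m n) ⟩
      int (m ℤ.⊖ n)                    ≡⟨ int-⊖ m n ⟩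
      nat m + - nat n                  ≡⟨ cong (nat m +_) (sym (+-identityˡ _)) ⟩
      nat m + (0# + - nat n)           ≡⟨ cong (λ z → nat m + (z + - nat n)) (sym (-‿inverseʳ 1#)) ⟩
      nat m + (1# + - 1# + - nat n)    ≡⟨ cong (nat m +_) (+-assoc _ _ _) ⟩
      nat m + (1# + (- 1# + - nat n))  ≡⟨ sym (+-assoc _ _ _) ⟩
      nat m + 1# + (- 1# + - nat n)    ≡⟨ cong₂ _+_ (trans (+-comm _ _) (sym (Mult′.1+× m 1#)))
                                            (trans (P.-‿+-comm 1# (nat n)) (cong -_ (sym (Mult′.1+× n 1#)))) ⟩
      nat (suc m) + - nat (suc n)      ∎

    int-+ : ∀ i j → int (i ℤ.+ j) ≡ int i + int j
    int-+ (ℤ.+ m) (ℤ.+ n) = Mult′.×-homo-+ 1# m n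
    int-+ (ℤ.+ m) (-[1+ n ]) = int-⊖ m (suc n)
    int-+ (-[1+ m ]) (ℤ.+ n) = trans (int-⊖ n (suc m)) (+-comm _ _)
    int-+ (-[1+ m ]) (-[1+ n ]) = trans
      (cong -_ (trans (cong nat (cong suc (sym (ℕ.+-suc m n)))) (Mult′.×-homo-+ 1# (suc m) (suc n))))
      (sym (P.-‿+-comm _ _))

    int-neg : ∀ i → int (ℤ.- i) ≡ - int i
    int-neg (ℤ.+ zero)   = sym P.-0#≈0#
    int-neg (ℤ.+ suc n)  = refl
    int-neg (-[1+ n ]) = sym (P.-‿involutive _)

    int-*-nat : ∀ m j → int (ℤ.+ m ℤ.* j) ≡ nat m * int j
    int-*-nat m (ℤ.+ n) = trans (cong int (sym (ℤ.pos-* m n))) (Mult′.×1-homo-* m n)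
    int-*-nat m (-[1+ n ]) = begin
      int (ℤ.+ m ℤ.* -[1+ n ])         ≡⟨ cong int (sym (ℤ.neg-distribʳ-* (ℤ.+ m) (ℤ.+ suc n))) ⟩
      int (ℤ.- (ℤ.+ m ℤ.* ℤ.+ suc n))    ≡⟨ int-neg (ℤ.+ m ℤ.* ℤ.+ suc n) ⟩
      - int (ℤ.+ m ℤ.* ℤ.+ suc n)        ≡⟨ cong -_ (int-*-nat m (ℤ.+ suc n)) ⟩
      - (nat m * nat (suc n))        ≡⟨ P.-‿distribʳ-* _ _ ⟩
      nat m * - nat (suc n)          ∎

    int-* : ∀ i j → int (i ℤ.* j) ≡ int i * int j
    int-* (ℤ.+ m) j = int-*-nat m j
    int-* (-[1+ m ]) j = begin
      int (-[1+ m ] ℤ.* j)           ≡⟨ cong int (sym (ℤ.neg-distribˡ-* (ℤ.+ suc m) j)) ⟩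
      int (ℤ.- (ℤ.+ suc m ℤ.* j))      ≡⟨ int-neg (ℤ.+ suc m ℤ.* j) ⟩
      - int (ℤ.+ suc m ℤ.* j)          ≡⟨ cong -_ (int-*-nat (suc m) j) ⟩
      - (nat (suc m) * int j)        ≡⟨ P.-‿distribˡ-* _ _ ⟩
      - nat (suc m) * int j          ∎

    ℤ-rawRing : RawRing 0ℓ 0ℓ
    ℤ-rawRing = CommutativeRing.rawRing ℤ.+-*-commutativeRing

    int-homo : ℤ-rawRing -Raw-AlmostCommutative⟶ acr
    int-homo = record
      { ⟦_⟧ = int ; +-homo = int-+ ; *-homo = int-* ; -‿homo = int-neg
      ; 0-homo = refl ; 1-homo = refl }

    int≟ : ∀ i j → Maybe (Induced-equivalence int-homo i j)
    int≟ i j = Maybe.map (cong int) (dec⇒maybe (i ℤ.≟ j))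

  module Solver = Algebra.Solver.Ring ℤ-rawRing acr int-homo int≟
  open Solver using (_:+_; _:*_; :-_; _:=_; con; solve)

  fromℕ-+ : ∀ m n → fromℕ (m ℕ.+ n) ≡ fromℕ m + fromℕ n
  fromℕ-+ zero    n = sym (+-identityˡ _)
  fromℕ-+ (suc m) n = trans (cong (1# +_) (fromℕ-+ m n)) (sym (+-assoc _ _ _))

  fromℕ-* : ∀ m n → fromℕ (m ℕ.* n) ≡ fromℕ m * fromℕ n
  fromℕ-* zero    n = sym (zeroˡ _)
  fromℕ-* (suc m) n = begin
    fromℕ (n ℕ.+ m ℕ.* n)              ≡⟨ fromℕ-+ n (m ℕ.* n) ⟩
    fromℕ n + fromℕ (m ℕ.* n)          ≡⟨ cong₂ _+_ (sym (*-identityˡ _)) (fromℕ-* m n) ⟩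
    1# * fromℕ n + fromℕ m * fromℕ n   ≡⟨ sym (distribʳ _ _ _) ⟩
    (1# + fromℕ m) * fromℕ n           ∎

  fromℕ-^ : ∀ m k → fromℕ (m ℕ.^ k) ≡ pow (fromℕ m) k
  fromℕ-^ m zero    = +-identityʳ 1#
  fromℕ-^ m (suc k) = trans (fromℕ-* m (m ℕ.^ k)) (cong (fromℕ m *_) (fromℕ-^ m k))

  x*x⁻¹≡1 : ∀ {x} → x ≢ 0# → x * x ⁻¹ ≡ 1#
  x*x⁻¹≡1 = inverse _

  *-cancelˡ : ∀ {x y z} → x ≢ 0# → x * y ≡ x * z → y ≡ z
  *-cancelˡ {x} {y} {z} x≢0 eq = trans (expand y) (trans (cong (x ⁻¹ *_) eq) (sym (expand z)))
    where
    expand : ∀ w → w ≡ x ⁻¹ * (x * w)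
    expand w = begin
      w               ≡⟨ sym (*-identityˡ w) ⟩
      1# * w          ≡⟨ cong (_* w) (trans (sym (x*x⁻¹≡1 x≢0)) (*-comm _ _)) ⟩
      x ⁻¹ * x * w    ≡⟨ *-assoc _ _ _ ⟩
      x ⁻¹ * (x * w)  ∎

  no-zero-divisors : ∀ {x y} → x * y ≡ 0# → x ≡ 0# ⊎ y ≡ 0#
  no-zero-divisors {x} {y} eq with x ≟ 0#
  ... | yes x≡0 = inj₁ x≡0
  ... | no  x≢0 = inj₂ (*-cancelˡ x≢0 (trans eq (sym (zeroʳ x))))

  *-≢0 : ∀ {x y} → x ≢ 0# → y ≢ 0# → x * y ≢ 0#
  *-≢0 x≢0 y≢0 eq with no-zero-divisors eq
  ... | inj₁ x≡0 = x≢0 x≡0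
  ... | inj₂ y≡0 = y≢0 y≡0

  ⁻¹-≢0 : ∀ {x} → x ≢ 0# → x ⁻¹ ≢ 0#
  ⁻¹-≢0 {x} x≢0 eq = 0≢1 (trans (sym (trans (cong (x *_) eq) (zeroʳ x))) (x*x⁻¹≡1 x≢0))

  x-y≡0⇒x≡y : ∀ {x y} → x + - y ≡ 0# → x ≡ y
  x-y≡0⇒x≡y {x} {y} eq = trans
    (solve 2 (λ x y → x := x :+ :- y :+ y) refl x y) (trans (cong (_+ y) eq) (+-identityˡ y))

  x≡y⇒x-y≡0 : ∀ {x y} → x ≡ y → x + - y ≡ 0#
  x≡y⇒x-y≡0 {x} refl = -‿inverseʳ x

  square-roots : ∀ {x y} → x * x ≡ y * y → x ≡ y ⊎ x ≡ - y
  square-roots {x} {y} eq with no-zero-divisors {x + - y} {x + - - y}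
    (trans (solve 2 (λ x y → (x :+ :- y) :* (x :+ :- :- y) := x :* x :+ :- (y :* y)) refl x y) (x≡y⇒x-y≡0 eq))
  ... | inj₁ p = inj₁ (x-y≡0⇒x≡y p)
  ... | inj₂ p = inj₂ (x-y≡0⇒x≡y p)

  pow≡^ : ∀ x n → pow x n ≡ x Exp.^ n
  pow≡^ x zero    = refl
  pow≡^ x (suc n) = cong (x *_) (pow≡^ x n)

  pow-+ : ∀ x m n → pow x (m ℕ.+ n) ≡ pow x m * pow x n
  pow-+ x zero    n = sym (*-identityˡ _)
  pow-+ x (suc m) n = trans (cong (x *_) (pow-+ x m n)) (sym (*-assoc _ _ _))

  pow-∘ : ∀ x m n → pow (pow x m) n ≡ pow x (m ℕ.* n)
  pow-∘ x m n = begin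
    pow (pow x m) n       ≡⟨ pow≡^ (pow x m) n ⟩
    pow x m Exp.^ n       ≡⟨ cong (Exp._^ n) (pow≡^ x m) ⟩
    (x Exp.^ m) Exp.^ n   ≡⟨ Exp.^-assocʳ x m n ⟩
    x Exp.^ (m ℕ.* n)     ≡⟨ sym (pow≡^ x (m ℕ.* n)) ⟩
    pow x (m ℕ.* n)       ∎

  pow-swap : ∀ x m n → pow (pow x m) n ≡ pow (pow x n) m
  pow-swap x m n = trans (pow-∘ x m n) (trans (cong (pow x) (ℕ.*-comm m n)) (sym (pow-∘ x n m)))

  pow-distrib-* : ∀ x y n → pow (x * y) n ≡ pow x n * pow y n
  pow-distrib-* x y n = trans (pow≡^ (x * y) n)
    (trans (CExp.^-distrib-* x y n) (cong₂ _*_ (sym (pow≡^ x n)) (sym (pow≡^ y n))))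

  pow-1# : ∀ n → pow 1# n ≡ 1#
  pow-1# zero    = refl
  pow-1# (suc n) = trans (*-identityˡ _) (pow-1# n)

  pow-0# : ∀ n → pow 0# (suc n) ≡ 0#
  pow-0# n = zeroˡ _

  pow-≢0 : ∀ {x} n → x ≢ 0# → pow x n ≢ 0#
  pow-≢0 zero    x≢0 = 0≢1 ∘ sym
  pow-≢0 (suc n) x≢0 = *-≢0 x≢0 (pow-≢0 n x≢0)

  pow-zero : ∀ {x} n → x ≡ 0# → 0 ℕ.< n → pow x n ≡ 0#
  pow-zero (suc n) refl _ = pow-0# n

  pow-⁻¹ : ∀ {x} n → x ≢ 0# → pow (x ⁻¹) n ≡ (pow x n) ⁻¹
  pow-⁻¹ {x} n x≢0 = *-cancelˡ (pow-≢0 n x≢0) (begin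
    pow x n * pow (x ⁻¹) n   ≡⟨ sym (pow-distrib-* x (x ⁻¹) n) ⟩
    pow (x * x ⁻¹) n         ≡⟨ cong (λ z → pow z n) (x*x⁻¹≡1 x≢0) ⟩
    pow 1# n                 ≡⟨ pow-1# n ⟩
    1#                       ≡⟨ sym (x*x⁻¹≡1 (pow-≢0 n x≢0)) ⟩
    pow x n * pow x n ⁻¹     ∎)

  pow-difference : ∀ {x i j} → x ≢ 0# → i ℕ.≤ j → pow x i ≡ pow x j → pow x (j ℕ.∸ i) ≡ 1#
  pow-difference {x} {i} {j} x≢0 i≤j eq = *-cancelˡ (pow-≢0 i x≢0) (begin
    pow x i * pow x (j ℕ.∸ i)   ≡⟨ sym (pow-+ x i _) ⟩
    pow x (i ℕ.+ (j ℕ.∸ i))     ≡⟨ cong (pow x) (ℕ.m+[n∸m]≡n i≤j) ⟩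
    pow x j                     ≡⟨ sym eq ⟩
    pow x i                     ≡⟨ sym (*-identityʳ _) ⟩
    pow x i * 1#                ∎)

-- Characteristic p

prime∤1 : ∀ {p} → Prime p → ¬ (p ∣ 1)
prime∤1 pp p∣1 = ℕ.<⇒≱ (ℕ.nonTrivial⇒n>1 _ {{prime⇒nonTrivial pp}}) (∣⇒≤ p∣1)

prime∣!⇒≤ : ∀ {p} → Prime p → ∀ k → p ∣ (k ℕ.!) → p ℕ.≤ k
prime∣!⇒≤ pp zero    p∣1 = contradiction p∣1 (prime∤1 pp)
prime∣!⇒≤ pp (suc k) p∣k! with euclidsLemma (suc k) (k ℕ.!) pp p∣k!
... | inj₁ p∣k  = ∣⇒≤ p∣k
... | inj₂ p∣k! = ℕ.m≤n⇒m≤1+n (prime∣!⇒≤ pp k p∣k!)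

-- p divides p! = (p C k) · k! (p - k)!, but neither factorial, as all their factors are smaller
-- than p.
prime∣pCk : ∀ {p k} → Prime p → 0 ℕ.< k → k ℕ.< p → p ∣ (p C k)
prime∣pCk {p} {k} pp 0<k k<p with euclidsLemma (p C k) (k ℕ.! ℕ.* (p ℕ.∸ k) ℕ.!) pp p∣product
  where
  instance _ = k ℕ.!* (p ℕ.∸ k) !≢0
  n∣n! : ∀ {n} → ℕ.NonZero n → n ∣ (n ℕ.!)
  n∣n! {suc n} _ = m∣m*n _
  p∣product : p ∣ (p C k) ℕ.* (k ℕ.! ℕ.* (p ℕ.∸ k) ℕ.!)
  p∣product = subst (p ∣_) (sym (trans (cong (ℕ._* (k ℕ.! ℕ.* (p ℕ.∸ k) ℕ.!)) (nCk≡n!/k![n-k]! (ℕ.<⇒≤ k<p)))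
    (m/n*n≡m (k![n∸k]!∣n! (ℕ.<⇒≤ k<p))))) (n∣n! (prime⇒nonZero pp))
... | inj₁ p∣C = p∣C
... | inj₂ p∣! with euclidsLemma (k ℕ.!) ((p ℕ.∸ k) ℕ.!) pp p∣!
...   | inj₁ p∣k! = contradiction (prime∣!⇒≤ pp k p∣k!) (ℕ.<⇒≱ k<p)
...   | inj₂ p∣!′ = contradiction (prime∣!⇒≤ pp (p ℕ.∸ k) p∣!′) (ℕ.<⇒≱ (ℕ.∸-monoʳ-< 0<k (ℕ.<⇒≤ k<p)))

module Characteristic (E : FiniteField) {p : ℕ} (p-prime : Prime p)
                      {k : ℕ} (card≡p^k : FiniteField.card E ≡ p ℕ.^ k) where
  open FiniteField E
  open FieldProperties E
  open Solver using (_:+_; _:*_; :-_; _:=_; con; solve)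
  private
    module R = CommutativeRing commutativeRing
    module Bin = Algebra.Properties.CommutativeSemiring.Binomial R.commutativeSemiring
    module Sum = Algebra.Properties.Monoid.Sum R.+-monoid
    module Mult = Algebra.Properties.Monoid.Mult R.+-monoid
  open ≡-Reasoning

  -- Translation by 1 permutes the field, so it preserves the sum of all elements.
  fromℕ-card : fromℕ card ≡ 0#
  fromℕ-card = begin
    fromℕ card                                ≡⟨ solve 2 (λ x y → x := x :+ y :+ :- y) refl _ _ ⟩
    fromℕ card + total elements + - total elements  ≡⟨ cong (_+ - total elements) (sym (total-translate elements)) ⟩
    total (map (1# +_) elements) + - total elements ≡⟨ cong (_+ - total elements) (total-↭ shift↭) ⟩
    total elements + - total elements               ≡⟨ -‿inverseʳ _ ⟩
    0# ∎
    where
    total : List Carrier → Carrier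
    total = foldr _+_ 0#

    total-translate : ∀ xs → total (map (1# +_) xs) ≡ fromℕ (length xs) + total xs
    total-translate []       = sym (+-identityˡ 0#)
    total-translate (x ∷ xs) = trans (cong (1# + x +_) (total-translate xs))
      (solve 4 (λ a b c d → a :+ b :+ (c :+ d) := a :+ c :+ (b :+ d)) refl 1# x _ _)

    total-↭ : ∀ {xs ys} → xs ↭ ys → total xs ≡ total ys
    total-↭ = Permutationₛ.foldr-commMonoid (setoid Carrier) R.+-isCommutativeMonoid ∘ ↭⇒↭ₛ

    cancel : ∀ y → 1# + (- 1# + y) ≡ y
    cancel = solve 1 (λ y → con (ℤ.+ 1) :+ (:- con (ℤ.+ 1) :+ y) := y) refl

    cancel′ : ∀ y → - 1# + (1# + y) ≡ y
    cancel′ = solve 1 (λ y → :- con (ℤ.+ 1) :+ (con (ℤ.+ 1) :+ y) := y) refl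

    shift↭ : map (1# +_) elements ↭ elements
    shift↭ = ∼bag⇒↭ (unique∧set⇒bag
      (Unique.map⁺ (λ {x} {y} eq → trans (sym (cancel′ x)) (trans (cong (- 1# +_) eq) (cancel′ y))) unique)
      unique
      (λ {y} → mk⇔ (λ _ → complete y)
        (λ _ → subst (_∈ map (1# +_) elements) (cancel y) (∈-map⁺ (1# +_) (complete (- 1# + y))))))

  -- The cardinality p^k vanishes in the field by `fromℕ-card`, and a field has no nonzero
  -- nilpotents.
  fromℕ-p : fromℕ p ≡ 0#
  fromℕ-p with fromℕ p ≟ 0#
  ... | yes eq = eq
  ... | no  p≢0 = contradiction
    (trans (sym (fromℕ-^ p k)) (trans (cong fromℕ (sym card≡p^k)) fromℕ-card)) (pow-≢0 k p≢0)

  p∣n⇒n×x≡0 : ∀ {n} → p ∣ n → ∀ x → n Mult.× x ≡ 0#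
  p∣n⇒n×x≡0 (divides c refl) x = begin
    (c ℕ.* p) Mult.× x          ≡⟨ sym (×≡fromℕ* (c ℕ.* p) x) ⟩
    fromℕ (c ℕ.* p) * x         ≡⟨ cong (_* x) (fromℕ-* c p) ⟩
    fromℕ c * fromℕ p * x       ≡⟨ cong (λ z → fromℕ c * z * x) fromℕ-p ⟩
    fromℕ c * 0# * x            ≡⟨ trans (cong (_* x) (zeroʳ _)) (zeroˡ x) ⟩
    0# ∎
    where
    ×≡fromℕ* : ∀ n x → fromℕ n * x ≡ n Mult.× x
    ×≡fromℕ* zero    x = zeroˡ x
    ×≡fromℕ* (suc n) x = trans (distribʳ _ _ _) (cong₂ _+_ (*-identityˡ x) (×≡fromℕ* n x))

  frobenius-p : ∀ x y → pow (x + y) p ≡ pow x p + pow y p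
  frobenius-p x y = expand p refl
    where
    -- The exponent is generalised so that it can be matched as a successor, which splits off the
    -- first and last binomial terms. All inner terms carry a coefficient divisible by p.
    expand : ∀ P → P ≡ p → pow (x + y) P ≡ pow x P + pow y P
    expand zero      P≡p = contradiction (subst Prime (sym P≡p) p-prime) λ pp → contradiction (prime⇒nonZero pp) λ ()
    expand P@(suc n) P≡p = begin
      pow (x + y) P                           ≡⟨ trans (pow≡^ (x + y) P) (Bin.theorem P x y) ⟩
      t Fin.zero + Sum.sum (t ∘ Fin.suc)      ≡⟨ cong (t Fin.zero +_) (Sum.sum-init-last (t ∘ Fin.suc)) ⟩
      t Fin.zero + (Sum.sum (Vector.init (t ∘ Fin.suc)) + t (Fin.fromℕ P))
        ≡⟨ cong₂ (λ a b → t Fin.zero + (a + b)) (trans (Sum.sum-cong-≗ inner) (Sum.sum-replicate-zero n)) last≡ ⟩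
      t Fin.zero + (0# + pow x P)             ≡⟨ cong₂ _+_ first≡ (+-identityˡ _) ⟩
      pow y P + pow x P                       ≡⟨ +-comm _ _ ⟩
      pow x P + pow y P ∎
      where
      t : Fin (suc P) → Carrier
      t = Bin.binomialTerm x y P

      first≡ : t Fin.zero ≡ pow y P
      first≡ = trans (+-identityʳ _) (trans (*-identityˡ _) (sym (pow≡^ y P)))

      last≡ : t (Fin.fromℕ P) ≡ pow x P
      last≡ = begin
        t (Fin.fromℕ P)
          ≡⟨ cong (λ m → (P C m) Mult.× ((x ^ m) * (y ^ (P ℕ.∸ m)))) (Fin.toℕ-fromℕ P) ⟩
        (P C P) Mult.× ((x ^ P) * (y ^ (P ℕ.∸ P)))
          ≡⟨ cong₂ (λ a b → a Mult.× ((x ^ P) * (y ^ b))) (nCn≡1 P) (ℕ.n∸n≡0 P) ⟩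
        (x ^ P) * 1# + 0#
          ≡⟨ trans (+-identityʳ _) (trans (*-identityʳ _) (sym (pow≡^ x P))) ⟩
        pow x P ∎
        where open import Algebra.Properties.Semiring.Exp R.semiring using (_^_)

      inner : ∀ i → t (Fin.suc (Fin.inject₁ i)) ≡ 0#
      inner i = p∣n⇒n×x≡0 (subst (_∣ (P C suc (Fin.toℕ (Fin.inject₁ i)))) P≡p
          (prime∣pCk (subst Prime (sym P≡p) p-prime) ℕ.z<s (ℕ.s<s (subst (ℕ._< n) (sym (Fin.toℕ-inject₁ i)) (Fin.toℕ<n i))))) _

  frobenius : ∀ j x y → pow (x + y) (p ℕ.^ j) ≡ pow x (p ℕ.^ j) + pow y (p ℕ.^ j)
  frobenius zero x y = solve 2 (λ x y → (x :+ y) :* con (ℤ.+ 1) := x :* con (ℤ.+ 1) :+ y :* con (ℤ.+ 1)) refl x y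
  frobenius (suc j) x y = begin
    pow (x + y) (p ℕ.* p ℕ.^ j)                  ≡⟨ sym (pow-∘ (x + y) p (p ℕ.^ j)) ⟩
    pow (pow (x + y) p) (p ℕ.^ j)                ≡⟨ cong (λ z → pow z (p ℕ.^ j)) (frobenius-p x y) ⟩
    pow (pow x p + pow y p) (p ℕ.^ j)            ≡⟨ frobenius j _ _ ⟩
    pow (pow x p) (p ℕ.^ j) + pow (pow y p) (p ℕ.^ j) ≡⟨ cong₂ _+_ (pow-∘ x p _) (pow-∘ y p _) ⟩
    pow x (p ℕ.* p ℕ.^ j) + pow y (p ℕ.* p ℕ.^ j) ∎

-- Parity and geometric sums

data Parity : ℕ → Set where
  even : ∀ k → Parity (2 ℕ.* k)
  odd  : ∀ k → Parity (suc (2 ℕ.* k))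

parity : ∀ n → Parity n
parity zero = even 0
parity (suc n) with parity n
... | even k = odd k
... | odd k  = subst Parity (sym (eq k)) (even (suc k))
  where
  eq : ∀ k → suc (suc (2 ℕ.* k)) ≡ 2 ℕ.* suc k
  eq = ℕ-solver.solve-∀

sign : ℕ → ℤ
sign n = -1ℤ ℤ.^ n

sign-+ : ∀ m n → sign (m ℕ.+ n) ≡ sign m ℤ.* sign n
sign-+ = ℤ.^-distribˡ-+-* -1ℤ

sign-2* : ∀ k → sign (2 ℕ.* k) ≡ 1ℤ
sign-2* k = trans (sym (ℤ.^-*-assoc -1ℤ 2 k)) (ℤ.^-zeroˡ k)

sign-1+2* : ∀ k → sign (suc (2 ℕ.* k)) ≡ -1ℤ
sign-1+2* k = cong (-1ℤ ℤ.*_) (sign-2* k)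

sign² : ∀ n → sign n ℤ.* sign n ≡ 1ℤ
sign² n = trans (sym (sign-+ n n)) (trans (cong sign (cong (n ℕ.+_) (sym (ℕ.+-identityʳ n)))) (sign-2* n))

-- This is (q^m - 1)/(q - 1) without a division. It is the exponent of the norm to 𝔽_q (`Nm≡pow`)
-- and the index of the multiplicative group of 𝔽_q in that of 𝔽_{q^m}.
geo : ℕ → ℕ → ℕ
geo q zero    = 0
geo q (suc m) = geo q m ℕ.+ q ℕ.^ m

geo-sum : ∀ n m → suc (n ℕ.* geo (suc n) m) ≡ suc n ℕ.^ m
geo-sum n zero    = cong suc (ℕ.*-zeroʳ n)
geo-sum n (suc m) = trans (cong suc (ℕ.*-distribˡ-+ n _ _)) (cong (ℕ._+ n ℕ.* suc n ℕ.^ m) (geo-sum n m))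

geo>0 : ∀ n {m} → 0 < m → 0 < geo (suc n) m
geo>0 n {suc m} _ = ℕ.<-≤-trans (ℕ.m^n>0 (suc n) m) (ℕ.m≤n+m _ (geo (suc n) m))

odd^ : ∀ h m → ∃ λ k → suc (2 ℕ.* h) ℕ.^ m ≡ suc (2 ℕ.* k)
odd^ h m = h ℕ.* geo (suc (2 ℕ.* h)) m , trans (sym (geo-sum (2 ℕ.* h) m)) (cong suc (ℕ.*-assoc 2 h _))

-- A sum of m odd powers has the parity of m. Applied with base q^t, this is how the parity of e
-- reaches the norm condition.
sign-geo : ∀ h m → sign (geo (suc (2 ℕ.* h)) m) ≡ sign m
sign-geo h zero    = refl
sign-geo h (suc m) with k , eq ← odd^ h m = trans (sign-+ (geo (suc (2 ℕ.* h)) m) _)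
  (trans (cong₂ ℤ._*_ (sign-geo h m) (trans (cong sign eq) (sign-1+2* k))) (ℤ.*-comm (sign m) -1ℤ))

-- Generators of the multiplicative group

unique-map : {A B : Set} (f : A → B) {xs : List A} → Unique xs →
             (∀ {x y} → x ∈ xs → y ∈ xs → f x ≡ f y → x ≡ y) → Unique (map f xs)
unique-map f [] inj = []
unique-map f {x ∷ xs} (x∉ ∷ u) inj =
  All.tabulate (λ {z} z∈ fx≡z → let y , y∈ , z≡fy = ∈-map⁻ f z∈ in
    All.lookup x∉ y∈ (inj (here refl) (there y∈) (trans fx≡z z≡fy)))
  ∷ unique-map f u (λ a b → inj (there a) (there b))

module Generators (E : FiniteField) where
  open FiniteField E
  open FieldProperties E

  -- The field `log` concerns only the roots of X^(N+1) - X, so the record describes a generator of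
  -- the multiplicative group of a subfield with N + 1 elements. It serves γ itself as well as its
  -- powers that generate L and K.
  record IsGenerator (N : ℕ) (θ : Carrier) : Set where
    field
      N>0      : 0 < N
      pow-N    : pow θ N ≡ 1#
      minimal  : ∀ {k} → 0 < k → k < N → pow θ k ≢ 1#
      log      : ∀ {x} → x ≢ 0# → pow x (suc N) ≡ x → ∃ λ j → j < N × pow θ j ≡ x

    θ≢0 : θ ≢ 0#
    θ≢0 θ≡0 = 0≢1 (trans (sym (pow-zero N θ≡0 N>0)) pow-N)

    pow-suc-N : ∀ j → pow (pow θ j) (suc N) ≡ pow θ j
    pow-suc-N j = trans (cong (pow θ j *_)
      (trans (pow-swap θ j N) (trans (cong (λ x → pow x j) pow-N) (pow-1# j)))) (*-identityʳ _)

    pow≡1⇒∣ : ∀ {k} → pow θ k ≡ 1# → N ∣ k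
    pow≡1⇒∣ {k} eq with k % N in r | pow-remainder
      where
      instance _ = ℕ.>-nonZero N>0
      pow-remainder : pow θ (k % N) ≡ 1#
      pow-remainder = begin
        pow θ (k % N)                          ≡⟨ sym (*-identityʳ _) ⟩
        pow θ (k % N) * 1#                     ≡⟨ cong (pow θ (k % N) *_) (sym (trans
             (cong (pow θ) (ℕ.*-comm (k / N) N)) (trans (sym (pow-∘ θ N (k / N)))
             (trans (cong (λ x → pow x (k / N)) pow-N) (pow-1# (k / N)))))) ⟩
        pow θ (k % N) * pow θ (k / N ℕ.* N)    ≡⟨ sym (pow-+ θ (k % N) _) ⟩
        pow θ (k % N ℕ.+ k / N ℕ.* N)          ≡⟨ cong (pow θ) (sym (m≡m%n+[m/n]*n k N)) ⟩
        pow θ k                                ≡⟨ eq ⟩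
        1# ∎
        where open ≡-Reasoning
    ... | zero  | _   = m%n≡0⇒n∣m k N {{ℕ.>-nonZero N>0}} r
    ... | suc m | eq′ = contradiction eq′
      (minimal ℕ.z<s (subst (_< N) r (m%n<n k N {{ℕ.>-nonZero N>0}})))

    injective : ∀ {i j} → i < N → j < N → pow θ i ≡ pow θ j → i ≡ j
    injective {i} {j} i<N j<N eq with ℕ.<-cmp i j
    ... | tri≈ _ i≡j _ = i≡j
    ... | tri< i<j _ _ = contradiction (pow-difference θ≢0 (ℕ.<⇒≤ i<j) eq)
      (minimal (ℕ.m<n⇒0<n∸m i<j) (ℕ.≤-<-trans (ℕ.m∸n≤m j i) j<N))
    ... | tri> _ _ j<i = contradiction (pow-difference θ≢0 (ℕ.<⇒≤ j<i) (sym eq))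
      (minimal (ℕ.m<n⇒0<n∸m j<i) (ℕ.≤-<-trans (ℕ.m∸n≤m i j) i<N))

  -- `Primitive` only says that 1 is not reached too early. This makes 0 and the first M powers of γ
  -- distinct; they are as many as the field has elements, so by `pigeonhole` they exhaust it.
  primitive⇒generator : ∀ {M γ} → card ≡ suc M → Primitive γ → IsGenerator M γ
  primitive⇒generator {M} {γ} card≡ (γ≢0 , min) = record
    { N>0 = M>0 ; pow-N = pow-M ; minimal = minimal ; log = λ x≢0 _ → log x≢0 }
    where
    minimal : ∀ {k} → 0 < k → k < M → pow γ k ≢ 1#
    minimal {k} 0<k k<M = min k 0<k (subst (λ c → k < c ℕ.∸ 1) (sym card≡) k<M)

    inj-< : ∀ {i j} → i < j → j < M → pow γ i ≢ pow γ j
    inj-< {i} {j} i<j j<M eq = minimal (ℕ.m<n⇒0<n∸m i<j) (ℕ.≤-<-trans (ℕ.m∸n≤m j i) j<M)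
      (pow-difference γ≢0 (ℕ.<⇒≤ i<j) eq)

    inj : ∀ {i j} → i ∈ upTo M → j ∈ upTo M → pow γ i ≡ pow γ j → i ≡ j
    inj {i} {j} i∈ j∈ eq with ℕ.<-cmp i j
    ... | tri≈ _ i≡j _ = i≡j
    ... | tri< i<j _ _ = contradiction eq (inj-< i<j (∈-upTo⁻ j∈))
    ... | tri> _ _ j<i = contradiction (sym eq) (inj-< j<i (∈-upTo⁻ i∈))

    powers : List Carrier
    powers = 0# ∷ map (pow γ) (upTo M)

    powers-unique : Unique powers
    powers-unique = All.tabulate (λ z∈ 0≡z → let i , _ , z≡ = ∈-map⁻ (pow γ) z∈ in
        pow-≢0 i γ≢0 (trans (sym z≡) (sym 0≡z)))
      ∷ unique-map (pow γ) (Unique.upTo⁺ M) inj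

    powers-length : length powers ≡ card
    powers-length = trans (cong suc (trans (length-map (pow γ) (upTo M)) (length-upTo M))) (sym card≡)

    log : ∀ {x} → x ≢ 0# → ∃ λ j → j < M × pow γ j ≡ x
    log {x} x≢0 with Reindexing.pigeonhole _≟_ powers-unique unique (λ {z} _ → complete z) powers-length (complete x)
    ... | here x≡0 = contradiction x≡0 x≢0
    ... | there x∈ = let j , j∈ , x≡ = ∈-map⁻ (pow γ) x∈ in j , ∈-upTo⁻ j∈ , sym x≡

    M>0 : 0 < M
    M>0 = let j , j<M , _ = log γ≢0 in ℕ.≤-<-trans ℕ.z≤n j<M

    pow-M : pow γ M ≡ 1#
    -- γ^M is nonzero, hence equal to γ^j with j < M; a positive j would give γ^(M - j) = 1 before
    -- the exponent M.
    pow-M with log (pow-≢0 M γ≢0)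
    ... | zero  , _   , eq = sym eq
    ... | suc j , j<M , eq = contradiction (pow-difference γ≢0 (ℕ.<⇒≤ j<M) eq)
      (minimal (ℕ.m<n⇒0<n∸m j<M) (ℕ.∸-monoʳ-< ℕ.z<s (ℕ.<⇒≤ j<M)))

  -- If x = γ^i satisfies x^N = 1, then N D divides i N, so D divides i and x is a power of γ^D.
  generator-pow : ∀ {N D γ} → 0 < N → 0 < D → IsGenerator (N ℕ.* D) γ → IsGenerator N (pow γ D)
  generator-pow {N} {D} {γ} N>0 D>0 gen = record
    { N>0 = N>0
    ; pow-N = trans (pow-∘ γ D N) (trans (cong (pow γ) (ℕ.*-comm D N)) G.pow-N)
    ; minimal = λ {k} 0<k k<N eq → G.minimal (ℕ.*-mono-< D>0 0<k)
        (subst (D ℕ.* k <_) (ℕ.*-comm D N) (ℕ.*-monoʳ-< D k<N)) (trans (sym (pow-∘ γ D k)) eq)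
    ; log = log }
    where
    module G = IsGenerator gen
    instance
      _ = ℕ.>-nonZero D>0
      _ = ℕ.>-nonZero N>0

    log : ∀ {x} → x ≢ 0# → pow x (suc N) ≡ x → ∃ λ j → j < N × pow (pow γ D) j ≡ x
    log {x} x≢0 x∈ = from (G.log x≢0 (trans (cong (x *_) (trans (sym (pow-∘ x N D))
        (trans (cong (λ y → pow y D) x^N≡1) (pow-1# D)))) (*-identityʳ x)))
      where
      x^N≡1 : pow x N ≡ 1#
      x^N≡1 = *-cancelˡ x≢0 (trans x∈ (sym (*-identityʳ x)))

      from : (∃ λ i → i < N ℕ.* D × pow γ i ≡ x) → ∃ λ j → j < N × pow (pow γ D) j ≡ x
      from (i , i<ND , γ^i≡x) with *-cancelˡ-∣ {D} {i} N (subst (N ℕ.* D ∣_) (ℕ.*-comm i N)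
        (G.pow≡1⇒∣ (trans (sym (pow-∘ γ i N)) (trans (cong (λ y → pow y N) γ^i≡x) x^N≡1))))
      ... | divides j refl = j , ℕ.*-cancelʳ-< D j N i<ND ,
        trans (pow-∘ γ D j) (trans (cong (pow γ) (ℕ.*-comm D j)) γ^i≡x)

-- Subfields and the quadratic character

any-true : {A : Set} (b : A → Bool) (xs : List A) → ∀ {x} → x ∈ xs → T (b x) → any b xs ≡ true
any-true b xs x∈ bx = Equivalence.to T-≡ (any⁺ b (lose x∈ bx))

any-false : {A : Set} (b : A → Bool) (xs : List A) → (∀ {x} → x ∈ xs → ¬ T (b x)) → any b xs ≡ false
any-false b xs ¬b with any b xs in eq
... | false = refl
... | true  = let x , x∈ , bx = find (any⁻ b xs (Equivalence.from T-≡ eq)) in contradiction bx (¬b x∈)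

module QuadraticCharacter (E : FiniteField) where
  open FiniteField E
  open FieldProperties E
  open Generators E
  open Reindexing _≟_
  open Solver using (_:+_; _:*_; :-_; _:=_; con; solve)

  subfield : ℕ → List Carrier
  subfield Q = filter (λ x → pow x Q ≟ x) elements

  subfield-unique : ∀ Q → Unique (subfield Q)
  subfield-unique Q = Unique.filter⁺ (λ x → pow x Q ≟ x) unique

  ∈-subfield⁺ : ∀ Q {x} → pow x Q ≡ x → x ∈ subfield Q
  ∈-subfield⁺ Q {x} eq = ∈-filter⁺ (λ x → pow x Q ≟ x) (complete x) eq

  ∈-subfield⁻ : ∀ Q {x} → x ∈ subfield Q → pow x Q ≡ x
  ∈-subfield⁻ Q x∈ = proj₂ (∈-filter⁻ (λ x → pow x Q ≟ x) {xs = elements} x∈)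

  ρ-0 : ∀ Q → ρ Q 0# ≡ 0ℤ
  ρ-0 Q with 0# ≟ 0#
  ... | yes _  = refl
  ... | no 0≢0 = contradiction refl 0≢0

  ρ-square : ∀ Q {y} → y ∈ subfield Q → y ≢ 0# → ρ Q (y * y) ≡ 1ℤ
  ρ-square Q {y} y∈ y≢0 with (y * y) ≟ 0#
  ... | yes y²≡0 = contradiction y²≡0 (*-≢0 y≢0 y≢0)
  ... | no _ = cong (λ b → if b then 1ℤ else -1ℤ) (any-true (λ z → inSub Q 1 z ∧ ⌊ (z * z) ≟ (y * y) ⌋) elements (complete y)
    (Equivalence.from T-∧ (fromWitness (trans (cong (pow y) (ℕ.^-identityʳ Q)) (∈-subfield⁻ Q y∈))
      , fromWitness {a? = (y * y) ≟ (y * y)} refl)))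

  ρ-nonsquare : ∀ Q {x} → x ≢ 0# → (∀ {y} → y ∈ subfield Q → y * y ≢ x) → ρ Q x ≡ -1ℤ
  ρ-nonsquare Q {x} x≢0 ¬sq with x ≟ 0#
  ... | yes x≡0 = contradiction x≡0 x≢0
  ... | no _ = cong (λ b → if b then 1ℤ else -1ℤ) (any-false (λ y → inSub Q 1 y ∧ ⌊ (y * y) ≟ x ⌋) elements (λ {y} _ Ty →
    let y∈ , y²≡x = Equivalence.to T-∧ Ty in
    ¬sq (∈-subfield⁺ Q (trans (cong (pow y) (sym (ℕ.^-identityʳ Q))) (toWitness y∈)))
        (toWitness {a? = (y * y) ≟ x} y²≡x)))

  -- Everything here is derived from the cyclic group generated by θ; the characteristic is not
  -- mentioned. The module is instantiated for L, for K, and for K once more with the generator g.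
  module OddSubfield {Q N H : ℕ} {θ : Carrier} (Q≡ : Q ≡ suc N) (N≡ : N ≡ 2 ℕ.* H)
                     (θ-generator : IsGenerator N θ) where
    open IsGenerator θ-generator

    F : List Carrier
    F = subfield Q

    0∈F : 0# ∈ F
    0∈F = ∈-subfield⁺ Q (pow-zero Q refl (subst (0 <_) (sym Q≡) ℕ.z<s))

    pow∈F : ∀ j → pow θ j ∈ F
    pow∈F j = ∈-subfield⁺ Q (trans (cong (pow (pow θ j)) Q≡) (pow-suc-N j))

    1∈F : 1# ∈ F
    1∈F = pow∈F 0

    *∈F : ∀ {x y} → x ∈ F → y ∈ F → x * y ∈ F
    *∈F {x} {y} x∈ y∈ = ∈-subfield⁺ Q (trans (pow-distrib-* x y Q) (cong₂ _*_ (∈-subfield⁻ Q x∈) (∈-subfield⁻ Q y∈)))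

    ⁻¹∈F : ∀ {x} → x ∈ F → x ≢ 0# → x ⁻¹ ∈ F
    ⁻¹∈F {x} x∈ x≢0 = ∈-subfield⁺ Q (trans (pow-⁻¹ Q x≢0) (cong _⁻¹ (∈-subfield⁻ Q x∈)))

    logarithm : ∀ {x} → x ∈ F → x ≢ 0# → ∃ λ j → j < N × pow θ j ≡ x
    logarithm {x} x∈ x≢0 = log x≢0 (trans (cong (pow x) (sym Q≡)) (∈-subfield⁻ Q x∈))

    size : ∑ F (λ _ → 1ℤ) ≡ ℤ.+ Q
    size = begin
      ∑ F (λ _ → 1ℤ)            ≡⟨ ∑-⊆⊇ (subfield-unique Q) powers-unique F⊆powers powers⊆F _ ⟩
      ∑ powers (λ _ → 1ℤ)       ≡⟨ ∑-const powers 1ℤ ⟩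
      ℤ.+ length powers ℤ.* 1ℤ  ≡⟨ ℤ.*-identityʳ _ ⟩
      ℤ.+ length powers         ≡⟨ cong (λ n → ℤ.+ suc n) (trans (length-map (pow θ) (upTo N)) (length-upTo N)) ⟩
      ℤ.+ suc N                 ≡⟨ cong ℤ.+_ (sym Q≡) ⟩
      ℤ.+ Q                     ∎
      where
      open ≡-Reasoning
      powers : List Carrier
      powers = 0# ∷ map (pow θ) (upTo N)

      powers-unique : Unique powers
      powers-unique = All.tabulate (λ z∈ 0≡z → let i , _ , z≡ = ∈-map⁻ (pow θ) z∈ in
          pow-≢0 i θ≢0 (trans (sym z≡) (sym 0≡z)))
        ∷ unique-map (pow θ) (Unique.upTo⁺ N) (λ i∈ j∈ → injective (∈-upTo⁻ i∈) (∈-upTo⁻ j∈))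

      F⊆powers : ∀ {x} → x ∈ F → x ∈ powers
      F⊆powers {x} x∈ with x ≟ 0#
      ... | yes x≡0 = here x≡0
      ... | no x≢0  = let j , j<N , eq = logarithm x∈ x≢0 in
        there (subst (_∈ map (pow θ) (upTo N)) eq (∈-map⁺ (pow θ) (∈-upTo⁺ j<N)))

      powers⊆F : ∀ {x} → x ∈ powers → x ∈ F
      powers⊆F (here refl) = 0∈F
      powers⊆F (there x∈) = let j , _ , eq = ∈-map⁻ (pow θ) x∈ in subst (_∈ F) (sym eq) (pow∈F j)

    H>0 : 0 < H
    H>0 = ℕ.n≢0⇒n>0 λ H≡0 → ℕ.<⇒≢ N>0 (sym (trans N≡ (cong (2 ℕ.*_) H≡0)))

    H<N : H < N
    H<N = subst (H <_) (trans (cong (H ℕ.+_) (sym (ℕ.+-identityʳ H))) (sym N≡)) (ℕ.m<m+n H H>0)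

    θ^H : Carrier
    θ^H = pow θ H

    θ^H≢1 : θ^H ≢ 1#
    θ^H≢1 = minimal H>0 H<N

    pow-θ^H-2* : ∀ k → pow θ^H (2 ℕ.* k) ≡ 1#
    pow-θ^H-2* k = begin
      pow θ^H (2 ℕ.* k)       ≡⟨ sym (pow-∘ θ^H 2 k) ⟩
      pow (pow θ^H 2) k       ≡⟨ cong (λ x → pow x k) (trans (pow-∘ θ H 2) (cong (pow θ) (trans (ℕ.*-comm H 2) (sym N≡)))) ⟩
      pow (pow θ N) k         ≡⟨ cong (λ x → pow x k) pow-N ⟩
      pow 1# k                ≡⟨ pow-1# k ⟩
      1# ∎
      where open ≡-Reasoning

    -- Euler's criterion: raising to the power H sends even powers of θ to 1 and odd powers to θ^H,
    -- which is not 1.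
    θ^even≢θ^odd : ∀ i k → pow θ (2 ℕ.* i) ≢ pow θ (suc (2 ℕ.* k))
    θ^even≢θ^odd i k eq = θ^H≢1 (begin
      θ^H                              ≡⟨ sym (*-identityʳ _) ⟩
      θ^H * 1#                         ≡⟨ cong (θ^H *_) (sym (pow-θ^H-2* k)) ⟩
      pow θ^H (suc (2 ℕ.* k))          ≡⟨ pow-swap θ H (suc (2 ℕ.* k)) ⟩
      pow (pow θ (suc (2 ℕ.* k))) H    ≡⟨ cong (λ x → pow x H) (sym eq) ⟩
      pow (pow θ (2 ℕ.* i)) H          ≡⟨ pow-swap θ (2 ℕ.* i) H ⟩
      pow θ^H (2 ℕ.* i)                ≡⟨ pow-θ^H-2* i ⟩
      1# ∎)
      where open ≡-Reasoning

    θ^H≡-1 : θ^H ≡ - 1#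
    θ^H≡-1 with square-roots {θ^H} {1#} (trans (cong (θ^H *_) (sym (*-identityʳ θ^H))) (trans (pow-θ^H-2* 1) (sym (*-identityˡ 1#))))
    ... | inj₁ eq = contradiction eq θ^H≢1
    ... | inj₂ eq = eq

    -1∈F : - 1# ∈ F
    -1∈F = subst (_∈ F) θ^H≡-1 (pow∈F H)

    -∈F : ∀ {x} → x ∈ F → - x ∈ F
    -∈F {x} x∈ = subst (_∈ F) (solve 1 (λ x → :- con 1ℤ :* x := :- x) refl x) (*∈F -1∈F x∈)

    x≢-x : ∀ {x} → x ≢ 0# → x ≢ - x
    x≢-x {x} x≢0 eq = θ^H≢1 (trans θ^H≡-1 (sym (*-cancelˡ x≢0
      (trans (*-identityʳ x) (trans eq (solve 1 (λ x → :- x := x :* :- con 1ℤ) refl x))))))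

    pow-double : ∀ k → pow θ k * pow θ k ≡ pow θ (2 ℕ.* k)
    pow-double k = trans (sym (pow-+ θ k k)) (cong (λ j → pow θ (k ℕ.+ j)) (sym (ℕ.+-identityʳ k)))

    odd-power-nonsquare : ∀ k {y} → y ∈ F → y * y ≢ pow θ (suc (2 ℕ.* k))
    odd-power-nonsquare k {y} y∈ eq with y ≟ 0#
    ... | yes refl = pow-≢0 (suc (2 ℕ.* k)) θ≢0 (trans (sym eq) (zeroˡ 0#))
    ... | no y≢0   with i , _ , refl ← logarithm y∈ y≢0 = θ^even≢θ^odd i k (trans (sym (pow-double i)) eq)

    -- The character is the parity of the discrete logarithm. In this form multiplicativity, and the
    -- comparison of the characters of K and L along the norm, become statements about exponents.
    ρ-pow : ∀ j → ρ Q (pow θ j) ≡ sign j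
    ρ-pow j with parity j
    ... | even k = trans (cong (ρ Q) (sym (pow-double k)))
      (trans (ρ-square Q (pow∈F k) (pow-≢0 k θ≢0)) (sym (sign-2* k)))
    ... | odd k = trans (ρ-nonsquare Q (pow-≢0 (suc (2 ℕ.* k)) θ≢0) (odd-power-nonsquare k)) (sym (sign-1+2* k))

    ρ-* : ∀ {x y} → x ∈ F → y ∈ F → ρ Q (x * y) ≡ ρ Q x ℤ.* ρ Q y
    ρ-* {x} {y} x∈ y∈ = cases (x ≟ 0#) (y ≟ 0#)
      where
      open ≡-Reasoning
      cases : Dec (x ≡ 0#) → Dec (y ≡ 0#) → ρ Q (x * y) ≡ ρ Q x ℤ.* ρ Q y
      cases (yes refl) _ = trans (trans (cong (ρ Q) (zeroˡ y)) (ρ-0 Q))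
        (sym (trans (cong (ℤ._* ρ Q y) (ρ-0 Q)) (ℤ.*-zeroˡ (ρ Q y))))
      cases (no _) (yes refl) = trans (trans (cong (ρ Q) (zeroʳ x)) (ρ-0 Q))
        (sym (trans (cong (ρ Q x ℤ.*_) (ρ-0 Q)) (ℤ.*-zeroʳ (ρ Q x))))
      cases (no x≢0) (no y≢0) with i , _ , refl ← logarithm x∈ x≢0 | j , _ , refl ← logarithm y∈ y≢0 = begin
        ρ Q (pow θ i * pow θ j)                 ≡⟨ cong (ρ Q) (sym (pow-+ θ i j)) ⟩
        ρ Q (pow θ (i ℕ.+ j))                   ≡⟨ ρ-pow (i ℕ.+ j) ⟩
        sign (i ℕ.+ j)                          ≡⟨ sign-+ i j ⟩
        sign i ℤ.* sign j                       ≡⟨ sym (cong₂ ℤ._*_ (ρ-pow i) (ρ-pow j)) ⟩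
        ρ Q (pow θ i) ℤ.* ρ Q (pow θ j)         ∎

    ρ²≡1 : ∀ {x} → x ∈ F → x ≢ 0# → ρ Q x ℤ.* ρ Q x ≡ 1ℤ
    ρ²≡1 x∈ x≢0 with j , _ , refl ← logarithm x∈ x≢0 =
      trans (cong₂ ℤ._*_ (ρ-pow j) (ρ-pow j)) (sign² j)

    ρ-1 : ρ Q 1# ≡ 1ℤ
    ρ-1 = ρ-pow 0

    ρ-⁻¹ : ∀ {x} → x ∈ F → x ≢ 0# → ρ Q (x ⁻¹) ≡ ρ Q x
    ρ-⁻¹ {x} x∈ x≢0 = begin
      ρ Q (x ⁻¹)                          ≡⟨ sym (ℤ.*-identityˡ _) ⟩
      1ℤ ℤ.* ρ Q (x ⁻¹)                   ≡⟨ cong (ℤ._* ρ Q (x ⁻¹)) (sym (ρ²≡1 x∈ x≢0)) ⟩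
      ρ Q x ℤ.* ρ Q x ℤ.* ρ Q (x ⁻¹)      ≡⟨ ℤ.*-assoc (ρ Q x) (ρ Q x) _ ⟩
      ρ Q x ℤ.* (ρ Q x ℤ.* ρ Q (x ⁻¹))    ≡⟨ cong (ρ Q x ℤ.*_) (sym (ρ-* x∈ (⁻¹∈F x∈ x≢0))) ⟩
      ρ Q x ℤ.* ρ Q (x * x ⁻¹)            ≡⟨ cong (λ y → ρ Q x ℤ.* ρ Q y) (x*x⁻¹≡1 x≢0) ⟩
      ρ Q x ℤ.* ρ Q 1#                    ≡⟨ cong (ρ Q x ℤ.*_) ρ-1 ⟩
      ρ Q x ℤ.* 1ℤ                        ≡⟨ ℤ.*-identityʳ _ ⟩
      ρ Q x                               ∎
      where open ≡-Reasoning

    count-square-roots : ∀ {x} → x ∈ F → ∑ F (λ y → ι ((y * y) ≟ x)) ≡ 1ℤ ℤ.+ ρ Q x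
    count-square-roots {x} x∈ = cases (x ≟ 0#)
      where
      open ≡-Reasoning
      split : ∀ k y → ι ((y * y) ≟ pow θ (2 ℕ.* k)) ≡ ι (pow θ k ≟ y) ℤ.+ ι ((- pow θ k) ≟ y)
      split k y with pow θ k ≟ y | (- pow θ k) ≟ y
      ... | yes z≡y | yes -z≡y = contradiction (trans z≡y (sym -z≡y)) (x≢-x (pow-≢0 k θ≢0))
      ... | yes refl | no _    = ι-yes (_ ≟ _) (pow-double k)
      ... | no _ | yes refl    = ι-yes (_ ≟ _) (trans (solve 1 (λ z → :- z :* :- z := z :* z) refl (pow θ k)) (pow-double k))
      ... | no z≢y | no -z≢y   = ι-no (_ ≟ _) λ eq →
        [ z≢y ∘ sym , -z≢y ∘ sym ]′ (square-roots (trans eq (sym (pow-double k))))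

      even-case : ∀ k → ∑ F (λ y → ι ((y * y) ≟ pow θ (2 ℕ.* k))) ≡ 1ℤ ℤ.+ ρ Q (pow θ (2 ℕ.* k))
      even-case k = begin
        ∑ F (λ y → ι ((y * y) ≟ pow θ (2 ℕ.* k)))               ≡⟨ ∑-cong′ F (split k) ⟩
        ∑ F (λ y → ι (pow θ k ≟ y) ℤ.+ ι ((- pow θ k) ≟ y))                 ≡⟨ ∑-+ F _ _ ⟩
        ∑ F (λ y → ι (pow θ k ≟ y)) ℤ.+ ∑ F (λ y → ι ((- pow θ k) ≟ y))
          ≡⟨ cong₂ ℤ._+_ (∑-count (subfield-unique Q) (pow∈F k)) (∑-count (subfield-unique Q) (-∈F (pow∈F k))) ⟩
        1ℤ ℤ.+ 1ℤ
          ≡⟨ cong (λ r → 1ℤ ℤ.+ r) (sym (trans (ρ-pow (2 ℕ.* k)) (sign-2* k))) ⟩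
        1ℤ ℤ.+ ρ Q (pow θ (2 ℕ.* k)) ∎

      odd-case : ∀ k → ∑ F (λ y → ι ((y * y) ≟ pow θ (suc (2 ℕ.* k)))) ≡ 1ℤ ℤ.+ ρ Q (pow θ (suc (2 ℕ.* k)))
      odd-case k = trans
        (trans (∑-cong F λ {y} y∈ → ι-no ((y * y) ≟ _) (odd-power-nonsquare k y∈)) (∑-0 F))
        (cong (λ r → 1ℤ ℤ.+ r) (sym (trans (ρ-pow (suc (2 ℕ.* k))) (sign-1+2* k))))

      cases : Dec (x ≡ 0#) → ∑ F (λ y → ι ((y * y) ≟ x)) ≡ 1ℤ ℤ.+ ρ Q x
      cases (yes refl) = trans
        (∑-cong′ F λ y → ι-⇔ ((y * y) ≟ 0#) (0# ≟ y)
          (λ eq → [ sym , sym ]′ (no-zero-divisors eq)) (λ { refl → zeroˡ 0# }))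
        (trans (∑-count (subfield-unique Q) 0∈F) (cong (λ r → 1ℤ ℤ.+ r) (sym (ρ-0 Q))))
      cases (no x≢0) with j , _ , refl ← logarithm x∈ x≢0 with parity j
      ... | even k = even-case k
      ... | odd k  = odd-case k

-- Euler's identity and the Vandermonde product

-- This is n(n - 1)/2, the number of pairs of conjugates and thus the exponent of -1 in the
-- discriminant.
triangle : ℕ → ℕ
triangle zero    = zero
triangle (suc n) = n ℕ.+ triangle n

module Interpolation (E : FiniteField) where
  open FiniteField E
  open FieldProperties E
  open Solver using (_:+_; _:*_; :-_; _:=_; con; solve)
  open ≡-Reasoning

  sumOver : List Carrier → (Carrier → Carrier) → Carrier
  sumOver []       f = 0#
  sumOver (x ∷ xs) f = f x + sumOver xs f

  prodOver : List Carrier → (Carrier → Carrier) → Carrier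
  prodOver []       f = 1#
  prodOver (x ∷ xs) f = f x * prodOver xs f

  sumOver-cong : ∀ xs {f g} → (∀ {x} → x ∈ xs → f x ≡ g x) → sumOver xs f ≡ sumOver xs g
  sumOver-cong []       eq = refl
  sumOver-cong (x ∷ xs) eq = cong₂ _+_ (eq (here refl)) (sumOver-cong xs (eq ∘ there))

  sumOver-linear : ∀ xs c f g → sumOver xs (λ x → c * f x + g x) ≡ c * sumOver xs f + sumOver xs g
  sumOver-linear []       c f g = solve 1 (λ c → con 0ℤ := c :* con 0ℤ :+ con 0ℤ) refl c
  sumOver-linear (x ∷ xs) c f g = trans (cong (c * f x + g x +_) (sumOver-linear xs c f g))
    (solve 5 (λ c a b s t → c :* a :+ b :+ (c :* s :+ t) := c :* (a :+ s) :+ (b :+ t)) refl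
      c (f x) (g x) (sumOver xs f) (sumOver xs g))

  sumOver-map : ∀ xs (h : Carrier → Carrier) f → sumOver (map h xs) f ≡ sumOver xs (f ∘ h)
  sumOver-map []       h f = refl
  sumOver-map (x ∷ xs) h f = cong (f (h x) +_) (sumOver-map xs h f)

  prodOver-map : ∀ xs (h : Carrier → Carrier) f → prodOver (map h xs) f ≡ prodOver xs (f ∘ h)
  prodOver-map []       h f = refl
  prodOver-map (x ∷ xs) h f = cong (f (h x) *_) (prodOver-map xs h f)

  -- The convention factor x x = 1 makes w x xs equal to ∏ (x − y) over the y in xs other than x,
  -- so no entry ever has to be deleted from a list.
  factor : Carrier → Carrier → Carrier
  factor x y with x ≟ y
  ... | yes _ = 1#
  ... | no _  = x + - y

  factor-≡ : ∀ x → factor x x ≡ 1#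
  factor-≡ x with x ≟ x
  ... | yes _  = refl
  ... | no x≢x = contradiction refl x≢x

  factor-≢ : ∀ {x y} → x ≢ y → factor x y ≡ x + - y
  factor-≢ {x} {y} x≢y with x ≟ y
  ... | yes x≡y = contradiction x≡y x≢y
  ... | no _    = refl

  factor≢0 : ∀ x y → factor x y ≢ 0#
  factor≢0 x y with x ≟ y
  ... | yes _  = 0≢1 ∘ sym
  ... | no x≢y = x≢y ∘ x-y≡0⇒x≡y

  factor-swap : ∀ {x y} → x ≢ y → factor x y ≡ - 1# * factor y x
  factor-swap {x} {y} x≢y = trans (factor-≢ x≢y) (trans
    (solve 2 (λ x y → x :+ :- y := :- con 1ℤ :* (y :+ :- x)) refl x y)
    (cong (- 1# *_) (sym (factor-≢ (x≢y ∘ sym)))))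

  w : Carrier → List Carrier → Carrier
  w x ys = prodOver ys (factor x)

  w≢0 : ∀ x ys → w x ys ≢ 0#
  w≢0 x []       = 0≢1 ∘ sym
  w≢0 x (y ∷ ys) = *-≢0 (factor≢0 x y) (w≢0 x ys)

  w-self : ∀ x xs → w x (x ∷ xs) ≡ w x xs
  w-self x xs = trans (cong (_* w x xs) (factor-≡ x)) (*-identityˡ _)

  w-∷ʳ : ∀ x ys y → w x (ys ∷ʳ y) ≡ w x (y ∷ ys)
  w-∷ʳ x []       y = refl
  w-∷ʳ x (z ∷ ys) y = trans (cong (factor x z *_) (w-∷ʳ x ys y))
    (solve 3 (λ a b c → a :* (b :* c) := b :* (a :* c)) refl (factor x z) (factor x y) (w x ys))

  -- The divided difference of X^k at the points xs.
  divided : ℕ → List Carrier → Carrier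
  divided k xs = sumOver xs (λ x → pow x k * w x xs ⁻¹)

  -- Write x^(k+1) = z x^k + (x - z) x^k. For x in `xs` the factor x - z cancels against the one
  -- that z contributes to `w`; for x = z the second summand is absent.
  divided-step : ∀ k z xs → z ∉ xs → divided (suc k) (z ∷ xs) ≡ z * divided k (z ∷ xs) + divided k xs
  divided-step k z xs z∉ = begin
    z * pow z k * w z (z ∷ xs) ⁻¹ + sumOver xs (λ x → x * pow x k * w x (z ∷ xs) ⁻¹)
      ≡⟨ cong₂ _+_ (*-assoc _ _ _) (sumOver-cong xs term) ⟩
    z * (pow z k * w z (z ∷ xs) ⁻¹) + sumOver xs (λ x → z * (pow x k * w x (z ∷ xs) ⁻¹) + pow x k * w x xs ⁻¹)
      ≡⟨ cong (z * (pow z k * w z (z ∷ xs) ⁻¹) +_) (sumOver-linear xs z _ _) ⟩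
    z * (pow z k * w z (z ∷ xs) ⁻¹) + (z * sumOver xs (λ x → pow x k * w x (z ∷ xs) ⁻¹) + divided k xs)
      ≡⟨ solve 4 (λ z a b c → z :* a :+ (z :* b :+ c) := z :* (a :+ b) :+ c) refl z _ _ _ ⟩
    z * divided k (z ∷ xs) + divided k xs ∎
    where
    term : ∀ {x} → x ∈ xs →
           x * pow x k * w x (z ∷ xs) ⁻¹ ≡ z * (pow x k * w x (z ∷ xs) ⁻¹) + pow x k * w x xs ⁻¹
    term {x} x∈ = begin
      x * pow x k * W ⁻¹
        ≡⟨ solve 4 (λ x z a b → x :* a :* b := z :* (a :* b) :+ a :* ((x :+ :- z) :* b)) refl x z (pow x k) (W ⁻¹) ⟩
      z * (pow x k * W ⁻¹) + pow x k * ((x + - z) * W ⁻¹)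
        ≡⟨ cong (λ y → z * (pow x k * W ⁻¹) + pow x k * y) cancelled ⟩
      z * (pow x k * W ⁻¹) + pow x k * w x xs ⁻¹ ∎
      where
      W : Carrier
      W = w x (z ∷ xs)
      x≢z : x ≢ z
      x≢z x≡z = z∉ (subst (_∈ xs) x≡z x∈)
      cancelled : (x + - z) * W ⁻¹ ≡ w x xs ⁻¹
      cancelled = *-cancelˡ (w≢0 x xs) (begin
        w x xs * ((x + - z) * W ⁻¹)   ≡⟨ solve 3 (λ a b c → a :* (b :* c) := b :* a :* c) refl _ _ _ ⟩
        (x + - z) * w x xs * W ⁻¹     ≡⟨ cong (λ y → y * w x xs * W ⁻¹) (sym (factor-≢ x≢z)) ⟩
        W * W ⁻¹                      ≡⟨ x*x⁻¹≡1 (w≢0 x (z ∷ xs)) ⟩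
        1#                            ≡⟨ sym (x*x⁻¹≡1 (w≢0 x xs)) ⟩
        w x xs * w x xs ⁻¹            ∎)

  divided-swap : ∀ k x y zs → divided k (x ∷ y ∷ zs) ≡ divided k (y ∷ x ∷ zs)
  divided-swap k x y zs = trans
    (solve 3 (λ a b c → a :+ (b :+ c) := b :+ (a :+ c)) refl (f x) (f y) (sumOver zs f))
    (sumOver-cong (y ∷ x ∷ zs) (λ {u} _ → cong (λ v → pow u k * v ⁻¹)
      (solve 3 (λ a b c → a :* (b :* c) := b :* (a :* c)) refl (factor u x) (factor u y) (w u zs))))
    where
    f : Carrier → Carrier
    f u = pow u k * w u (x ∷ y ∷ zs) ⁻¹

  ∉-head : ∀ {z : Carrier} {xs} → Unique (z ∷ xs) → z ∉ xs
  ∉-head (z∉ ∷ _) z∈ = All.lookup z∉ z∈ refl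

  divided-0-[_] : ∀ x → divided 0 (x ∷ []) ≡ 1#
  divided-0-[ x ] = begin
    1# * w x (x ∷ []) ⁻¹ + 0#   ≡⟨ solve 1 (λ a → con 1ℤ :* a :+ con 0ℤ := con 1ℤ :* a) refl _ ⟩
    1# * w x (x ∷ []) ⁻¹        ≡⟨ cong (_* w x (x ∷ []) ⁻¹) (sym (w-self x [])) ⟩
    w x (x ∷ []) * w x (x ∷ []) ⁻¹ ≡⟨ x*x⁻¹≡1 (w≢0 x (x ∷ [])) ⟩
    1# ∎

  -- Expanding `divided 1` at x and at y, which is possible by symmetry, shows that (x - y) times
  -- the left side is `divided 0 (x ∷ zs)` minus `divided 0 (y ∷ zs)`. These two agree by induction.
  divided-0 : ∀ x y zs → Unique (x ∷ y ∷ zs) → divided 0 (x ∷ y ∷ zs) ≡ 0#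
  divided-0 x y zs u@((x≢y ∷ x∉zs) ∷ y∉zs ∷ uzs) = *-cancelˡ (x≢y ∘ x-y≡0⇒x≡y) (begin
    (x + - y) * divided 0 (x ∷ y ∷ zs)
      ≡⟨ solve 5 (λ x y d a b → (x :+ :- y) :* d := x :* d :+ a :+ :- (y :* d :+ b) :+ (b :+ :- a)) refl
           x y (divided 0 (x ∷ y ∷ zs)) (divided 0 (y ∷ zs)) (divided 0 (x ∷ zs)) ⟩
    x * divided 0 (x ∷ y ∷ zs) + divided 0 (y ∷ zs) + - (y * divided 0 (x ∷ y ∷ zs) + divided 0 (x ∷ zs))
      + (divided 0 (x ∷ zs) + - divided 0 (y ∷ zs))
      ≡⟨ cong₂ _+_ (x≡y⇒x-y≡0 (begin
           x * divided 0 (x ∷ y ∷ zs) + divided 0 (y ∷ zs)  ≡⟨ sym (divided-step 0 x (y ∷ zs) (∉-head u)) ⟩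
           divided 1 (x ∷ y ∷ zs)                            ≡⟨ divided-swap 1 x y zs ⟩
           divided 1 (y ∷ x ∷ zs)                            ≡⟨ divided-step 0 y (x ∷ zs) (∉-head ((x≢y ∘ sym ∷ y∉zs) ∷ x∉zs ∷ uzs)) ⟩
           y * divided 0 (y ∷ x ∷ zs) + divided 0 (x ∷ zs)  ≡⟨ cong (λ d → y * d + divided 0 (x ∷ zs)) (sym (divided-swap 0 x y zs)) ⟩
           y * divided 0 (x ∷ y ∷ zs) + divided 0 (x ∷ zs)  ∎))
         (x≡y⇒x-y≡0 (same zs x∉zs y∉zs uzs)) ⟩
    0# + 0#              ≡⟨ +-identityˡ 0# ⟩
    0#                   ≡⟨ sym (zeroʳ _) ⟩
    (x + - y) * 0#       ∎)
    where
    -- Both sides are 1 when no further point is left, and both are 0 by the shorter instance of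
    -- `divided-0` otherwise.
    same : ∀ zs → All (x ≢_) zs → All (y ≢_) zs → Unique zs → divided 0 (x ∷ zs) ≡ divided 0 (y ∷ zs)
    same []        _  _  _ = trans divided-0-[ x ] (sym divided-0-[ y ])
    same (z ∷ zs) x∉ y∉ u = trans (divided-0 x z zs (x∉ ∷ u)) (sym (divided-0 y z zs (y∉ ∷ u)))

  mutual
    -- Euler's identity. `divided-step` lowers the degree in one summand, and both the degree and
    -- the number of points in the other; in `divided-top` only the latter survives.
    divided-low : ∀ k xs → Unique xs → suc k < length xs → divided k xs ≡ 0#
    divided-low zero    (x ∷ y ∷ zs) u         _         = divided-0 x y zs u
    divided-low (suc k) (x ∷ xs)     u@(_ ∷ v) (ℕ.s≤s l) = begin
      divided (suc k) (x ∷ xs)                  ≡⟨ divided-step k x xs (∉-head u) ⟩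
      x * divided k (x ∷ xs) + divided k xs     ≡⟨ cong₂ (λ a b → x * a + b) (divided-low k (x ∷ xs) u (ℕ.m<n⇒m<1+n l)) (divided-low k xs v l) ⟩
      x * 0# + 0#                               ≡⟨ trans (+-identityʳ _) (zeroʳ x) ⟩
      0#                                        ∎
    divided-low zero    (x ∷ [])     _         (ℕ.s≤s ())

    divided-top : ∀ k xs → Unique xs → suc k ≡ length xs → divided k xs ≡ 1#
    divided-top zero    (x ∷ [])     u         _ = divided-0-[ x ]
    divided-top (suc k) (x ∷ xs)     u@(_ ∷ v) l = begin
      divided (suc k) (x ∷ xs)                  ≡⟨ divided-step k x xs (∉-head u) ⟩
      x * divided k (x ∷ xs) + divided k xs     ≡⟨ cong₂ (λ a b → x * a + b) (divided-low k (x ∷ xs) u (ℕ.≤-reflexive l))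
                                                     (divided-top k xs v (ℕ.suc-injective l)) ⟩
      x * 0# + 1#                               ≡⟨ trans (cong (_+ 1#) (zeroʳ x)) (+-identityˡ 1#) ⟩
      1#                                        ∎

  vandermonde : List Carrier → Carrier
  vandermonde []       = 1#
  vandermonde (x ∷ xs) = w x xs * vandermonde xs

  vandermonde≢0 : ∀ xs → vandermonde xs ≢ 0#
  vandermonde≢0 []       = 0≢1 ∘ sym
  vandermonde≢0 (x ∷ xs) = *-≢0 (w≢0 x xs) (vandermonde≢0 xs)

  -- Each difference x - z is turned into z - x at the cost of one sign. The spare factor `f` lets
  -- this act inside the product of all `w x xs`.
  prodOver-factor : ∀ z xs (f : Carrier → Carrier) → z ∉ xs →
    prodOver xs (λ x → factor x z * f x) ≡ pow (- 1#) (length xs) * w z xs * prodOver xs f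
  prodOver-factor z []       f z∉ = solve 0 (con 1ℤ := con 1ℤ :* con 1ℤ :* con 1ℤ) refl
  prodOver-factor z (x ∷ xs) f z∉ = begin
    factor x z * f x * prodOver xs (λ x → factor x z * f x)
      ≡⟨ cong₂ (λ a b → a * f x * b) (factor-swap {x} {z} (λ { refl → z∉ (here refl) })) (prodOver-factor z xs f (z∉ ∘ there)) ⟩
    - 1# * factor z x * f x * (pow (- 1#) (length xs) * w z xs * prodOver xs f)
      ≡⟨ solve 5 (λ a b c d e → :- con 1ℤ :* a :* b :* (c :* d :* e) := :- con 1ℤ :* c :* (a :* d) :* (b :* e)) refl
           (factor z x) (f x) (pow (- 1#) (length xs)) (w z xs) (prodOver xs f) ⟩
    - 1# * pow (- 1#) (length xs) * (factor z x * w z xs) * (f x * prodOver xs f) ∎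

  -- Every unordered pair contributes (x - y)(y - x) = -(x - y)², which gives one sign per pair: the
  -- discriminant formula.
  prod-w : ∀ xs → Unique xs →
           prodOver xs (λ x → w x xs) ≡ pow (- 1#) (triangle (length xs)) * (vandermonde xs * vandermonde xs)
  prod-w []       _          = solve 0 (con 1ℤ := con 1ℤ :* (con 1ℤ :* con 1ℤ)) refl
  prod-w (z ∷ xs) u@(_ ∷ v) = begin
    w z (z ∷ xs) * prodOver xs (λ x → factor x z * w x xs)
      ≡⟨ cong₂ _*_ (w-self z xs) (trans (prodOver-factor z xs (λ x → w x xs) (∉-head u)) (cong (pow (- 1#) n * w z xs *_) (prod-w xs v))) ⟩
    w z xs * (pow (- 1#) n * w z xs * (pow (- 1#) (triangle n) * (vandermonde xs * vandermonde xs)))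
      ≡⟨ solve 4 (λ a b c d → a :* (b :* a :* (c :* (d :* d))) := b :* c :* (a :* d :* (a :* d))) refl
           (w z xs) (pow (- 1#) n) (pow (- 1#) (triangle n)) (vandermonde xs) ⟩
    pow (- 1#) n * pow (- 1#) (triangle n) * (vandermonde (z ∷ xs) * vandermonde (z ∷ xs))
      ≡⟨ cong (_* (vandermonde (z ∷ xs) * vandermonde (z ∷ xs))) (sym (pow-+ (- 1#) n (triangle n))) ⟩
    pow (- 1#) (n ℕ.+ triangle n) * (vandermonde (z ∷ xs) * vandermonde (z ∷ xs)) ∎
    where
    n : ℕ
    n = length xs

  -- Carrying x from the front to the back reverses exactly its differences with the entries of
  -- `xs`.
  vandermonde-∷ʳ : ∀ x xs → x ∉ xs → vandermonde (xs ∷ʳ x) ≡ pow (- 1#) (length xs) * vandermonde (x ∷ xs)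
  vandermonde-∷ʳ x []       x∉ = solve 0 (con 1ℤ :* con 1ℤ := con 1ℤ :* (con 1ℤ :* con 1ℤ)) refl
  vandermonde-∷ʳ x (z ∷ xs) x∉ = begin
    w z (xs ∷ʳ x) * vandermonde (xs ∷ʳ x)
      ≡⟨ cong₂ _*_ (w-∷ʳ z xs x) (vandermonde-∷ʳ x xs (x∉ ∘ there)) ⟩
    factor z x * w z xs * (s * (w x xs * vandermonde xs))
      ≡⟨ cong (λ a → a * w z xs * (s * (w x xs * vandermonde xs))) (factor-swap {z} {x} (λ { refl → x∉ (here refl) })) ⟩
    - 1# * factor x z * w z xs * (s * (w x xs * vandermonde xs))
      ≡⟨ solve 5 (λ a b c d e → :- con 1ℤ :* a :* b :* (c :* (d :* e)) := :- con 1ℤ :* c :* (a :* d :* (b :* e))) refl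
           (factor x z) (w z xs) s (w x xs) (vandermonde xs) ⟩
    - 1# * s * (factor x z * w x xs * (w z xs * vandermonde xs)) ∎
    where
    s : Carrier
    s = pow (- 1#) (length xs)

  module _ (φ : Carrier → Carrier) (φ-+ : ∀ x y → φ (x + y) ≡ φ x + φ y) (φ-* : ∀ x y → φ (x * y) ≡ φ x * φ y)
           (φ-1 : φ 1# ≡ 1#) (φ-neg : ∀ x → φ (- x) ≡ - φ x) (φ-injective : ∀ {x y} → φ x ≡ φ y → x ≡ y) where

    -- Injectivity of φ keeps the convention in step: φ x and φ y coincide only where x and y
    -- already do.
    factor-hom : ∀ x y → factor (φ x) (φ y) ≡ φ (factor x y)
    factor-hom x y = cases (x ≟ y)
      where
      cases : Dec (x ≡ y) → factor (φ x) (φ y) ≡ φ (factor x y)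
      cases (yes refl) = trans (factor-≡ (φ x)) (trans (sym φ-1) (cong φ (sym (factor-≡ x))))
      cases (no x≢y)   = trans (factor-≢ (x≢y ∘ φ-injective)) (trans (cong (φ x +_) (sym (φ-neg y)))
        (trans (sym (φ-+ x (- y))) (cong φ (sym (factor-≢ x≢y)))))

    w-hom : ∀ x ys → w (φ x) (map φ ys) ≡ φ (w x ys)
    w-hom x []       = sym φ-1
    w-hom x (y ∷ ys) = trans (cong₂ _*_ (factor-hom x y) (w-hom x ys)) (sym (φ-* _ _))

    vandermonde-hom : ∀ xs → vandermonde (map φ xs) ≡ φ (vandermonde xs)
    vandermonde-hom []       = sym φ-1
    vandermonde-hom (x ∷ xs) = trans (cong₂ _*_ (w-hom x xs) (vandermonde-hom xs)) (sym (φ-* _ _))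

-- Counting values of the quadratic form s(y²)

pos-^-suc : ∀ q m → ℤ.+ (q ℕ.^ suc m) ≡ ℤ.+ q ℤ.* ℤ.+ (q ℕ.^ m)
pos-^-suc q m = ℤ.pos-* q (q ℕ.^ m)

module CoefficientForms (E : FiniteField) where
  open FiniteField E
  open FieldProperties E
  open Reindexing _≟_
  open Solver using (_:+_; _:*_; :-_; _:=_; con; solve)

  -- On the span of 1, θ, ..., θ^t′ the functional s reads off the coefficient of θ^t′. Independence
  -- of these powers is deduced from s, and that they span L from the cardinalities, so no minimal
  -- polynomial is needed as an object.
  module CoefficientForm
    (K L : List Carrier) (K-unique : Unique K) (L-unique : Unique L) (q t′ : ℕ)
    (|K| : ∑ K (λ _ → 1ℤ) ≡ ℤ.+ q) (|L| : ∑ L (λ _ → 1ℤ) ≡ ℤ.+ (q ℕ.^ suc t′))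
    (0∈K : 0# ∈ K) (+∈K : ∀ {x y} → x ∈ K → y ∈ K → x + y ∈ K) (*∈K : ∀ {x y} → x ∈ K → y ∈ K → x * y ∈ K)
    (-∈K : ∀ {x} → x ∈ K → - x ∈ K) (⁻¹∈K : ∀ {x} → x ∈ K → x ≢ 0# → x ⁻¹ ∈ K) (2≢0 : 1# + 1# ≢ 0#)
    (K⊆L : ∀ {x} → x ∈ K → x ∈ L) (+∈L : ∀ {x y} → x ∈ L → y ∈ L → x + y ∈ L)
    (*∈L : ∀ {x y} → x ∈ L → y ∈ L → x * y ∈ L)
    (θ : Carrier) (θ^∈L : ∀ k → pow θ k ∈ L)
    (s : Carrier → Carrier) (s∈K : ∀ {x} → x ∈ L → s x ∈ K)
    (s-+ : ∀ x y → s (x + y) ≡ s x + s y) (s-* : ∀ {c} → c ∈ K → ∀ x → s (c * x) ≡ c * s x)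
    (s-low : ∀ {k} → k < t′ → s (pow θ k) ≡ 0#) (s-top : s (pow θ t′) ≡ 1#)
    where

    -- The sum runs over coefficient tuples, not over field elements. Repetitions would count with
    -- multiplicity; that there are none is settled only in `polySum-full`.
    polySum : ℕ → (Carrier → ℤ) → ℤ
    polySum zero    F = F 0#
    polySum (suc m) F = ∑ K (λ c → polySum m (λ y → F (y + c * pow θ m)))

    data Span : ℕ → Carrier → Set where
      span-0 : Span 0 0#
      span-+ : ∀ {m y c} → Span m y → c ∈ K → Span (suc m) (y + c * pow θ m)

    polySum-cong : ∀ m {F G : Carrier → ℤ} → (∀ {y} → Span m y → F y ≡ G y) → polySum m F ≡ polySum m G
    polySum-cong zero    eq = eq span-0
    polySum-cong (suc m) eq = ∑-cong K λ c∈ → polySum-cong m λ y∈ → eq (span-+ y∈ c∈)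

    polySum-∑ : {A : Set} (m : ℕ) (as : List A) (G : A → Carrier → ℤ) →
                polySum m (λ y → ∑ as (λ a → G a y)) ≡ ∑ as (λ a → polySum m (G a))
    polySum-∑ zero    as G = refl
    polySum-∑ (suc m) as G = trans
      (∑-cong′ K λ c → polySum-∑ m as (λ a y → G a (y + c * pow θ m))) (∑-swap K as _)

    ∑K-const : ∀ c → ∑ K (λ _ → c) ≡ ℤ.+ q ℤ.* c
    ∑K-const c = trans (∑-cong′ K λ _ → sym (ℤ.*-identityˡ c)) (trans (∑-*ʳ K (λ _ → 1ℤ) c) (cong (ℤ._* c) |K|))

    polySum-const : ∀ m c → polySum m (λ _ → c) ≡ ℤ.+ (q ℕ.^ m) ℤ.* c
    polySum-const zero    c = sym (ℤ.*-identityˡ c)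
    polySum-const (suc m) c = begin
      ∑ K (λ _ → polySum m (λ _ → c))     ≡⟨ ∑K-const _ ⟩
      ℤ.+ q ℤ.* polySum m (λ _ → c)       ≡⟨ cong (ℤ.+ q ℤ.*_) (polySum-const m c) ⟩
      ℤ.+ q ℤ.* (ℤ.+ (q ℕ.^ m) ℤ.* c)     ≡⟨ sym (ℤ.*-assoc (ℤ.+ q) _ c) ⟩
      ℤ.+ q ℤ.* ℤ.+ (q ℕ.^ m) ℤ.* c       ≡⟨ cong (ℤ._* c) (sym (pos-^-suc q m)) ⟩
      ℤ.+ (q ℕ.^ suc m) ℤ.* c             ∎
      where open ≡-Reasoning

    polySum-*ʳ : ∀ m F c → polySum m (λ y → F y ℤ.* c) ≡ polySum m F ℤ.* c
    polySum-*ʳ zero    F c = refl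
    polySum-*ʳ (suc m) F c = trans (∑-cong′ K λ d → polySum-*ʳ m _ c) (∑-*ʳ K _ c)

    ∑K-affine : ∀ {v d} → v ∈ K → d ∈ K → d ≢ 0# → (f : Carrier → ℤ) → ∑ K (λ k → f (v + d * k)) ≡ ∑ K f
    ∑K-affine {v} {d} v∈ d∈ d≢0 = ∑-reindex K-unique (λ k → v + d * k) (λ y → d ⁻¹ * (y + - v))
      (λ k∈ → +∈K v∈ (*∈K d∈ k∈)) (λ y∈ → *∈K (⁻¹∈K d∈ d≢0) (+∈K y∈ (-∈K v∈)))
      (λ k → begin
        d ⁻¹ * (v + d * k + - v)   ≡⟨ solve 4 (λ v d e k → e :* (v :+ d :* k :+ :- v) := d :* e :* k) refl v d (d ⁻¹) k ⟩
        d * d ⁻¹ * k               ≡⟨ cong (_* k) (x*x⁻¹≡1 d≢0) ⟩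
        1# * k                     ≡⟨ *-identityˡ k ⟩
        k                          ∎)
      (λ y → begin
        v + d * (d ⁻¹ * (y + - v)) ≡⟨ cong (v +_) (sym (*-assoc _ _ _)) ⟩
        v + d * d ⁻¹ * (y + - v)   ≡⟨ cong (λ z → v + z * (y + - v)) (x*x⁻¹≡1 d≢0) ⟩
        v + 1# * (y + - v)         ≡⟨ solve 2 (λ v y → v :+ con 1ℤ :* (y :+ :- v) := y) refl v y ⟩
        y                          ∎)
      where open ≡-Reasoning

    ∑K-translate : ∀ {v} → v ∈ K → (f : Carrier → ℤ) → ∑ K (λ c → f (c + v)) ≡ ∑ K f
    ∑K-translate {v} v∈ = ∑-reindex K-unique (_+ v) (_+ - v)
      (λ c∈ → +∈K c∈ v∈) (λ c∈ → +∈K c∈ (-∈K v∈))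
      (λ c → solve 2 (λ c v → c :+ v :+ :- v := c) refl c v)
      (λ c → solve 2 (λ c v → c :+ :- v :+ v := c) refl c v)

    -- Adding k θ^j translates the single coefficient of θ^j, which is a bijection of K; the
    -- recursion descends to that coefficient.
    polySum-translate : ∀ m {j k} → j < m → k ∈ K → (F : Carrier → ℤ) →
                        polySum m (λ y → F (y + k * pow θ j)) ≡ polySum m F
    polySum-translate (suc m) {j} {k} (ℕ.s≤s j≤m) k∈ F with j ℕ.≟ m
    ... | yes refl = trans
      (∑-cong′ K λ c → polySum-cong m λ {y} _ → cong F
        (solve 4 (λ y c p k → y :+ c :* p :+ k :* p := y :+ (c :+ k) :* p) refl y c (pow θ m) k))
      (∑K-translate k∈ (λ c → polySum m (λ y → F (y + c * pow θ m))))
    ... | no j≢m = ∑-cong′ K λ c → trans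
      (polySum-cong m λ {y} _ → cong F (solve 3 (λ y a b → y :+ a :+ b := y :+ b :+ a) refl y (c * pow θ m) (k * pow θ j)))
      (polySum-translate m (ℕ.≤∧≢⇒< j≤m j≢m) k∈ (λ y → F (y + c * pow θ m)))

    s-0 : s 0# ≡ 0#
    s-0 = trans (cong s (sym (zeroˡ 0#))) (trans (s-* 0∈K 0#) (zeroˡ _))

    span⊆L : ∀ {m y} → Span m y → y ∈ L
    span⊆L span-0         = K⊆L 0∈K
    span⊆L (span-+ {m} y∈ c∈) = +∈L (span⊆L y∈) (*∈L (K⊆L c∈) (θ^∈L m))

    s-shift : ∀ {c} → c ∈ K → ∀ y m i → s ((y + c * pow θ m) * pow θ i) ≡ s (y * pow θ i) + c * s (pow θ (m ℕ.+ i))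
    s-shift {c} c∈ y m i = begin
      s ((y + c * pow θ m) * pow θ i)              ≡⟨ cong s (solve 4 (λ y c a b → (y :+ c :* a) :* b := y :* b :+ c :* (a :* b)) refl y c _ _) ⟩
      s (y * pow θ i + c * (pow θ m * pow θ i))    ≡⟨ s-+ _ _ ⟩
      s (y * pow θ i) + s (c * (pow θ m * pow θ i)) ≡⟨ cong (s (y * pow θ i) +_) (s-* c∈ _) ⟩
      s (y * pow θ i) + c * s (pow θ m * pow θ i)  ≡⟨ cong (λ z → s (y * pow θ i) + c * s z) (sym (pow-+ θ m i)) ⟩
      s (y * pow θ i) + c * s (pow θ (m ℕ.+ i))    ∎
      where open ≡-Reasoning

    -- Every power of θ occurring in y θ^i has exponent at most i + m - 1 < t′.
    span-orthogonal : ∀ {m y} → Span m y → ∀ i → i ℕ.+ m ≤ t′ → s (y * pow θ i) ≡ 0#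
    span-orthogonal span-0 i _ = trans (cong s (zeroˡ _)) s-0
    span-orthogonal {suc m} (span-+ {y = y} {c} y∈ c∈) i i+m<t = begin
      s ((y + c * pow θ m) * pow θ i)              ≡⟨ s-shift c∈ y m i ⟩
      s (y * pow θ i) + c * s (pow θ (m ℕ.+ i))
        ≡⟨ cong₂ (λ a b → a + c * b) (span-orthogonal y∈ i (ℕ.≤-trans (ℕ.+-monoʳ-≤ i (ℕ.n≤1+n m)) i+m<t))
             (s-low (subst (_≤ t′) (trans (ℕ.+-suc i m) (cong suc (ℕ.+-comm i m))) i+m<t)) ⟩
      0# + c * 0#                                  ≡⟨ trans (+-identityˡ _) (zeroʳ c) ⟩
      0#                                           ∎
      where open ≡-Reasoning

    span-isotropic : ∀ {m y z} → Span m y → (∀ {i} → i < m → s (z * pow θ i) ≡ 0#) → s (z * y) ≡ 0#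
    span-isotropic span-0 _ = trans (cong s (zeroʳ _)) s-0
    span-isotropic {suc m} {z = z} (span-+ {y = y} {c} y∈ c∈) z⊥ = begin
      s (z * (y + c * pow θ m))             ≡⟨ cong s (solve 4 (λ z y c p → z :* (y :+ c :* p) := z :* y :+ c :* (z :* p)) refl z y c _) ⟩
      s (z * y + c * (z * pow θ m))         ≡⟨ trans (s-+ _ _) (cong (s (z * y) +_) (s-* c∈ _)) ⟩
      s (z * y) + c * s (z * pow θ m)       ≡⟨ cong₂ (λ a b → a + c * b) (span-isotropic y∈ (z⊥ ∘ ℕ.m<n⇒m<1+n)) (z⊥ ℕ.≤-refl) ⟩
      0# + c * 0#                           ≡⟨ trans (+-identityˡ _) (zeroʳ c) ⟩
      0#                                    ∎
      where open ≡-Reasoning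

    -- In y² the exponents are at most 2m - 2 < t′: this is the totally isotropic subspace.
    span-square : ∀ {m y} → Span m y → m ℕ.+ m ≤ suc t′ → s (y * y) ≡ 0#
    span-square {m} y∈ 2m≤t = span-isotropic y∈ λ {i} i<m →
      span-orthogonal y∈ i (ℕ.s≤s⁻¹ (ℕ.≤-trans (ℕ.+-monoˡ-≤ m i<m) 2m≤t))

    s-square : ∀ {k} → k ∈ K → ∀ u j → s ((u + k * pow θ j) * (u + k * pow θ j)) ≡
               s (u * u) + (k + k) * s (u * pow θ j) + k * k * s (pow θ (j ℕ.+ j))
    s-square {k} k∈ u j = begin
      s ((u + k * p) * (u + k * p))
        ≡⟨ cong s (solve 3 (λ u k p → (u :+ k :* p) :* (u :+ k :* p) := u :* u :+ (k :+ k) :* (u :* p) :+ k :* k :* (p :* p)) refl u k p) ⟩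
      s (u * u + (k + k) * (u * p) + k * k * (p * p))
        ≡⟨ trans (s-+ _ _) (cong (_+ s (k * k * (p * p))) (s-+ _ _)) ⟩
      s (u * u) + s ((k + k) * (u * p)) + s (k * k * (p * p))
        ≡⟨ cong₂ (λ a b → s (u * u) + a + b) (s-* (+∈K k∈ k∈) _) (s-* (*∈K k∈ k∈) _) ⟩
      s (u * u) + (k + k) * s (u * p) + k * k * s (p * p)
        ≡⟨ cong (λ z → s (u * u) + (k + k) * s (u * p) + k * k * s z) (sym (pow-+ θ j j)) ⟩
      s (u * u) + (k + k) * s (u * p) + k * k * s (pow θ (j ℕ.+ j)) ∎
      where
      open ≡-Reasoning
      p : Carrier
      p = pow θ j

    -- Distribution of the values s(y²), tested against a weight f

    module _ (f : Carrier → ℤ) where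
      open ≡-Reasoning

      squareSum : ℕ → ℤ
      squareSum m = polySum m (λ y → f (s (y * y)))

      -- Translating by k θ^j with j = t′ − m changes s (u²) by 2ck, so averaging over k equidistributes it.
      equidistribution : ∀ m j → j ℕ.+ m ≡ t′ → j < m → ∀ {c} → c ∈ K → c ≢ 0# →
        ℤ.+ q ℤ.* polySum m (λ y → f (s ((y + c * pow θ m) * (y + c * pow θ m)))) ≡ ℤ.+ (q ℕ.^ m) ℤ.* ∑ K f
      equidistribution m j j+m≡t′ j<m {c} c∈ c≢0 = begin
        ℤ.+ q ℤ.* polySum m F                                    ≡⟨ sym (∑K-const _) ⟩
        ∑ K (λ k → polySum m F)                                  ≡⟨ ∑-cong K (λ k∈ → sym (polySum-translate m j<m k∈ F)) ⟩
        ∑ K (λ k → polySum m (λ y → F (y + k * pow θ j)))        ≡⟨ sym (polySum-∑ m K (λ k y → F (y + k * pow θ j))) ⟩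
        polySum m (λ y → ∑ K (λ k → F (y + k * pow θ j)))        ≡⟨ polySum-cong m average ⟩
        polySum m (λ _ → ∑ K f)                                  ≡⟨ polySum-const m _ ⟩
        ℤ.+ (q ℕ.^ m) ℤ.* ∑ K f                                  ∎
        where
        F : Carrier → ℤ
        F y = f (s ((y + c * pow θ m) * (y + c * pow θ m)))

        -- From j + m = t′ the mixed term picks up exactly the leading coefficient c, which gives
        -- 2ck. From j < m also 2j < t′, so the term in k² vanishes and the dependence on k is
        -- affine.
        value : ∀ {y k} → Span m y → k ∈ K → let u = y + c * pow θ m in
          s ((y + k * pow θ j + c * pow θ m) * (y + k * pow θ j + c * pow θ m)) ≡ s (u * u) + (c + c) * k
        value {y} {k} y∈ k∈ = begin
          s ((y + k * pow θ j + c * pow θ m) * (y + k * pow θ j + c * pow θ m))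
            ≡⟨ cong (λ z → s (z * z)) (solve 3 (λ y a b → y :+ a :+ b := y :+ b :+ a) refl y _ _) ⟩
          s ((u + k * pow θ j) * (u + k * pow θ j))
            ≡⟨ s-square k∈ u j ⟩
          s (u * u) + (k + k) * s (u * pow θ j) + k * k * s (pow θ (j ℕ.+ j))
            ≡⟨ cong₂ (λ a b → s (u * u) + (k + k) * a + k * k * b)
                 (trans (s-shift c∈ y m j) (cong₂ (λ a b → a + c * b) (span-orthogonal y∈ j (ℕ.≤-reflexive j+m≡t′))
                   (trans (cong (λ i → s (pow θ i)) (trans (ℕ.+-comm m j) j+m≡t′)) s-top)))
                 (s-low (subst (j ℕ.+ j <_) j+m≡t′ (ℕ.+-monoʳ-< j j<m))) ⟩
          s (u * u) + (k + k) * (0# + c * 1#) + k * k * 0#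
            ≡⟨ solve 3 (λ a k c → a :+ (k :+ k) :* (con 0ℤ :+ c :* con 1ℤ) :+ k :* k :* con 0ℤ := a :+ (c :+ c) :* k) refl (s (u * u)) k c ⟩
          s (u * u) + (c + c) * k ∎
          where
          u : Carrier
          u = y + c * pow θ m

        average : ∀ {y} → Span m y → ∑ K (λ k → F (y + k * pow θ j)) ≡ ∑ K f
        average {y} y∈ = trans (∑-cong K (λ k∈ → cong f (value y∈ k∈)))
          -- The affine map k ↦ s(u²) + 2ck permutes K because 2c ≠ 0; odd characteristic enters
          -- here.
          (∑K-affine (s∈K (*∈L u∈L u∈L)) (+∈K c∈ c∈) c+c≢0 f)
          where
          u∈L : y + c * pow θ m ∈ L
          u∈L = span⊆L (span-+ y∈ c∈)
          c+c≢0 : c + c ≢ 0#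
          c+c≢0 eq = *-≢0 2≢0 c≢0 (trans (solve 1 (λ c → (con 1ℤ :+ con 1ℤ) :* c := c :+ c) refl c) eq)

      -- The sum is split by the leading coefficient: 0 gives `squareSum m`, and each of the q - 1
      -- others gives q^(m-1) ∑ f by equidistribution. The factor q on both sides avoids that
      -- quotient.
      squareSum-suc : ∀ m j → j ℕ.+ m ≡ t′ → j < m →
        ℤ.+ q ℤ.* squareSum (suc m) ≡
        ℤ.+ q ℤ.* squareSum m ℤ.+ (ℤ.+ (q ℕ.^ suc m) ℤ.- ℤ.+ (q ℕ.^ m)) ℤ.* ∑ K f
      squareSum-suc m j j+m≡t′ j<m = begin
        ℤ.+ q ℤ.* squareSum (suc m)
          ≡⟨ sym (∑-*ˡ K (ℤ.+ q) _) ⟩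
        ∑ K (λ c → ℤ.+ q ℤ.* P c)
          ≡⟨ ∑-cong K (λ {c} c∈ → split c∈ (0# ≟ c)) ⟩
        -- The value b is taken for every c, and the one exception c = 0 is corrected by an
        -- indicator.
        ∑ K (λ c → ι (0# ≟ c) ℤ.* (ℤ.+ q ℤ.* squareSum m ℤ.- b) ℤ.+ b)
          ≡⟨ ∑-+ K _ _ ⟩
        ∑ K (λ c → ι (0# ≟ c) ℤ.* (ℤ.+ q ℤ.* squareSum m ℤ.- b)) ℤ.+ ∑ K (λ _ → b)
          ≡⟨ cong₂ ℤ._+_ (∑-δ K-unique 0∈K (λ _ → ℤ.+ q ℤ.* squareSum m ℤ.- b)) (∑K-const b) ⟩
        ℤ.+ q ℤ.* squareSum m ℤ.- b ℤ.+ ℤ.+ q ℤ.* b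
          ≡⟨ arith (ℤ.+ q ℤ.* squareSum m) (ℤ.+ q) (ℤ.+ (q ℕ.^ m)) (∑ K f) ⟩
        ℤ.+ q ℤ.* squareSum m ℤ.+ (ℤ.+ q ℤ.* ℤ.+ (q ℕ.^ m) ℤ.- ℤ.+ (q ℕ.^ m)) ℤ.* ∑ K f
          ≡⟨ cong (λ z → ℤ.+ q ℤ.* squareSum m ℤ.+ (z ℤ.- ℤ.+ (q ℕ.^ m)) ℤ.* ∑ K f) (sym (pos-^-suc q m)) ⟩
        ℤ.+ q ℤ.* squareSum m ℤ.+ (ℤ.+ (q ℕ.^ suc m) ℤ.- ℤ.+ (q ℕ.^ m)) ℤ.* ∑ K f ∎
        where
        b : ℤ
        b = ℤ.+ (q ℕ.^ m) ℤ.* ∑ K f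

        P : Carrier → ℤ
        P c = polySum m (λ y → f (s ((y + c * pow θ m) * (y + c * pow θ m))))

        arith : ∀ a q p f → a ℤ.- p ℤ.* f ℤ.+ q ℤ.* (p ℤ.* f) ≡ a ℤ.+ (q ℤ.* p ℤ.- p) ℤ.* f
        arith = solve-∀

        one : ∀ a b → a ≡ 1ℤ ℤ.* (a ℤ.- b) ℤ.+ b
        one = solve-∀

        split : ∀ {c} → c ∈ K → (d : Dec (0# ≡ c)) → ℤ.+ q ℤ.* P c ≡ ι d ℤ.* (ℤ.+ q ℤ.* squareSum m ℤ.- b) ℤ.+ b
        split c∈ (yes refl) = trans
          (cong (ℤ.+ q ℤ.*_) (polySum-cong m λ {y} _ → cong (λ z → f (s (z * z)))
            (solve 2 (λ y p → y :+ con 0ℤ :* p := y) refl y (pow θ m))))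
          (one (ℤ.+ q ℤ.* squareSum m) b)
        split c∈ (no 0≢c) = trans (equidistribution m j j+m≡t′ j<m c∈ (0≢c ∘ sym)) (sym (ℤ.+-identityˡ b))

      -- `squareSum-suc` telescopes. Its condition j < m for j = t′ - m holds from m = n on as soon
      -- as t′ < 2n, that is, beyond the isotropic half.
      squareSum-+ : ∀ n d → t′ < n ℕ.+ n → n ℕ.+ d ≤ suc t′ →
        ℤ.+ q ℤ.* squareSum (n ℕ.+ d) ≡
        ℤ.+ q ℤ.* squareSum n ℤ.+ (ℤ.+ (q ℕ.^ (n ℕ.+ d)) ℤ.- ℤ.+ (q ℕ.^ n)) ℤ.* ∑ K f
      squareSum-+ n zero _ _ rewrite ℕ.+-identityʳ n = arith (ℤ.+ q ℤ.* squareSum n) (ℤ.+ (q ℕ.^ n)) (∑ K f)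
        where
        arith : ∀ a p f → a ≡ a ℤ.+ (p ℤ.- p) ℤ.* f
        arith = solve-∀
      squareSum-+ n (suc d) t′<2n n+d<t rewrite ℕ.+-suc n d = begin
        ℤ.+ q ℤ.* squareSum (suc (n ℕ.+ d))
          ≡⟨ squareSum-suc (n ℕ.+ d) (t′ ℕ.∸ (n ℕ.+ d)) (ℕ.m∸n+n≡m (ℕ.s≤s⁻¹ n+d<t)) j<m ⟩
        ℤ.+ q ℤ.* squareSum (n ℕ.+ d) ℤ.+ (ℤ.+ (q ℕ.^ suc (n ℕ.+ d)) ℤ.- ℤ.+ (q ℕ.^ (n ℕ.+ d))) ℤ.* ∑ K f
          ≡⟨ cong (λ z → z ℤ.+ (ℤ.+ (q ℕ.^ suc (n ℕ.+ d)) ℤ.- ℤ.+ (q ℕ.^ (n ℕ.+ d))) ℤ.* ∑ K f)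
               (squareSum-+ n d t′<2n (ℕ.<⇒≤ n+d<t)) ⟩
        ℤ.+ q ℤ.* squareSum n ℤ.+ (ℤ.+ (q ℕ.^ (n ℕ.+ d)) ℤ.- ℤ.+ (q ℕ.^ n)) ℤ.* ∑ K f
          ℤ.+ (ℤ.+ (q ℕ.^ suc (n ℕ.+ d)) ℤ.- ℤ.+ (q ℕ.^ (n ℕ.+ d))) ℤ.* ∑ K f
          ≡⟨ arith (ℤ.+ q ℤ.* squareSum n) (ℤ.+ (q ℕ.^ (n ℕ.+ d))) (ℤ.+ (q ℕ.^ n)) (ℤ.+ (q ℕ.^ suc (n ℕ.+ d))) (∑ K f) ⟩
        ℤ.+ q ℤ.* squareSum n ℤ.+ (ℤ.+ (q ℕ.^ suc (n ℕ.+ d)) ℤ.- ℤ.+ (q ℕ.^ n)) ℤ.* ∑ K f ∎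
        where
        arith : ∀ a b c d f → a ℤ.+ (b ℤ.- c) ℤ.* f ℤ.+ (d ℤ.- b) ℤ.* f ≡ a ℤ.+ (d ℤ.- c) ℤ.* f
        arith = solve-∀
        j<m : t′ ℕ.∸ (n ℕ.+ d) < n ℕ.+ d
        j<m = ℕ.<-≤-trans (ℕ.≤-<-trans (ℕ.∸-monoʳ-≤ t′ (ℕ.m≤m+n n d))
          (subst (t′ ℕ.∸ n <_) (ℕ.m+n∸n≡m n n) (ℕ.∸-monoˡ-< t′<2n (ℕ.≤-trans n≤n+d (ℕ.s≤s⁻¹ n+d<t))))) n≤n+d
          where
          n≤n+d : n ≤ n ℕ.+ d
          n≤n+d = ℕ.m≤m+n n d

      squareSum-isotropic : ∀ n → n ℕ.+ n ≤ suc t′ → squareSum n ≡ ℤ.+ (q ℕ.^ n) ℤ.* f 0#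
      squareSum-isotropic n 2n≤t = trans (polySum-cong n λ y∈ → cong f (span-square y∈ 2n≤t)) (polySum-const n _)

      -- For t odd the subspace orthogonal to the isotropic span of 1, ..., θ^(n-1) has one extra
      -- dimension, spanned by θ^n with s(θ^(2n)) = 1; only c² survives.
      squareSum-middle : ∀ n → n ℕ.+ n ≡ t′ → squareSum (suc n) ≡ ℤ.+ (q ℕ.^ n) ℤ.* ∑ K (λ c → f (c * c))
      squareSum-middle n 2n≡t′ = trans
        (∑-cong K λ c∈ → trans (polySum-cong n λ y∈ → cong f (value y∈ c∈)) (polySum-const n _))
        (∑-*ˡ K (ℤ.+ (q ℕ.^ n)) _)
        where
        value : ∀ {y c} → Span n y → c ∈ K → s ((y + c * pow θ n) * (y + c * pow θ n)) ≡ c * c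
        value {y} {c} y∈ c∈ = begin
          s ((y + c * pow θ n) * (y + c * pow θ n))
            ≡⟨ s-square c∈ y n ⟩
          s (y * y) + (c + c) * s (y * pow θ n) + c * c * s (pow θ (n ℕ.+ n))
            ≡⟨ cong₂ (λ a b → s (y * y) + (c + c) * a + c * c * b) (span-orthogonal y∈ n (ℕ.≤-reflexive 2n≡t′))
                 (trans (cong (λ i → s (pow θ i)) 2n≡t′) s-top) ⟩
          s (y * y) + (c + c) * 0# + c * c * 1#
            ≡⟨ cong (λ z → z + (c + c) * 0# + c * c * 1#) (span-square y∈ (ℕ.≤-trans (ℕ.≤-reflexive 2n≡t′) (ℕ.n≤1+n t′))) ⟩
          0# + (c + c) * 0# + c * c * 1#
            ≡⟨ solve 1 (λ c → con 0ℤ :+ (c :+ c) :* con 0ℤ :+ c :* c :* con 1ℤ := c :* c) refl c ⟩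
          c * c ∎

    -- The coefficient of θ^m is recovered by s (− · θ^(t′ − m)), so representations are unique.
    multiplicity≤1 : ∀ m → m ≤ suc t′ → ∀ y → polySum m (λ u → ι (u ≟ y)) ℤ.≤ 1ℤ
    multiplicity≤1 zero    _   y with 0# ≟ y
    ... | yes _ = ℤ.≤-refl
    ... | no _  = ℤ.+≤+ ℕ.z≤n
    -- Only the leading coefficient c₀ can occur in a representation of y; after subtracting c₀ θ^m
    -- the bound for m applies.
    multiplicity≤1 (suc m) m<t y = ℤ.≤-trans (ℤ.≤-reflexive (∑-cong K λ c∈ → concentrate c∈ (c₀ ≟ _)))
      (ℤ.≤-trans (∑-mono K λ {c} _ → bound c (c₀ ≟ c)) (∑-ι≤1 K-unique c₀))
      where
      open ≡-Reasoning
      j : ℕ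
      j = t′ ℕ.∸ m
      j+m≡t′ : j ℕ.+ m ≡ t′
      j+m≡t′ = ℕ.m∸n+n≡m (ℕ.s≤s⁻¹ m<t)
      c₀ : Carrier
      c₀ = s (y * pow θ j)
      X : Carrier → ℤ
      X c = polySum m (λ u → ι ((u + c * pow θ m) ≟ y))

      coefficient : ∀ {u c} → Span m u → c ∈ K → u + c * pow θ m ≡ y → c₀ ≡ c
      coefficient {u} {c} u∈ c∈ refl = begin
        s ((u + c * pow θ m) * pow θ j)              ≡⟨ s-shift c∈ u m j ⟩
        s (u * pow θ j) + c * s (pow θ (m ℕ.+ j))
          ≡⟨ cong₂ (λ a b → a + c * b) (span-orthogonal u∈ j (ℕ.≤-reflexive j+m≡t′))
               (trans (cong (λ i → s (pow θ i)) (trans (ℕ.+-comm m j) j+m≡t′)) s-top) ⟩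
        0# + c * 1#                                  ≡⟨ trans (+-identityˡ _) (*-identityʳ c) ⟩
        c                                            ∎

      concentrate : ∀ {c} → c ∈ K → (d : Dec (c₀ ≡ c)) → X c ≡ ι d ℤ.* X c
      concentrate c∈ (yes _)   = sym (ℤ.*-identityˡ _)
      concentrate c∈ (no c₀≢c) = trans
        (polySum-cong m λ {u} u∈ → ι-no ((u + _) ≟ y) (c₀≢c ∘ coefficient u∈ c∈))
        (trans (polySum-const m 0ℤ) (ℤ.*-zeroʳ (ℤ.+ (q ℕ.^ m))))

      bound : ∀ c (d : Dec (c₀ ≡ c)) → ι d ℤ.* X c ℤ.≤ ι d
      bound c (no _)  = ℤ.≤-refl
      bound c (yes _) = subst (ℤ._≤ 1ℤ) (sym (trans (ℤ.*-identityˡ (X c)) (polySum-cong m λ {u} _ →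
          ι-⇔ ((u + c * pow θ m) ≟ y) (u ≟ (y + - (c * pow θ m)))
            (λ { refl → solve 2 (λ u a → u := u :+ a :+ :- a) refl u (c * pow θ m) })
            (λ { refl → solve 2 (λ y a → y :+ :- a :+ a := y) refl y (c * pow θ m) }))))
        (multiplicity≤1 m (ℕ.<⇒≤ m<t) (y + - (c * pow θ m)))

    -- The multiplicities are at most 1 and add up to q^t, the size of L, so each equals 1: the
    -- powers of θ form a basis of L.
    polySum-full : ∀ F → polySum (suc t′) F ≡ ∑ L F
    polySum-full F = begin
      polySum t F                                              ≡⟨ by-multiplicity F ⟩
      ∑ L (λ y → polySum t (λ u → ι (u ≟ y)) ℤ.* F y)         ≡⟨ ∑-cong L (λ {y} y∈ → trans
                                                                    (cong (ℤ._* F y) (multiplicity≡1 y∈)) (ℤ.*-identityˡ (F y))) ⟩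
      ∑ L F                                                    ∎
      where
      open ≡-Reasoning
      t : ℕ
      t = suc t′

      by-multiplicity : ∀ F → polySum t F ≡ ∑ L (λ y → polySum t (λ u → ι (u ≟ y)) ℤ.* F y)
      by-multiplicity F = begin
        polySum t F                                            ≡⟨ polySum-cong t (λ u∈ → sym (∑-δ L-unique (span⊆L u∈) F)) ⟩
        polySum t (λ u → ∑ L (λ y → ι (u ≟ y) ℤ.* F y))        ≡⟨ polySum-∑ t L (λ y u → ι (u ≟ y) ℤ.* F y) ⟩
        ∑ L (λ y → polySum t (λ u → ι (u ≟ y) ℤ.* F y))        ≡⟨ ∑-cong′ L (λ y → polySum-*ʳ t (λ u → ι (u ≟ y)) (F y)) ⟩
        ∑ L (λ y → polySum t (λ u → ι (u ≟ y)) ℤ.* F y)        ∎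

      multiplicity≡1 : ∀ {y} → y ∈ L → polySum t (λ u → ι (u ≟ y)) ≡ 1ℤ
      multiplicity≡1 = ∑-squeeze L (λ {y} _ → multiplicity≤1 t ℕ.≤-refl y) (begin
        ∑ L (λ y → polySum t (λ u → ι (u ≟ y)))                ≡⟨ ∑-cong′ L (λ y → sym (ℤ.*-identityʳ _)) ⟩
        ∑ L (λ y → polySum t (λ u → ι (u ≟ y)) ℤ.* 1ℤ)         ≡⟨ sym (by-multiplicity (λ _ → 1ℤ)) ⟩
        polySum t (λ _ → 1ℤ)                                   ≡⟨ polySum-const t 1ℤ ⟩
        ℤ.+ (q ℕ.^ t) ℤ.* 1ℤ                                   ≡⟨ ℤ.*-identityʳ _ ⟩
        ℤ.+ (q ℕ.^ t)                                          ≡⟨ sym |L| ⟩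
        ∑ L (λ _ → 1ℤ)                                         ∎)

-- Trace, norm and conjugates

module Frobenius (E : FiniteField) {p : ℕ} (p-prime : Prime p)
                 {k : ℕ} (card≡p^k : FiniteField.card E ≡ p ℕ.^ k)
                 {q r : ℕ} (q≡p^r : q ≡ p ℕ.^ r) where
  open FiniteField E
  open FieldProperties E
  open Characteristic E p-prime {k} card≡p^k
  open QuadraticCharacter E using (subfield; ∈-subfield⁺; ∈-subfield⁻)
  open Interpolation E
  open Solver using (_:+_; _:*_; :-_; _:=_; con; solve)
  open ≡-Reasoning

  pow-q^-+ : ∀ i x y → pow (x + y) (q ℕ.^ i) ≡ pow x (q ℕ.^ i) + pow y (q ℕ.^ i)
  pow-q^-+ i x y rewrite trans (cong (ℕ._^ i) q≡p^r) (ℕ.^-*-assoc p r i) = frobenius (r ℕ.* i) x y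

  σ : Carrier → Carrier
  σ x = pow x q

  σ-+ : ∀ x y → σ (x + y) ≡ σ x + σ y
  σ-+ x y rewrite q≡p^r = frobenius r x y

  σ-* : ∀ x y → σ (x * y) ≡ σ x * σ y
  σ-* x y = pow-distrib-* x y q

  σ-1 : σ 1# ≡ 1#
  σ-1 = pow-1# q

  additive-0 : ∀ {φ : Carrier → Carrier} → (∀ x y → φ (x + y) ≡ φ x + φ y) → φ 0# ≡ 0#
  additive-0 {φ} φ-+ = begin
    φ 0#                     ≡⟨ solve 1 (λ a → a := a :+ a :+ :- a) refl (φ 0#) ⟩
    φ 0# + φ 0# + - φ 0#     ≡⟨ cong (_+ - φ 0#) (trans (sym (φ-+ 0# 0#)) (cong φ (+-identityˡ 0#))) ⟩
    φ 0# + - φ 0#            ≡⟨ -‿inverseʳ _ ⟩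
    0#                       ∎

  σ-neg : ∀ x → σ (- x) ≡ - σ x
  σ-neg x = begin
    σ (- x)                  ≡⟨ solve 2 (λ a b → a := b :+ a :+ :- b) refl (σ (- x)) (σ x) ⟩
    σ x + σ (- x) + - σ x    ≡⟨ cong (_+ - σ x) (trans (sym (σ-+ x (- x))) (trans (cong σ (-‿inverseʳ x)) (additive-0 σ-+))) ⟩
    0# + - σ x               ≡⟨ +-identityˡ _ ⟩
    - σ x                    ∎

  σ-injective : ∀ {x y} → σ x ≡ σ y → x ≡ y
  σ-injective {x} {y} eq with (x + - y) ≟ 0#
  ... | yes x-y≡0 = x-y≡0⇒x≡y x-y≡0
  ... | no  x-y≢0 = contradiction (begin
    σ (x + - y)       ≡⟨ σ-+ x (- y) ⟩
    σ x + σ (- y)     ≡⟨ cong₂ _+_ eq (σ-neg y) ⟩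
    σ y + - σ y       ≡⟨ -‿inverseʳ _ ⟩
    0#                ∎) (pow-≢0 q x-y≢0)

  pow-σ : ∀ x i → pow x (q ℕ.^ suc i) ≡ pow (σ x) (q ℕ.^ i)
  pow-σ x i = sym (pow-∘ x q (q ℕ.^ i))

  σ-pow : ∀ x i → σ (pow x (q ℕ.^ i)) ≡ pow x (q ℕ.^ suc i)
  σ-pow x i = trans (pow-∘ x (q ℕ.^ i) q) (cong (pow x) (ℕ.*-comm (q ℕ.^ i) q))

  -- The map h need not be additive or multiplicative. It is used for x ↦ f′(x) on conjugates, and
  -- for constant maps.
  pow-q^-commutes : (h : Carrier → Carrier) → (∀ x → h (σ x) ≡ σ (h x)) →
                    ∀ i x → h (pow x (q ℕ.^ i)) ≡ pow (h x) (q ℕ.^ i)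
  pow-q^-commutes h hσ zero    x = trans (cong h (*-identityʳ x)) (sym (*-identityʳ (h x)))
  pow-q^-commutes h hσ (suc i) x = begin
    h (pow x (q ℕ.^ suc i))        ≡⟨ cong h (pow-σ x i) ⟩
    h (pow (σ x) (q ℕ.^ i))        ≡⟨ pow-q^-commutes h hσ i (σ x) ⟩
    pow (h (σ x)) (q ℕ.^ i)        ≡⟨ cong (λ y → pow y (q ℕ.^ i)) (hσ x) ⟩
    pow (σ (h x)) (q ℕ.^ i)        ≡⟨ sym (pow-σ (h x) i) ⟩
    pow (h x) (q ℕ.^ suc i)        ∎

  fixed-pow : ∀ {x} → σ x ≡ x → ∀ i → pow x (q ℕ.^ i) ≡ x
  -- The constant map with value x commutes with σ exactly because σ fixes x.
  fixed-pow {x} σx≡x i = sym (pow-q^-commutes (λ _ → x) (λ _ → sym σx≡x) i x)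

  +∈subfield : ∀ i {x y} → x ∈ subfield (q ℕ.^ i) → y ∈ subfield (q ℕ.^ i) → x + y ∈ subfield (q ℕ.^ i)
  +∈subfield i {x} {y} x∈ y∈ = ∈-subfield⁺ (q ℕ.^ i) (trans (pow-q^-+ i x y)
    (cong₂ _+_ (∈-subfield⁻ (q ℕ.^ i) x∈) (∈-subfield⁻ (q ℕ.^ i) y∈)))

  Tr-+ : ∀ n x y → Tr q n (x + y) ≡ Tr q n x + Tr q n y
  Tr-+ zero    x y = sym (+-identityˡ 0#)
  Tr-+ (suc n) x y = trans (cong₂ _+_ (Tr-+ n x y) (pow-q^-+ n x y))
    (solve 4 (λ a b c d → a :+ b :+ (c :+ d) := a :+ c :+ (b :+ d)) refl (Tr q n x) (Tr q n y) _ _)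

  Tr-* : ∀ n {c} → σ c ≡ c → ∀ x → Tr q n (c * x) ≡ c * Tr q n x
  Tr-* zero    _    x = sym (zeroʳ _)
  Tr-* (suc n) {c} σc≡c x = trans
    (cong₂ _+_ (Tr-* n σc≡c x) (trans (pow-distrib-* c x (q ℕ.^ n)) (cong (_* pow x (q ℕ.^ n)) (fixed-pow σc≡c n))))
    (sym (distribˡ c _ _))

  -- σ moves every summand of the trace one place up; both sides are the sum of x, x^q, ...,
  -- x^(q^n).
  Tr-telescope : ∀ n x → σ (Tr q n x) + x ≡ Tr q n x + pow x (q ℕ.^ n)
  Tr-telescope zero    x = cong₂ _+_ (additive-0 σ-+) (sym (*-identityʳ x))
  Tr-telescope (suc n) x = begin
    σ (Tr q n x + pow x (q ℕ.^ n)) + x                ≡⟨ cong (_+ x) (trans (σ-+ _ _) (cong (σ (Tr q n x) +_) (σ-pow x n))) ⟩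
    σ (Tr q n x) + pow x (q ℕ.^ suc n) + x            ≡⟨ solve 3 (λ a b c → a :+ b :+ c := a :+ c :+ b) refl _ _ x ⟩
    σ (Tr q n x) + x + pow x (q ℕ.^ suc n)            ≡⟨ cong (_+ pow x (q ℕ.^ suc n)) (Tr-telescope n x) ⟩
    Tr q n x + pow x (q ℕ.^ n) + pow x (q ℕ.^ suc n)  ∎

  Tr-fixed : ∀ n {x} → pow x (q ℕ.^ n) ≡ x → σ (Tr q n x) ≡ Tr q n x
  Tr-fixed n {x} x∈ = begin
    σ (Tr q n x)               ≡⟨ solve 2 (λ a b → a := a :+ b :+ :- b) refl _ x ⟩
    σ (Tr q n x) + x + - x     ≡⟨ cong (_+ - x) (trans (Tr-telescope n x) (cong (Tr q n x +_) x∈)) ⟩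
    Tr q n x + x + - x         ≡⟨ solve 2 (λ a b → a :+ b :+ :- b := a) refl _ x ⟩
    Tr q n x                   ∎

  Nm≡pow : ∀ n x → Nm q n x ≡ pow x (geo q n)
  Nm≡pow zero    x = refl
  Nm≡pow (suc n) x = trans (cong (_* pow x (q ℕ.^ n)) (Nm≡pow n x)) (sym (pow-+ x (geo q n) (q ℕ.^ n)))

  -- The conjugates are listed from x onwards, while `Tr` and `Nm` add the highest power last;
  -- `orbit-∷ʳ` reconciles the two orders.
  orbit : ℕ → Carrier → List Carrier
  orbit zero    x = []
  orbit (suc n) x = x ∷ orbit n (σ x)

  length-orbit : ∀ n x → length (orbit n x) ≡ n
  length-orbit zero    x = refl
  length-orbit (suc n) x = cong suc (length-orbit n (σ x))

  map-orbit : (h : Carrier → Carrier) → (∀ x → h (σ x) ≡ σ (h x)) → ∀ n x → map h (orbit n x) ≡ orbit n (h x)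
  map-orbit h hσ zero    x = refl
  map-orbit h hσ (suc n) x = cong (h x ∷_) (trans (map-orbit h hσ n (σ x)) (cong (orbit n) (hσ x)))

  orbit-∷ʳ : ∀ n x → orbit (suc n) x ≡ orbit n x ∷ʳ pow x (q ℕ.^ n)
  orbit-∷ʳ zero    x = cong (_∷ []) (sym (*-identityʳ x))
  orbit-∷ʳ (suc n) x = cong (x ∷_) (trans (orbit-∷ʳ n (σ x)) (cong (orbit n (σ x) ∷ʳ_) (sym (pow-σ x n))))

  ∈-orbit⁻ : ∀ n {x z} → z ∈ orbit n x → ∃ λ i → i < n × z ≡ pow x (q ℕ.^ i)
  ∈-orbit⁻ (suc n) {x} (here z≡x) = 0 , ℕ.z<s , trans z≡x (sym (*-identityʳ x))
  ∈-orbit⁻ (suc n) {x} (there z∈) = let i , i<n , eq = ∈-orbit⁻ n z∈ in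
    suc i , ℕ.s<s i<n , trans eq (sym (pow-σ x i))

  sumOver-∷ʳ : ∀ xs x → sumOver (xs ∷ʳ x) id ≡ sumOver xs id + x
  sumOver-∷ʳ []       x = +-comm x 0#
  sumOver-∷ʳ (y ∷ xs) x = trans (cong (y +_) (sumOver-∷ʳ xs x)) (sym (+-assoc _ _ _))

  prodOver-∷ʳ : ∀ xs x → prodOver (xs ∷ʳ x) id ≡ prodOver xs id * x
  prodOver-∷ʳ []       x = *-comm x 1#
  prodOver-∷ʳ (y ∷ xs) x = trans (cong (y *_) (prodOver-∷ʳ xs x)) (sym (*-assoc _ _ _))

  Tr≡sumOver : ∀ n x → Tr q n x ≡ sumOver (orbit n x) id
  Tr≡sumOver zero    x = refl
  Tr≡sumOver (suc n) x = trans (cong (_+ pow x (q ℕ.^ n)) (Tr≡sumOver n x))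
    (trans (sym (sumOver-∷ʳ (orbit n x) _)) (cong (λ xs → sumOver xs id) (sym (orbit-∷ʳ n x))))

  Nm≡prodOver : ∀ n x → Nm q n x ≡ prodOver (orbit n x) id
  Nm≡prodOver zero    x = refl
  Nm≡prodOver (suc n) x = trans (cong (_* pow x (q ℕ.^ n)) (Nm≡prodOver n x))
    (trans (sym (prodOver-∷ʳ (orbit n x) _)) (cong (λ xs → prodOver xs id) (sym (orbit-∷ʳ n x))))

-- The character sum S

module Tower (E : FiniteField) {p : ℕ} (p-prime : Prime p)
             {k : ℕ} (card≡p^k : FiniteField.card E ≡ p ℕ.^ k)
             {q r : ℕ} (q≡p^r : q ≡ p ℕ.^ r) {hq : ℕ} (q≡ : q ≡ suc (2 ℕ.* hq)) {t′ : ℕ}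
             {θ : FiniteField.Carrier E}
             (θ-generator : Generators.IsGenerator E (2 ℕ.* (hq ℕ.* geo q (suc t′))) θ) where
  open FiniteField E
  open FieldProperties E
  open Generators E
  open QuadraticCharacter E
  open Frobenius E p-prime {k} card≡p^k {q} {r} q≡p^r public
  open Interpolation E
  open Reindexing _≟_
  open Solver using (_:+_; _:*_; :-_; _:=_; con; solve)
  open ≡-Reasoning

  t Q : ℕ
  t = suc t′
  Q = q ℕ.^ t

  Q≡ : Q ≡ suc (2 ℕ.* (hq ℕ.* geo q t))
  Q≡ = trans (cong (ℕ._^ t) q≡) (trans (sym (geo-sum (2 ℕ.* hq) t))
    (cong suc (trans (cong (λ n → 2 ℕ.* hq ℕ.* geo n t) (sym q≡)) (ℕ.*-assoc 2 hq _))))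

  hq>0 : 0 < hq
  hq>0 = ℕ.n≢0⇒n>0 λ { refl → ℕ.<-irrefl refl (IsGenerator.N>0 θ-generator) }

  q-1>0 : 0 < 2 ℕ.* hq
  q-1>0 = ℕ.*-monoʳ-< 2 hq>0

  geo-q>0 : ∀ {n} → 0 < n → 0 < geo q n
  geo-q>0 {n} n>0 = subst (λ a → 0 < geo a n) (sym q≡) (geo>0 (2 ℕ.* hq) n>0)

  -- The norm of θ from L to K, written as a power so that κ^j and θ^j share the exponent j.
  κ : Carrier
  κ = pow θ (geo q t)

  κ-generator : IsGenerator (2 ℕ.* hq) κ
  κ-generator = generator-pow q-1>0 (geo-q>0 {t} ℕ.z<s)
    (subst (λ N → IsGenerator N θ) (sym (ℕ.*-assoc 2 hq _)) θ-generator)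

  module K = OddSubfield {q} {H = hq} q≡ refl κ-generator
  module L = OddSubfield {Q} {H = hq ℕ.* geo q t} Q≡ refl θ-generator

  σ-fixed : ∀ {x} → x ∈ K.F → σ x ≡ x
  σ-fixed = ∈-subfield⁻ q

  K⊆L : ∀ {x} → x ∈ K.F → x ∈ L.F
  K⊆L x∈ = ∈-subfield⁺ Q (fixed-pow (σ-fixed x∈) t)

  +∈K : ∀ {x y} → x ∈ K.F → y ∈ K.F → x + y ∈ K.F
  +∈K {x} {y} x∈ y∈ = ∈-subfield⁺ q (trans (σ-+ x y) (cong₂ _+_ (σ-fixed x∈) (σ-fixed y∈)))

  +∈L : ∀ {x y} → x ∈ L.F → y ∈ L.F → x + y ∈ L.F
  +∈L = +∈subfield t

  Tr∈K : ∀ {x} → x ∈ L.F → Tr q t x ∈ K.F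
  Tr∈K x∈ = ∈-subfield⁺ q (Tr-fixed t (∈-subfield⁻ Q x∈))

  -- The conjugates of θ and the functional s

  conjugates : List Carrier
  conjugates = orbit t θ

  pow-q^-Q : pow θ Q ≡ θ
  pow-q^-Q = subst (λ x → pow x Q ≡ x) (*-identityʳ θ) (∈-subfield⁻ Q (L.pow∈F 1))

  -- The exponents q^i with i < t are distinct and lie below the order q^t - 1 of θ, where distinct
  -- exponents give distinct powers.
  conjugates-unique : Unique conjugates
  conjugates-unique = subst (λ x → Unique (orbit t x)) (*-identityʳ θ) (orbit-unique t 0 (ℕ.≤-refl))
    where
    1<q : 1 < q
    1<q = subst (1 <_) (sym q≡) (ℕ.s<s q-1>0)

    -- The strict bound q^t′ < q^t - 1 uses q ≥ 3 and already holds for t = 1.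
    bound : ∀ {i} → i < t → q ℕ.^ i < 2 ℕ.* (hq ℕ.* geo q t)
    bound {i} i<t = ℕ.≤-<-trans (ℕ.^-monoʳ-≤ q {{ℕ.>-nonZero (ℕ.<⇒≤ 1<q)}} (ℕ.s≤s⁻¹ i<t)) (ℕ.s<s⁻¹
      (subst (suc (q ℕ.^ t′) <_) Q≡ (subst (λ n → suc (q ℕ.^ t′) < n ℕ.* q ℕ.^ t′) (sym q≡) grow)))
      where
      x>0 : 0 < q ℕ.^ t′
      x>0 = ℕ.m^n>0 q {{ℕ.>-nonZero (ℕ.<⇒≤ 1<q)}} t′
      grow : suc (q ℕ.^ t′) < suc (2 ℕ.* hq) ℕ.* q ℕ.^ t′
      grow = subst (_< suc (2 ℕ.* hq) ℕ.* q ℕ.^ t′) (ℕ.+-comm (q ℕ.^ t′) 1)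
        (ℕ.+-monoʳ-< (q ℕ.^ t′) (ℕ.*-mono-≤ (ℕ.*-monoʳ-≤ 2 hq>0) x>0))

    orbit-unique : ∀ n a → a ℕ.+ n ≤ t → Unique (orbit n (pow θ (q ℕ.^ a)))
    orbit-unique zero    a _ = []
    orbit-unique (suc n) a a+n<t = All.tabulate distinct ∷
      subst (λ x → Unique (orbit n x)) (sym (σ-pow θ a)) (orbit-unique n (suc a) (subst (_≤ t) (ℕ.+-suc a n) a+n<t))
      where
      distinct : ∀ {z} → z ∈ orbit n (σ (pow θ (q ℕ.^ a))) → pow θ (q ℕ.^ a) ≢ z
      distinct z∈ eq with i , i<n , refl ← ∈-orbit⁻ n z∈ = ℕ.<⇒≢ (ℕ.^-monoʳ-< q 1<q (ℕ.m≤m+n (suc a) i))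
        (IsGenerator.injective θ-generator (bound (ℕ.<-≤-trans (ℕ.m<m+n a ℕ.z<s) a+n<t))
          (bound (ℕ.<-≤-trans (subst (_< a ℕ.+ suc n) (ℕ.+-suc a i) (ℕ.+-monoʳ-< a (ℕ.s<s i<n))) a+n<t))
          (trans eq (begin
            pow (σ (pow θ (q ℕ.^ a))) (q ℕ.^ i)      ≡⟨ cong (λ x → pow x (q ℕ.^ i)) (σ-pow θ a) ⟩
            pow (pow θ (q ℕ.^ suc a)) (q ℕ.^ i)      ≡⟨ pow-∘ θ (q ℕ.^ suc a) (q ℕ.^ i) ⟩
            pow θ (q ℕ.^ suc a ℕ.* q ℕ.^ i)          ≡⟨ cong (pow θ) (sym (ℕ.^-distribˡ-+-* q (suc a) i)) ⟩
            pow θ (q ℕ.^ (suc a ℕ.+ i))              ∎)))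

  map-σ-conjugates : map σ conjugates ≡ orbit t′ (σ θ) ∷ʳ θ
  map-σ-conjugates = trans (map-orbit σ (λ _ → refl) t θ) (trans (orbit-∷ʳ t′ (σ θ))
    (cong (orbit t′ (σ θ) ∷ʳ_) (trans (sym (pow-σ θ t′)) pow-q^-Q)))

  -- For x a conjugate of θ this is f′(x), with f the minimal polynomial of θ over K.
  W : Carrier → Carrier
  W x = w x conjugates

  W≢0 : ∀ x → W x ≢ 0#
  W≢0 x = w≢0 x conjugates

  W-σ : ∀ x → W (σ x) ≡ σ (W x)
  W-σ x = begin
    w (σ x) (θ ∷ orbit t′ (σ θ))     ≡⟨ sym (w-∷ʳ (σ x) (orbit t′ (σ θ)) θ) ⟩
    w (σ x) (orbit t′ (σ θ) ∷ʳ θ)    ≡⟨ cong (w (σ x)) (sym map-σ-conjugates) ⟩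
    w (σ x) (map σ conjugates)       ≡⟨ w-hom σ σ-+ σ-* σ-1 σ-neg σ-injective x conjugates ⟩
    σ (W x)                          ∎

  μ : Carrier
  μ = W θ

  μ∈L : μ ∈ L.F
  μ∈L = ∈-subfield⁺ Q (trans (sym (pow-q^-commutes W W-σ t θ)) (cong W pow-q^-Q))

  s : Carrier → Carrier
  s x = Tr q t (μ ⁻¹ * x)

  -- The function x ↦ x^j / f′(x) commutes with σ, so the trace of its value at θ is the sum of its
  -- values at all conjugates, a divided difference.
  s-pow : ∀ j → s (pow θ j) ≡ divided j conjugates
  s-pow j = begin
    Tr q t (μ ⁻¹ * pow θ j)                ≡⟨ cong (Tr q t) (*-comm _ _) ⟩
    Tr q t (F θ)                           ≡⟨ Tr≡sumOver t (F θ) ⟩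
    sumOver (orbit t (F θ)) id             ≡⟨ cong (λ xs → sumOver xs id) (sym (map-orbit F F-σ t θ)) ⟩
    sumOver (map F conjugates) id          ≡⟨ sumOver-map conjugates F id ⟩
    divided j conjugates                   ∎
    where
    F : Carrier → Carrier
    F x = pow x j * W x ⁻¹
    F-σ : ∀ x → F (σ x) ≡ σ (F x)
    F-σ x = trans (cong₂ _*_ (pow-swap x q j) (trans (cong _⁻¹ (W-σ x)) (sym (pow-⁻¹ q (W≢0 x))))) (sym (σ-* _ _))

  s-+ : ∀ x y → s (x + y) ≡ s x + s y
  s-+ x y = trans (cong (Tr q t) (distribˡ _ x y)) (Tr-+ t _ _)

  s-* : ∀ {c} → c ∈ K.F → ∀ x → s (c * x) ≡ c * s x
  s-* {c} c∈ x = trans (cong (Tr q t) (solve 3 (λ m c x → m :* (c :* x) := c :* (m :* x)) refl (μ ⁻¹) c x)) (Tr-* t (σ-fixed c∈) _)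

  s∈K : ∀ {x} → x ∈ L.F → s x ∈ K.F
  s∈K x∈ = Tr∈K (L.*∈F (L.⁻¹∈F μ∈L (W≢0 θ)) x∈)

  s-low : ∀ {j} → j < t′ → s (pow θ j) ≡ 0#
  s-low {j} j<t′ = trans (s-pow j) (divided-low j conjugates conjugates-unique (ℕ.s<s (subst (j <_) (sym (length-orbit t′ (σ θ))) j<t′)))

  s-top : s (pow θ t′) ≡ 1#
  s-top = trans (s-pow t′) (divided-top t′ conjugates conjugates-unique (cong suc (sym (length-orbit t′ (σ θ)))))

  2≢0 : 1# + 1# ≢ 0#
  2≢0 eq = K.x≢-x (0≢1 ∘ sym) (trans (solve 0 (con 1ℤ := con 1ℤ :+ con 1ℤ :+ :- con 1ℤ) refl)
    (trans (cong (_+ - 1#) eq) (+-identityˡ _)))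

  open CoefficientForms E
  open CoefficientForm K.F L.F (subfield-unique q) (subfield-unique Q) q t′ K.size L.size
    K.0∈F +∈K K.*∈F K.-∈F K.⁻¹∈F 2≢0 K⊆L +∈L L.*∈F θ L.pow∈F s s∈K s-+ s-* s-low s-top

  -- The square class of f′(θ)

  ρ-norm : ∀ {x} → x ∈ L.F → x ≢ 0# → ρ Q x ≡ ρ q (pow x (geo q t))
  -- For x = θ^j the norm is κ^j, and both characters are the parity of j.
  ρ-norm x∈ x≢0 with j , _ , refl ← L.logarithm x∈ x≢0 = begin
    ρ Q (pow θ j)                     ≡⟨ L.ρ-pow j ⟩
    sign j                            ≡⟨ sym (K.ρ-pow j) ⟩
    ρ q (pow κ j)                     ≡⟨ cong (ρ q) (pow-swap θ (geo q t) j) ⟩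
    ρ q (pow (pow θ j) (geo q t))     ∎

  Δ : Carrier
  Δ = vandermonde conjugates

  norm-μ : pow μ (geo q t) ≡ pow (- 1#) (triangle t) * (Δ * Δ)
  norm-μ = begin
    pow μ (geo q t)                      ≡⟨ sym (Nm≡pow t μ) ⟩
    Nm q t μ                             ≡⟨ Nm≡prodOver t μ ⟩
    prodOver (orbit t μ) id              ≡⟨ cong (λ xs → prodOver xs id) (sym (map-orbit W W-σ t θ)) ⟩
    prodOver (map W conjugates) id       ≡⟨ prodOver-map conjugates W id ⟩
    prodOver conjugates W                ≡⟨ prod-w conjugates conjugates-unique ⟩
    pow (- 1#) (triangle (length conjugates)) * (Δ * Δ)
      ≡⟨ cong (λ n → pow (- 1#) (triangle n) * (Δ * Δ)) (length-orbit t θ) ⟩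
    pow (- 1#) (triangle t) * (Δ * Δ)    ∎

  -- Frobenius permutes the conjugates cyclically, a permutation of sign (−1)^t′.
  σ-Δ : σ Δ ≡ pow (- 1#) t′ * Δ
  σ-Δ = begin
    σ Δ                                       ≡⟨ sym (vandermonde-hom σ σ-+ σ-* σ-1 σ-neg σ-injective conjugates) ⟩
    vandermonde (map σ conjugates)            ≡⟨ cong vandermonde map-σ-conjugates ⟩
    vandermonde (orbit t′ (σ θ) ∷ʳ θ)         ≡⟨ vandermonde-∷ʳ θ (orbit t′ (σ θ)) (∉-head conjugates-unique) ⟩
    pow (- 1#) (length (orbit t′ (σ θ))) * Δ  ≡⟨ cong (λ n → pow (- 1#) n * Δ) (length-orbit t′ (σ θ)) ⟩
    pow (- 1#) t′ * Δ                         ∎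

  pow-neg-2* : ∀ n → pow (- 1#) (2 ℕ.* n) ≡ 1#
  pow-neg-2* n = trans (sym (pow-∘ (- 1#) 2 n)) (trans (cong (λ x → pow x n)
    (solve 0 (:- con 1ℤ :* (:- con 1ℤ :* con 1ℤ) := con 1ℤ) refl)) (pow-1# n))

  Δ≢0 : Δ ≢ 0#
  Δ≢0 = vandermonde≢0 conjugates

  ρ-Δ² : ρ q (Δ * Δ) ≡ sign t′
  ρ-Δ² with parity t′
  ... | even n = trans (ρ-square q (∈-subfield⁺ q (trans σ-Δ′ (*-identityˡ Δ))) Δ≢0) (sym (sign-2* n))
    where
    σ-Δ′ : σ Δ ≡ 1# * Δ
    σ-Δ′ = trans σ-Δ (cong (_* Δ) (pow-neg-2* n))
  ... | odd n = trans (ρ-nonsquare q (*-≢0 Δ≢0 Δ≢0) nonsquare) (sym (sign-1+2* n))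
    where
    σ-Δ′ : σ Δ ≡ - Δ
    σ-Δ′ = trans σ-Δ (trans (cong (λ z → - 1# * z * Δ) (pow-neg-2* n))
      (solve 1 (λ d → :- con 1ℤ :* con 1ℤ :* d := :- d) refl Δ))
    Δ∉K : Δ ∉ K.F
    Δ∉K Δ∈ = K.x≢-x Δ≢0 (trans (sym (σ-fixed Δ∈)) σ-Δ′)
    nonsquare : ∀ {y} → y ∈ K.F → y * y ≢ Δ * Δ
    nonsquare {y} y∈ eq with square-roots (sym eq)
    ... | inj₁ Δ≡y  = Δ∉K (subst (_∈ K.F) (sym Δ≡y) y∈)
    ... | inj₂ Δ≡-y = Δ∉K (subst (_∈ K.F) (sym Δ≡-y) (K.-∈F y∈))

  Δ²∈K : Δ * Δ ∈ K.F
  Δ²∈K = ∈-subfield⁺ q (begin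
    σ (Δ * Δ)                                        ≡⟨ trans (σ-* Δ Δ) (cong₂ _*_ σ-Δ σ-Δ) ⟩
    pow (- 1#) t′ * Δ * (pow (- 1#) t′ * Δ)          ≡⟨ solve 2 (λ a d → a :* d :* (a :* d) := a :* a :* (d :* d)) refl _ Δ ⟩
    pow (- 1#) t′ * pow (- 1#) t′ * (Δ * Δ)          ≡⟨ cong (_* (Δ * Δ)) (trans (sym (pow-+ (- 1#) t′ t′))
                                                          (trans (cong (λ n → pow (- 1#) (t′ ℕ.+ n)) (sym (ℕ.+-identityʳ t′))) (pow-neg-2* t′))) ⟩
    1# * (Δ * Δ)                                     ≡⟨ *-identityˡ _ ⟩
    Δ * Δ                                            ∎)

  pow-neg∈K : ∀ n → pow (- 1#) n ∈ K.F
  pow-neg∈K zero    = K.1∈F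
  pow-neg∈K (suc n) = K.*∈F K.-1∈F (pow-neg∈K n)

  ρ-μ : ρ Q μ ≡ ρ q (pow (- 1#) (triangle t)) ℤ.* sign t′
  ρ-μ = trans (ρ-norm μ∈L (W≢0 θ)) (trans (cong (ρ q) norm-μ)
    (trans (K.ρ-* (pow-neg∈K (triangle t)) Δ²∈K) (cong (ρ q (pow (- 1#) (triangle t)) ℤ.*_) ρ-Δ²)))

  -- The exponent is n(2n - 1), which has the parity of n; likewise n(2n + 1) in the odd case below.
  pow-neg-triangle-2* : ∀ n → pow (- 1#) (triangle (n ℕ.+ n)) ≡ pow (- 1#) n
  pow-neg-triangle-2* zero    = refl
  pow-neg-triangle-2* (suc n) rewrite ℕ.+-suc n n = begin
    - 1# * pow (- 1#) (n ℕ.+ n ℕ.+ (n ℕ.+ n ℕ.+ triangle (n ℕ.+ n)))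
      ≡⟨ cong (- 1# *_) (trans (pow-+ (- 1#) (n ℕ.+ n) _) (cong (pow (- 1#) (n ℕ.+ n) *_) (pow-+ (- 1#) (n ℕ.+ n) _))) ⟩
    - 1# * (pow (- 1#) (n ℕ.+ n) * (pow (- 1#) (n ℕ.+ n) * pow (- 1#) (triangle (n ℕ.+ n))))
      ≡⟨ cong₂ (λ a b → - 1# * (a * (a * b)))
           (trans (cong (λ m → pow (- 1#) (n ℕ.+ m)) (sym (ℕ.+-identityʳ n))) (pow-neg-2* n)) (pow-neg-triangle-2* n) ⟩
    - 1# * (1# * (1# * pow (- 1#) n))
      ≡⟨ solve 1 (λ a → :- con 1ℤ :* (con 1ℤ :* (con 1ℤ :* a)) := :- con 1ℤ :* a) refl _ ⟩
    - 1# * pow (- 1#) n ∎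

  pow-neg-triangle-1+2* : ∀ n → pow (- 1#) (triangle (suc (n ℕ.+ n))) ≡ pow (- 1#) n
  pow-neg-triangle-1+2* n = begin
    pow (- 1#) (n ℕ.+ n ℕ.+ triangle (n ℕ.+ n))             ≡⟨ pow-+ (- 1#) (n ℕ.+ n) _ ⟩
    pow (- 1#) (n ℕ.+ n) * pow (- 1#) (triangle (n ℕ.+ n))
      ≡⟨ cong₂ _*_ (trans (cong (λ m → pow (- 1#) (n ℕ.+ m)) (sym (ℕ.+-identityʳ n))) (pow-neg-2* n)) (pow-neg-triangle-2* n) ⟩
    1# * pow (- 1#) n                                        ≡⟨ *-identityˡ _ ⟩
    pow (- 1#) n                                             ∎

  instance
    q-nonZero : ℤ.NonZero (ℤ.+ q)
    q-nonZero = ℕ.>-nonZero (subst (0 <_) (sym q≡) ℕ.z<s)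

  -- Evaluation of S

  S : Carrier → ℤ
  S c = ∑ L.F (λ x → ρ Q x ℤ.* ι (Tr q t x ≟ c))

  traceCount : Carrier → ℤ
  traceCount c = ∑ L.F (λ x → ι (Tr q t x ≟ c))

  ∑L-scale : (f : Carrier → ℤ) → ∑ L.F (λ x → f (μ * x)) ≡ ∑ L.F f
  ∑L-scale = ∑-reindex (subfield-unique Q) (μ *_) (μ ⁻¹ *_) (L.*∈F μ∈L) (L.*∈F (L.⁻¹∈F μ∈L (W≢0 θ))) cancel
    (λ x → trans (solve 3 (λ a b x → a :* (b :* x) := b :* (a :* x)) refl μ (μ ⁻¹) x) (cancel x))
    where
    cancel : ∀ x → μ ⁻¹ * (μ * x) ≡ x
    cancel x = trans (sym (*-assoc _ _ _)) (trans (cong (_* x) (trans (*-comm _ _) (x*x⁻¹≡1 (W≢0 θ)))) (*-identityˡ x))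

  s-μ* : ∀ x → s (μ * x) ≡ Tr q t x
  s-μ* x = cong (Tr q t) (trans (sym (*-assoc _ _ _)) (trans (cong (_* x) (trans (*-comm _ _) (x*x⁻¹≡1 (W≢0 θ)))) (*-identityˡ x)))

  -- Since s(θ^t′) = 1, translation by k θ^t′ shifts s by k. Averaged over k in K, every x of L
  -- meets the value c exactly once.
  traceCount≡ : ∀ {c} → c ∈ K.F → traceCount c ≡ ℤ.+ (q ℕ.^ t′)
  traceCount≡ {c} c∈ = ℤ.*-cancelˡ-≡ (ℤ.+ q) _ _ (begin
    ℤ.+ q ℤ.* traceCount c
      ≡⟨ cong (ℤ.+ q ℤ.*_) (trans (∑-cong′ L.F λ x → cong (λ z → ι (z ≟ c)) (sym (s-μ* x))) (∑L-scale (λ x → ι (s x ≟ c)))) ⟩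
    ℤ.+ q ℤ.* ∑ L.F (λ x → ι (s x ≟ c))
      ≡⟨ sym (∑K-const _) ⟩
    ∑ K.F (λ k → ∑ L.F (λ x → ι (s x ≟ c)))
      ≡⟨ ∑-cong K.F (λ k∈ → sym (translate k∈ (λ x → ι (s x ≟ c)))) ⟩
    ∑ K.F (λ k → ∑ L.F (λ x → ι (s (x + k * pow θ t′) ≟ c)))
      ≡⟨ ∑-swap K.F L.F _ ⟩
    ∑ L.F (λ x → ∑ K.F (λ k → ι (s (x + k * pow θ t′) ≟ c)))
      ≡⟨ ∑-cong L.F (λ {x} x∈ → ∑-cong K.F λ {k} k∈ → ι-⇔ (s (x + k * pow θ t′) ≟ c) ((c + - s x) ≟ k)
           (λ eq → trans (cong (_+ - s x) (trans (sym eq) (s-translate x k∈))) (solve 2 (λ a k → a :+ k :+ :- a := k) refl (s x) k))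
           (λ eq → trans (s-translate x k∈) (trans (cong (s x +_) (sym eq)) (solve 2 (λ a c → a :+ (c :+ :- a) := c) refl (s x) c)))) ⟩
    ∑ L.F (λ x → ∑ K.F (λ k → ι ((c + - s x) ≟ k)))
      ≡⟨ ∑-cong L.F (λ x∈ → ∑-count (subfield-unique q) (+∈K c∈ (K.-∈F (s∈K x∈)))) ⟩
    ∑ L.F (λ _ → 1ℤ)
      ≡⟨ trans L.size (pos-^-suc q t′) ⟩
    ℤ.+ q ℤ.* ℤ.+ (q ℕ.^ t′) ∎)
    where
    translate : ∀ {k} → k ∈ K.F → (f : Carrier → ℤ) → ∑ L.F (λ x → f (x + k * pow θ t′)) ≡ ∑ L.F f
    translate {k} k∈ = ∑-reindex (subfield-unique Q) (_+ a) (_+ - a)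
      (λ x∈ → +∈L x∈ a∈) (λ x∈ → +∈L x∈ (L.-∈F a∈))
      (λ x → solve 2 (λ x a → x :+ a :+ :- a := x) refl x a) (λ x → solve 2 (λ x a → x :+ :- a :+ a := x) refl x a)
      where
      a : Carrier
      a = k * pow θ t′
      a∈ : a ∈ L.F
      a∈ = L.*∈F (K⊆L k∈) (L.pow∈F t′)

    s-translate : ∀ x {k} → k ∈ K.F → s (x + k * pow θ t′) ≡ s x + k
    s-translate x {k} k∈ = trans (s-+ x _) (cong (s x +_) (trans (s-* k∈ _) (trans (cong (k *_) s-top) (*-identityʳ k))))

  squareSum≡ : ∀ {c} → c ∈ K.F → squareSum (λ z → ι (z ≟ c)) t ≡ ℤ.+ (q ℕ.^ t′) ℤ.+ ρ Q μ ℤ.* S c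
  squareSum≡ {c} c∈ = begin
    squareSum f t
      ≡⟨ polySum-full _ ⟩
    ∑ L.F (λ y → f (s (y * y)))
      ≡⟨ ∑-fibre L.F (λ y → y * y) (subfield-unique Q) (λ y∈ → L.*∈F y∈ y∈) (λ x → f (s x)) ⟩
    ∑ L.F (λ x → ∑ L.F (λ y → ι ((y * y) ≟ x)) ℤ.* f (s x))
      ≡⟨ ∑-cong L.F (λ {x} x∈ → trans (cong (ℤ._* f (s x)) (L.count-square-roots x∈))
           (trans (ℤ.*-distribʳ-+ (f (s x)) 1ℤ (ρ Q x)) (cong (ℤ._+ ρ Q x ℤ.* f (s x)) (ℤ.*-identityˡ (f (s x)))))) ⟩
    ∑ L.F (λ x → f (s x) ℤ.+ ρ Q x ℤ.* f (s x))
      -- Replacing x by μ x turns s into the plain trace and releases the constant ρ(μ).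
      ≡⟨ sym (∑L-scale (λ x → f (s x) ℤ.+ ρ Q x ℤ.* f (s x))) ⟩
    ∑ L.F (λ x → f (s (μ * x)) ℤ.+ ρ Q (μ * x) ℤ.* f (s (μ * x)))
      ≡⟨ ∑-cong L.F (λ {x} x∈ → cong₂ (λ a b → f a ℤ.+ b ℤ.* f a) (s-μ* x) (L.ρ-* μ∈L x∈)) ⟩
    ∑ L.F (λ x → f (Tr q t x) ℤ.+ ρ Q μ ℤ.* ρ Q x ℤ.* f (Tr q t x))
      ≡⟨ ∑-+ L.F _ _ ⟩
    traceCount c ℤ.+ ∑ L.F (λ x → ρ Q μ ℤ.* ρ Q x ℤ.* f (Tr q t x))
      ≡⟨ cong₂ ℤ._+_ (traceCount≡ c∈) (trans (∑-cong′ L.F λ x → ℤ.*-assoc (ρ Q μ) (ρ Q x) _) (∑-*ˡ L.F (ρ Q μ) _)) ⟩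
    ℤ.+ (q ℕ.^ t′) ℤ.+ ρ Q μ ℤ.* S c ∎
    where
    f : Carrier → ℤ
    f z = ι (z ≟ c)

  ∑K-indicator : ∀ {c} → c ∈ K.F → ∑ K.F (λ z → ι (z ≟ c)) ≡ 1ℤ
  ∑K-indicator {c} c∈ = trans (∑-cong′ K.F λ z → ι-⇔ (z ≟ c) (c ≟ z) sym sym) (∑-count (subfield-unique q) c∈)

  S≡μ*μ*S : ∀ c {v} → ρ Q μ ℤ.* S c ≡ v → S c ≡ ρ Q μ ℤ.* v
  S≡μ*μ*S c {v} eq = begin
    S c                               ≡⟨ sym (ℤ.*-identityˡ _) ⟩
    1ℤ ℤ.* S c                        ≡⟨ cong (ℤ._* S c) (sym (L.ρ²≡1 μ∈L (W≢0 θ))) ⟩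
    ρ Q μ ℤ.* ρ Q μ ℤ.* S c           ≡⟨ ℤ.*-assoc (ρ Q μ) (ρ Q μ) (S c) ⟩
    ρ Q μ ℤ.* (ρ Q μ ℤ.* S c)         ≡⟨ cong (ρ Q μ ℤ.*_) eq ⟩
    ρ Q μ ℤ.* v                       ∎

  -- Here n + 1 = t/2. The isotropic half of dimension n + 1 contributes q^(n+1) copies of the value
  -- 0, and the other coefficients are equidistributed. After the main term q^t′ is removed, a
  -- multiple of the indicator of c = 0 and a constant remain.
  S-even : ∀ n → t ≡ suc n ℕ.+ suc n → ∀ {c} → c ∈ K.F →
    S c ≡ ℤ.- ρ q (pow (- 1#) (suc n)) ℤ.* (ℤ.+ (q ℕ.^ suc n) ℤ.* ι (0# ≟ c) ℤ.- ℤ.+ (q ℕ.^ n))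
  S-even n t≡ {c} c∈ = trans (S≡μ*μ*S c (ℤ.*-cancelˡ-≡ (ℤ.+ q) _ _ q*))
    (cong (ℤ._* (ℤ.+ (q ℕ.^ suc n) ℤ.* ι (0# ≟ c) ℤ.- ℤ.+ (q ℕ.^ n))) η)
    where
    f : Carrier → ℤ
    f z = ι (z ≟ c)

    t′≡ : t′ ≡ suc (2 ℕ.* n)
    t′≡ = trans (ℕ.suc-injective t≡) (trans (ℕ.+-suc n n) (cong (λ m → suc (n ℕ.+ m)) (sym (ℕ.+-identityʳ n))))

    -- The minus sign comes from Δ²: as t′ is odd, Frobenius negates Δ, so Δ² is not a square in K.
    η : ρ Q μ ≡ ℤ.- ρ q (pow (- 1#) (suc n))
    η = trans ρ-μ (trans (cong₂ ℤ._*_ (cong (ρ q) (trans (cong (λ m → pow (- 1#) (triangle m)) t≡) (pow-neg-triangle-2* (suc n))))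
        (trans (cong sign t′≡) (sign-1+2* n))) (trans (ℤ.*-comm (ρ q (pow (- 1#) (suc n))) -1ℤ) (ℤ.-1*i≡-i _)))

    arith : ∀ q a b x y i → q ℤ.* (a ℤ.+ x) ≡ q ℤ.* (b ℤ.* i) ℤ.+ (q ℤ.* a ℤ.- q ℤ.* y) ℤ.* 1ℤ → q ℤ.* x ≡ q ℤ.* (b ℤ.* i ℤ.- y)
    arith q a b x y i eq = trans (expand q a x) (trans (cong (ℤ._- q ℤ.* a) eq) (collect q a b y i))
      where
      expand : ∀ q a x → q ℤ.* x ≡ q ℤ.* (a ℤ.+ x) ℤ.- q ℤ.* a
      expand = solve-∀
      collect : ∀ q a b y i → q ℤ.* (b ℤ.* i) ℤ.+ (q ℤ.* a ℤ.- q ℤ.* y) ℤ.* 1ℤ ℤ.- q ℤ.* a ≡ q ℤ.* (b ℤ.* i ℤ.- y)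
      collect = solve-∀

    q* : ℤ.+ q ℤ.* (ρ Q μ ℤ.* S c) ≡ ℤ.+ q ℤ.* (ℤ.+ (q ℕ.^ suc n) ℤ.* ι (0# ≟ c) ℤ.- ℤ.+ (q ℕ.^ n))
    q* = arith (ℤ.+ q) (ℤ.+ (q ℕ.^ t′)) (ℤ.+ (q ℕ.^ suc n)) (ρ Q μ ℤ.* S c) (ℤ.+ (q ℕ.^ n)) (ι (0# ≟ c)) (begin
      ℤ.+ q ℤ.* (ℤ.+ (q ℕ.^ t′) ℤ.+ ρ Q μ ℤ.* S c)
        ≡⟨ cong (ℤ.+ q ℤ.*_) (sym (squareSum≡ c∈)) ⟩
      ℤ.+ q ℤ.* squareSum f t
        ≡⟨ cong (λ m → ℤ.+ q ℤ.* squareSum f m) t≡ ⟩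
      ℤ.+ q ℤ.* squareSum f (suc n ℕ.+ suc n)
        ≡⟨ squareSum-+ f (suc n) (suc n) (ℕ.≤-reflexive t≡) (ℕ.≤-reflexive (sym t≡)) ⟩
      ℤ.+ q ℤ.* squareSum f (suc n) ℤ.+ (ℤ.+ (q ℕ.^ (suc n ℕ.+ suc n)) ℤ.- ℤ.+ (q ℕ.^ suc n)) ℤ.* ∑ K.F f
        ≡⟨ cong₂ (λ a b → ℤ.+ q ℤ.* a ℤ.+ (ℤ.+ (q ℕ.^ (suc n ℕ.+ suc n)) ℤ.- ℤ.+ (q ℕ.^ suc n)) ℤ.* b)
             (squareSum-isotropic f (suc n) (ℕ.≤-reflexive (sym t≡))) (∑K-indicator c∈) ⟩
      ℤ.+ q ℤ.* (ℤ.+ (q ℕ.^ suc n) ℤ.* ι (0# ≟ c)) ℤ.+ (ℤ.+ (q ℕ.^ (suc n ℕ.+ suc n)) ℤ.- ℤ.+ (q ℕ.^ suc n)) ℤ.* 1ℤ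
        ≡⟨ cong₂ (λ a b → ℤ.+ q ℤ.* (ℤ.+ (q ℕ.^ suc n) ℤ.* ι (0# ≟ c)) ℤ.+ (a ℤ.- b) ℤ.* 1ℤ)
             (trans (cong (λ m → ℤ.+ (q ℕ.^ m)) (sym t≡)) (pos-^-suc q t′)) (pos-^-suc q n) ⟩
      ℤ.+ q ℤ.* (ℤ.+ (q ℕ.^ suc n) ℤ.* ι (0# ≟ c)) ℤ.+ (ℤ.+ q ℤ.* ℤ.+ (q ℕ.^ t′) ℤ.- ℤ.+ q ℤ.* ℤ.+ (q ℕ.^ n)) ℤ.* 1ℤ ∎)

  -- Here 2n + 1 = t. The middle coordinate represents c as a square in 1 + ρ(c) ways; the summand 1
  -- goes into the main term and ρ(c) stays.
  S-odd : ∀ n → t′ ≡ n ℕ.+ n → ∀ {c} → c ∈ K.F →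
    S c ≡ ρ q (pow (- 1#) n) ℤ.* (ℤ.+ (q ℕ.^ n) ℤ.* ρ q c)
  S-odd n t′≡ {c} c∈ = trans (S≡μ*μ*S c (ℤ.*-cancelˡ-≡ (ℤ.+ q) _ _ q*)) (cong (ℤ._* (ℤ.+ (q ℕ.^ n) ℤ.* ρ q c)) η)
    where
    f : Carrier → ℤ
    f z = ι (z ≟ c)

    η : ρ Q μ ≡ ρ q (pow (- 1#) n)
    η = trans ρ-μ (trans (cong₂ ℤ._*_ (cong (ρ q) (trans (cong (λ m → pow (- 1#) (triangle (suc m))) t′≡) (pow-neg-triangle-1+2* n)))
        (trans (cong sign (trans t′≡ (cong (n ℕ.+_) (sym (ℕ.+-identityʳ n))))) (sign-2* n))) (ℤ.*-identityʳ _))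

    arith : ∀ q a b x r → q ℤ.* (a ℤ.+ x) ≡ q ℤ.* (b ℤ.* (1ℤ ℤ.+ r)) ℤ.+ (q ℤ.* a ℤ.- q ℤ.* b) ℤ.* 1ℤ → q ℤ.* x ≡ q ℤ.* (b ℤ.* r)
    arith q a b x r eq = trans (expand q a x) (trans (cong (ℤ._- q ℤ.* a) eq) (collect q a b r))
      where
      expand : ∀ q a x → q ℤ.* x ≡ q ℤ.* (a ℤ.+ x) ℤ.- q ℤ.* a
      expand = solve-∀
      collect : ∀ q a b r → q ℤ.* (b ℤ.* (1ℤ ℤ.+ r)) ℤ.+ (q ℤ.* a ℤ.- q ℤ.* b) ℤ.* 1ℤ ℤ.- q ℤ.* a ≡ q ℤ.* (b ℤ.* r)
      collect = solve-∀

    t≡ : t ≡ suc n ℕ.+ n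
    t≡ = cong suc t′≡

    q* : ℤ.+ q ℤ.* (ρ Q μ ℤ.* S c) ≡ ℤ.+ q ℤ.* (ℤ.+ (q ℕ.^ n) ℤ.* ρ q c)
    q* = arith (ℤ.+ q) (ℤ.+ (q ℕ.^ t′)) (ℤ.+ (q ℕ.^ n)) (ρ Q μ ℤ.* S c) (ρ q c) (begin
      ℤ.+ q ℤ.* (ℤ.+ (q ℕ.^ t′) ℤ.+ ρ Q μ ℤ.* S c)
        ≡⟨ cong (ℤ.+ q ℤ.*_) (sym (squareSum≡ c∈)) ⟩
      ℤ.+ q ℤ.* squareSum f t
        ≡⟨ cong (λ m → ℤ.+ q ℤ.* squareSum f m) t≡ ⟩
      ℤ.+ q ℤ.* squareSum f (suc n ℕ.+ n)
        ≡⟨ squareSum-+ f (suc n) n (subst (_< suc n ℕ.+ suc n) (sym t′≡) (ℕ.+-mono-< ℕ.≤-refl ℕ.≤-refl)) (ℕ.≤-reflexive (sym t≡)) ⟩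
      ℤ.+ q ℤ.* squareSum f (suc n) ℤ.+ (ℤ.+ (q ℕ.^ (suc n ℕ.+ n)) ℤ.- ℤ.+ (q ℕ.^ suc n)) ℤ.* ∑ K.F f
        ≡⟨ cong₂ (λ a b → ℤ.+ q ℤ.* a ℤ.+ (ℤ.+ (q ℕ.^ (suc n ℕ.+ n)) ℤ.- ℤ.+ (q ℕ.^ suc n)) ℤ.* b)
             (trans (squareSum-middle f n (sym t′≡)) (cong (ℤ.+ (q ℕ.^ n) ℤ.*_) (K.count-square-roots c∈))) (∑K-indicator c∈) ⟩
      ℤ.+ q ℤ.* (ℤ.+ (q ℕ.^ n) ℤ.* (1ℤ ℤ.+ ρ q c)) ℤ.+ (ℤ.+ (q ℕ.^ (suc n ℕ.+ n)) ℤ.- ℤ.+ (q ℕ.^ suc n)) ℤ.* 1ℤ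
        ≡⟨ cong₂ (λ a b → ℤ.+ q ℤ.* (ℤ.+ (q ℕ.^ n) ℤ.* (1ℤ ℤ.+ ρ q c)) ℤ.+ (a ℤ.- b) ℤ.* 1ℤ)
             (trans (cong (λ m → ℤ.+ (q ℕ.^ m)) (sym t≡)) (pos-^-suc q t′)) (pos-^-suc q n) ⟩
      ℤ.+ q ℤ.* (ℤ.+ (q ℕ.^ n) ℤ.* (1ℤ ℤ.+ ρ q c)) ℤ.+ (ℤ.+ q ℤ.* ℤ.+ (q ℕ.^ t′) ℤ.- ℤ.+ q ℤ.* ℤ.+ (q ℕ.^ n)) ℤ.* 1ℤ ∎)

-- From Nt to the character sum

odd-prime : ∀ {p} → Prime p → p ≢ 2 → ∃ λ h → p ≡ suc (2 ℕ.* h)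
odd-prime {p} pp p≢2 with parity p
... | odd h  = h , refl
... | even h with prime⇒irreducible pp {2} (divides h (ℕ.*-comm 2 h))
...   | inj₁ ()
...   | inj₂ 2≡p = contradiction (sym 2≡p) p≢2

sign-cases : ∀ n → sign n ≡ 1ℤ ⊎ sign n ≡ -1ℤ
sign-cases n with parity n
... | even k = inj₁ (sign-2* k)
... | odd k  = inj₂ (sign-1+2* k)

-- The indicator that two signs agree is half of 1 plus their product.
ι-sign : ∀ m n {P : Set} (d : Dec P) → (P → sign m ≡ sign n) → (sign m ≡ sign n → P) →
         ℤ.+ 2 ℤ.* ι d ≡ 1ℤ ℤ.+ sign n ℤ.* sign m
ι-sign m n d to from with sign-cases m | sign-cases n
... | inj₁ a | inj₁ b rewrite ι-yes d (from (trans a (sym b))) | a | b = refl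
... | inj₂ a | inj₂ b rewrite ι-yes d (from (trans a (sym b))) | a | b = refl
... | inj₁ a | inj₂ b rewrite ι-no d (λ p → contradiction (trans (sym a) (trans (to p) b)) λ ()) | a | b = refl
... | inj₂ a | inj₁ b rewrite ι-no d (λ p → contradiction (trans (sym a) (trans (to p) b)) λ ()) | a | b = refl

-- Stated for an arbitrary decision `d`, because `Nt` filters by a decision procedure local to its
-- definition.
ι-∧ : {P : Set} (d₁ : Dec P) (b : Bool) (d : Dec (T (⌊ d₁ ⌋ ∧ b))) → ι d ≡ ι d₁ ℤ.* ι (T? b)
ι-∧ (yes p) b d = trans (ι-⇔ d (T? b) id id) (sym (ℤ.*-identityˡ _))
ι-∧ (no ¬p) b d = ι-no d id

length-filter : {A : Set} {P : Pred A _} (P? : Decidable P) (xs : List A) →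
                ℤ.+ length (filter P? xs) ≡ ∑ xs (λ x → ι (P? x))
length-filter P? xs = begin
  ℤ.+ length (filter P? xs)              ≡⟨ sym (ℤ.*-identityʳ _) ⟩
  ℤ.+ length (filter P? xs) ℤ.* 1ℤ       ≡⟨ sym (∑-const (filter P? xs) 1ℤ) ⟩
  ∑ (filter P? xs) (λ _ → 1ℤ)            ≡⟨ ∑-filter P? xs (λ _ → 1ℤ) ⟩
  ∑ xs (λ x → ι (P? x) ℤ.* 1ℤ)           ≡⟨ ∑-cong′ xs (λ x → ℤ.*-identityʳ _) ⟩
  ∑ xs (λ x → ι (P? x))                  ∎
  where open ≡-Reasoning

module Counting (E : FiniteField) {p : ℕ} (p-prime : Prime p) {q r : ℕ} (q≡p^r : q ≡ p ℕ.^ r)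
                {hq : ℕ} (q≡ : q ≡ suc (2 ℕ.* hq))
                {e t′ : ℕ} (card≡q^m : FiniteField.card E ≡ q ℕ.^ (e ℕ.* suc t′)) (0<m : 0 < e ℕ.* suc t′)
                {γ : FiniteField.Carrier E} (γ-primitive : FiniteField.Primitive E γ) {h : ℕ} (h≤1 : h ≤ 1)
                {a : FiniteField.Carrier E} (a∈K : FiniteField.inSub E q 1 a ≡ true) (p∤e : ¬ (p ∣ e)) where
  open FiniteField E
  open FieldProperties E
  open Generators E
  open QuadraticCharacter E
  open Solver using (_:+_; _:*_; :-_; _:=_; con; solve)
  open ≡-Reasoning

  -- `NL` is q^t - 1, and `D` is (q^m - 1)/(q^t - 1), so that γ^D generates the multiplicative group
  -- of L.
  m NL D : ℕ
  m  = e ℕ.* suc t′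
  NL = 2 ℕ.* (hq ℕ.* geo q (suc t′))
  D  = geo (q ℕ.^ suc t′) e

  q^t≡ : q ℕ.^ suc t′ ≡ suc NL
  q^t≡ = trans (cong (ℕ._^ suc t′) q≡) (trans (sym (geo-sum (2 ℕ.* hq) (suc t′)))
    (cong suc (trans (cong (λ n → 2 ℕ.* hq ℕ.* geo n (suc t′)) (sym q≡)) (ℕ.*-assoc 2 hq _))))

  γ-generator : IsGenerator (NL ℕ.* D) γ
  γ-generator = primitive⇒generator (begin
    card                              ≡⟨ card≡q^m ⟩
    q ℕ.^ (e ℕ.* suc t′)              ≡⟨ trans (cong (q ℕ.^_) (ℕ.*-comm e (suc t′))) (sym (ℕ.^-*-assoc q (suc t′) e)) ⟩
    (q ℕ.^ suc t′) ℕ.^ e              ≡⟨ cong (ℕ._^ e) q^t≡ ⟩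
    suc NL ℕ.^ e                      ≡⟨ sym (geo-sum NL e) ⟩
    suc (NL ℕ.* geo (suc NL) e)       ≡⟨ cong (λ n → suc (NL ℕ.* geo n e)) (sym q^t≡) ⟩
    suc (NL ℕ.* D)                    ∎) γ-primitive

  θ : Carrier
  θ = pow γ D

  θ-generator : IsGenerator NL θ
  θ-generator = generator-pow
    (ℕ.n≢0⇒n>0 λ NL≡0 → ℕ.<⇒≢ (IsGenerator.N>0 γ-generator) (sym (cong (ℕ._* D) NL≡0)))
    (ℕ.n≢0⇒n>0 λ D≡0 → ℕ.<⇒≢ (IsGenerator.N>0 γ-generator) (sym (trans (cong (NL ℕ.*_) D≡0) (ℕ.*-zeroʳ NL))))
    γ-generator

  card≡p^ : card ≡ p ℕ.^ (r ℕ.* m)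
  card≡p^ = trans card≡q^m (trans (cong (ℕ._^ m) q≡p^r) (ℕ.^-*-assoc p r m))

  open Tower E p-prime {r ℕ.* m} card≡p^ {r = r} q≡p^r {hq} q≡ {t′} {θ} θ-generator
  open Characteristic E p-prime {r ℕ.* m} card≡p^ using (fromℕ-p)

  -- The norm condition as a condition on logarithms

  g : Carrier
  g = Nm q m γ

  g≡ : g ≡ pow γ (geo q m)
  g≡ = Nm≡pow m γ

  g-generator : IsGenerator (2 ℕ.* hq) g
  g-generator = subst (IsGenerator (2 ℕ.* hq)) (sym g≡) (generator-pow q-1>0 (geo-q>0 0<m)
    (primitive⇒generator (begin
      card                                    ≡⟨ card≡q^m ⟩
      q ℕ.^ m                                 ≡⟨ cong (ℕ._^ m) q≡ ⟩
      suc (2 ℕ.* hq) ℕ.^ m                    ≡⟨ sym (geo-sum (2 ℕ.* hq) m) ⟩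
      suc (2 ℕ.* hq ℕ.* geo (suc (2 ℕ.* hq)) m) ≡⟨ cong (λ n → suc (2 ℕ.* hq ℕ.* geo n m)) (sym q≡) ⟩
      suc (2 ℕ.* hq ℕ.* geo q m)              ∎) γ-primitive))

  -- The same field as `K.F`, but with logarithms to the base g, in which the cosets of `inCoset`
  -- are expressed.
  module G = OddSubfield {q} {H = hq} q≡ refl g-generator

  Nm-θ^ : ∀ j → Nm q m (pow θ j) ≡ pow g (D ℕ.* j)
  Nm-θ^ j = begin
    Nm q m (pow θ j)                  ≡⟨ Nm≡pow m (pow θ j) ⟩
    pow (pow θ j) (geo q m)           ≡⟨ cong (λ x → pow x (geo q m)) (pow-∘ γ D j) ⟩
    pow (pow γ (D ℕ.* j)) (geo q m)   ≡⟨ pow-swap γ (D ℕ.* j) (geo q m) ⟩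
    pow (pow γ (geo q m)) (D ℕ.* j)   ≡⟨ cong (λ x → pow x (D ℕ.* j)) (sym g≡) ⟩
    pow g (D ℕ.* j)                   ∎

  -- The coset of g^h contains only powers whose exponent has the parity of h, and ρ reads this
  -- parity off the element.
  inCoset⇒sign : ∀ i → T (inCoset q g h (pow g i)) → sign i ≡ sign h
  inCoset⇒sign i Ti with l , _ , eq ← find (any⁻ (λ l → ⌊ pow g i ≟ pow g (h ℕ.+ 2 ℕ.* l) ⌋) (upTo q) Ti) = begin
    sign i                            ≡⟨ sym (G.ρ-pow i) ⟩
    ρ q (pow g i)                     ≡⟨ cong (ρ q) (toWitness {a? = pow g i ≟ pow g (h ℕ.+ 2 ℕ.* l)} eq) ⟩
    ρ q (pow g (h ℕ.+ 2 ℕ.* l))       ≡⟨ G.ρ-pow (h ℕ.+ 2 ℕ.* l) ⟩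
    sign (h ℕ.+ 2 ℕ.* l)              ≡⟨ sign-+ h (2 ℕ.* l) ⟩
    sign h ℤ.* sign (2 ℕ.* l)         ≡⟨ trans (cong (sign h ℤ.*_) (sign-2* l)) (ℤ.*-identityʳ _) ⟩
    sign h                            ∎

  -- `inCoset` tries exponents h + 2l with l < q only. Since g² has order hq < q, the half-logarithm
  -- may be reduced modulo hq.
  sign⇒inCoset : ∀ i → sign i ≡ sign h → T (inCoset q g h (pow g i))
  sign⇒inCoset i eq = any⁺ (λ l → ⌊ pow g i ≟ pow g (h ℕ.+ 2 ℕ.* l) ⌋)
    (let j , i≡ = halve i h h≤1 eq in lose (∈-upTo⁺ (k<q j))
      (fromWitness {a? = pow g i ≟ pow g (h ℕ.+ 2 ℕ.* k j)} (trans (cong (pow g) i≡) (reduce j))))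
    where
    instance _ = ℕ.>-nonZero hq>0
    k : ℕ → ℕ
    k j = j % hq

    k<q : ∀ j → k j < q
    k<q j = ℕ.<-trans (m%n<n j hq) (subst (hq <_) (sym q≡) (ℕ.s≤s (ℕ.m≤m+n hq (hq ℕ.+ 0))))

    halve : ∀ i h → h ≤ 1 → sign i ≡ sign h → ∃ λ j → i ≡ h ℕ.+ 2 ℕ.* j
    halve i h h≤1 eq with parity i
    halve _ 0 _ _  | even j = j , refl
    halve _ 0 _ eq | odd j  = contradiction (trans (sym (sign-1+2* j)) eq) λ ()
    halve _ 1 _ eq | even j = contradiction (trans (sym (sign-2* j)) eq) λ ()
    halve _ 1 _ _  | odd j  = j , refl
    halve _ (suc (suc _)) (ℕ.s≤s ()) _ | _

    double : ∀ a b → 2 ℕ.* (a ℕ.+ b ℕ.* hq) ≡ 2 ℕ.* a ℕ.+ 2 ℕ.* hq ℕ.* b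
    double a b = distribute a b hq
      where
      distribute : ∀ a b c → 2 ℕ.* (a ℕ.+ b ℕ.* c) ≡ 2 ℕ.* a ℕ.+ 2 ℕ.* c ℕ.* b
      distribute = ℕ-solver.solve-∀

    reduce : ∀ j → pow g (h ℕ.+ 2 ℕ.* j) ≡ pow g (h ℕ.+ 2 ℕ.* k j)
    reduce j = begin
      pow g (h ℕ.+ 2 ℕ.* j)                                     ≡⟨ cong (λ n → pow g (h ℕ.+ 2 ℕ.* n)) (m≡m%n+[m/n]*n j hq) ⟩
      pow g (h ℕ.+ 2 ℕ.* (k j ℕ.+ j / hq ℕ.* hq))               ≡⟨ cong (λ n → pow g (h ℕ.+ n)) (double (k j) (j / hq)) ⟩
      pow g (h ℕ.+ (2 ℕ.* k j ℕ.+ 2 ℕ.* hq ℕ.* (j / hq)))       ≡⟨ cong (pow g) (sym (ℕ.+-assoc h _ _)) ⟩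
      pow g (h ℕ.+ 2 ℕ.* k j ℕ.+ 2 ℕ.* hq ℕ.* (j / hq))         ≡⟨ pow-+ g (h ℕ.+ 2 ℕ.* k j) _ ⟩
      pow g (h ℕ.+ 2 ℕ.* k j) * pow g (2 ℕ.* hq ℕ.* (j / hq))
        ≡⟨ cong (pow g (h ℕ.+ 2 ℕ.* k j) *_) (trans (sym (pow-∘ g (2 ℕ.* hq) (j / hq)))
             (trans (cong (λ x → pow x (j / hq)) (IsGenerator.pow-N g-generator)) (pow-1# (j / hq)))) ⟩
      pow g (h ℕ.+ 2 ℕ.* k j) * 1#                              ≡⟨ *-identityʳ _ ⟩
      pow g (h ℕ.+ 2 ℕ.* k j)                                   ∎

  0∉coset : ¬ T (inCoset q g h (Nm q m 0#))
  0∉coset T0 with l , _ , eq ← find (any⁻ (λ l → ⌊ Nm q m 0# ≟ pow g (h ℕ.+ 2 ℕ.* l) ⌋) (upTo q) T0) =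
    pow-≢0 (h ℕ.+ 2 ℕ.* l) (IsGenerator.θ≢0 g-generator)
      (trans (sym (toWitness {a? = Nm q m 0# ≟ pow g (h ℕ.+ 2 ℕ.* l)} eq))
        (trans (Nm≡pow m 0#) (pow-zero (geo q m) refl (geo-q>0 0<m))))

  coset : Carrier → ℤ
  coset x = ι (T? (inCoset q g h (Nm q m x)))

  coset-0 : coset 0# ≡ 0ℤ
  coset-0 = ι-no (T? (inCoset q g h (Nm q m 0#))) 0∉coset

  2*coset-θ^ : ∀ j → ℤ.+ 2 ℤ.* coset (pow θ j) ≡ 1ℤ ℤ.+ sign h ℤ.* sign (D ℕ.* j)
  2*coset-θ^ j = ι-sign (D ℕ.* j) h (T? (inCoset q g h (Nm q m (pow θ j))))
    (inCoset⇒sign (D ℕ.* j) ∘ subst (T ∘ inCoset q g h) (Nm-θ^ j))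
    (subst (T ∘ inCoset q g h) (sym (Nm-θ^ j)) ∘ sign⇒inCoset (D ℕ.* j))

  -- `D` is a sum of e powers of the odd number q^t, so it has the parity of e.
  sign-D* : ∀ j → sign (D ℕ.* j) ≡ sign e ℤ.^ j
  sign-D* j = trans (sym (ℤ.^-*-assoc -1ℤ D j)) (cong (ℤ._^ j)
    (trans (cong (λ n → sign (geo n e)) q^t≡) (sign-geo (hq ℕ.* geo q (suc t′)) e)))

  -- At x = θ^j the norm is g^(D j) with D odd, so its parity is that of j, hence η(x). At 0 the
  -- coset indicator and η both vanish, and the indicator of 0 removes the constant 1.
  2*coset-odd : sign e ≡ -1ℤ → ∀ {x} → x ∈ L.F → ℤ.+ 2 ℤ.* coset x ≡ 1ℤ ℤ.- ι (0# ≟ x) ℤ.+ sign h ℤ.* ρ Q x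
  2*coset-odd e-odd {x} x∈ = cases (0# ≟ x)
    where
    at-0 : ℤ.+ 2 ℤ.* coset 0# ≡ 0ℤ ℤ.+ sign h ℤ.* ρ Q 0#
    at-0 = trans (cong (ℤ.+ 2 ℤ.*_) coset-0)
      (sym (trans (cong (λ z → 0ℤ ℤ.+ sign h ℤ.* z) (ρ-0 Q)) (trans (ℤ.+-identityˡ _) (ℤ.*-zeroʳ (sign h)))))

    at-θ^ : ∀ j → ℤ.+ 2 ℤ.* coset (pow θ j) ≡ 1ℤ ℤ.+ sign h ℤ.* ρ Q (pow θ j)
    at-θ^ j = trans (2*coset-θ^ j) (cong (λ z → 1ℤ ℤ.+ sign h ℤ.* z)
      (trans (sign-D* j) (trans (cong (ℤ._^ j) e-odd) (sym (L.ρ-pow j)))))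

    at-log : (∃ λ j → j < NL × pow θ j ≡ x) → ℤ.+ 2 ℤ.* coset x ≡ 1ℤ ℤ.+ sign h ℤ.* ρ Q x
    at-log (j , _ , eq) = subst (λ y → ℤ.+ 2 ℤ.* coset y ≡ 1ℤ ℤ.+ sign h ℤ.* ρ Q y) eq (at-θ^ j)

    cases : (d : Dec (0# ≡ x)) → ℤ.+ 2 ℤ.* coset x ≡ 1ℤ ℤ.- ι d ℤ.+ sign h ℤ.* ρ Q x
    cases (yes 0≡x) = subst (λ y → ℤ.+ 2 ℤ.* coset y ≡ 0ℤ ℤ.+ sign h ℤ.* ρ Q y) 0≡x at-0
    cases (no 0≢x)  = at-log (L.logarithm x∈ (0≢x ∘ sym))

  -- `D` is now even, so the norm of every nonzero x is an even power of g.
  coset-even : sign e ≡ 1ℤ → h ≡ 0 → ∀ {x} → x ∈ L.F → coset x ≡ 1ℤ ℤ.- ι (0# ≟ x)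
  coset-even e-even h≡0 {x} x∈ = cases (0# ≟ x)
    where
    at-θ^ : ∀ j → coset (pow θ j) ≡ 1ℤ
    at-θ^ j = ℤ.*-cancelˡ-≡ (ℤ.+ 2) _ _ (trans (2*coset-θ^ j)
      (cong₂ (λ y z → 1ℤ ℤ.+ y ℤ.* z) (cong sign h≡0) (trans (sign-D* j) (trans (cong (ℤ._^ j) e-even) (ℤ.^-zeroˡ j)))))

    at-log : (∃ λ j → j < NL × pow θ j ≡ x) → coset x ≡ 1ℤ
    at-log (j , _ , eq) = subst (λ y → coset y ≡ 1ℤ) eq (at-θ^ j)

    cases : (d : Dec (0# ≡ x)) → coset x ≡ 1ℤ ℤ.- ι d
    cases (yes 0≡x) = subst (λ y → coset y ≡ 0ℤ) 0≡x coset-0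
    cases (no 0≢x)  = at-log (L.logarithm x∈ (0≢x ∘ sym))

  -- The trace condition

  Tr-multiple : ∀ {x} → x ∈ L.F → ∀ n → Tr q (n ℕ.* suc t′) x ≡ fromℕ n * Tr q (suc t′) x
  Tr-multiple {x} x∈ zero    = sym (zeroˡ _)
  Tr-multiple {x} x∈ (suc n) = begin
    Tr q (suc t′ ℕ.+ n ℕ.* suc t′) x                    ≡⟨ Tr-split (n ℕ.* suc t′) ⟩
    Tr q t x + Tr q (n ℕ.* suc t′) x                    ≡⟨ cong₂ _+_ (sym (*-identityˡ _)) (Tr-multiple x∈ n) ⟩
    1# * Tr q t x + fromℕ n * Tr q t x                  ≡⟨ sym (distribʳ _ _ _) ⟩
    (1# + fromℕ n) * Tr q t x                           ∎
    where
    -- On L the powers x^(q^i) have period t in i, so the first t summands of the trace split off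
    -- and the rest starts afresh.
    Tr-split : ∀ n → Tr q (t ℕ.+ n) x ≡ Tr q t x + Tr q n x
    Tr-split zero    = trans (cong (λ n → Tr q n x) (ℕ.+-identityʳ t)) (sym (+-identityʳ _))
    Tr-split (suc n) = begin
      Tr q (t ℕ.+ suc n) x                              ≡⟨ cong (λ n → Tr q n x) (ℕ.+-suc t n) ⟩
      Tr q (t ℕ.+ n) x + pow x (q ℕ.^ (t ℕ.+ n))        ≡⟨ cong₂ _+_ (Tr-split n) (begin
          pow x (q ℕ.^ (t ℕ.+ n))                         ≡⟨ cong (pow x) (ℕ.^-distribˡ-+-* q t n) ⟩
          pow x (Q ℕ.* q ℕ.^ n)                           ≡⟨ sym (pow-∘ x Q (q ℕ.^ n)) ⟩
          pow (pow x Q) (q ℕ.^ n)                         ≡⟨ cong (λ y → pow y (q ℕ.^ n)) (∈-subfield⁻ Q x∈) ⟩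
          pow x (q ℕ.^ n)                                 ∎) ⟩
      Tr q t x + Tr q n x + pow x (q ℕ.^ n)             ≡⟨ +-assoc _ _ _ ⟩
      Tr q t x + Tr q (suc n) x                         ∎

  bézout-vanishes : ∀ x y {m n} → fromℕ m ≡ 0# → fromℕ n ≡ 0# → 1 ℕ.+ x ℕ.* m ≡ y ℕ.* n → 0# ≡ 1#
  bézout-vanishes x y {m} {n} m≡0 n≡0 eq = begin
    0#                                ≡⟨ sym (trans (fromℕ-* y n) (trans (cong (fromℕ y *_) n≡0) (zeroʳ _))) ⟩
    fromℕ (y ℕ.* n)                   ≡⟨ cong fromℕ (sym eq) ⟩
    1# + fromℕ (x ℕ.* m)              ≡⟨ cong (1# +_) (trans (fromℕ-* x m) (trans (cong (fromℕ x *_) m≡0) (zeroʳ _))) ⟩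
    1# + 0#                           ≡⟨ +-identityʳ 1# ⟩
    1#                                ∎

  -- p and e are coprime, so Bézout writes 1 through multiples of both; if e vanished in the field
  -- along with p, so would 1.
  fromℕ-e≢0 : fromℕ e ≢ 0#
  fromℕ-e≢0 e≡0 with coprime-Bézout {p} {e} coprime
    where
    coprime : Coprime p e
    coprime (d∣p , d∣e) with prime⇒irreducible p-prime d∣p
    ... | inj₁ d≡1  = d≡1
    ... | inj₂ refl = contradiction d∣e p∤e
  ... | Bézout.+- x y eq = 0≢1 (bézout-vanishes y x e≡0 fromℕ-p eq)
  ... | Bézout.-+ x y eq = 0≢1 (bézout-vanishes x y fromℕ-p e≡0 eq)

  c : Carrier
  c = a * fromℕ e ⁻¹

  fromℕ∈K : ∀ n → fromℕ n ∈ K.F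
  fromℕ∈K zero    = K.0∈F
  fromℕ∈K (suc n) = +∈K K.1∈F (fromℕ∈K n)

  a∈F : a ∈ K.F
  a∈F = ∈-subfield⁺ q (trans (cong (pow a) (sym (ℕ.^-identityʳ q)))
    (toWitness {a? = pow a (q ℕ.^ 1) ≟ a} (Equivalence.from T-≡ a∈K)))

  e⁻¹∈K : fromℕ e ⁻¹ ∈ K.F
  e⁻¹∈K = K.⁻¹∈F (fromℕ∈K e) fromℕ-e≢0

  c∈K : c ∈ K.F
  c∈K = K.*∈F a∈F e⁻¹∈K

  Tr≡a⇒Tr≡c : ∀ {x} → x ∈ L.F → Tr q m x ≡ a → Tr q t x ≡ c
  Tr≡a⇒Tr≡c {x} x∈ eq = *-cancelˡ fromℕ-e≢0 (begin
    fromℕ e * Tr q t x              ≡⟨ sym (Tr-multiple x∈ e) ⟩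
    Tr q m x                        ≡⟨ eq ⟩
    a                               ≡⟨ sym (*-identityʳ a) ⟩
    a * 1#                          ≡⟨ cong (a *_) (sym (x*x⁻¹≡1 fromℕ-e≢0)) ⟩
    a * (fromℕ e * fromℕ e ⁻¹)      ≡⟨ solve 3 (λ a b c → a :* (b :* c) := b :* (a :* c)) refl a _ _ ⟩
    fromℕ e * c                     ∎)

  Tr≡c⇒Tr≡a : ∀ {x} → x ∈ L.F → Tr q t x ≡ c → Tr q m x ≡ a
  Tr≡c⇒Tr≡a {x} x∈ eq = begin
    Tr q m x                        ≡⟨ Tr-multiple x∈ e ⟩
    fromℕ e * Tr q t x              ≡⟨ cong (fromℕ e *_) eq ⟩
    fromℕ e * (a * fromℕ e ⁻¹)      ≡⟨ solve 3 (λ a b c → b :* (a :* c) := a :* (b :* c)) refl a _ _ ⟩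
    a * (fromℕ e * fromℕ e ⁻¹)      ≡⟨ cong (a *_) (x*x⁻¹≡1 fromℕ-e≢0) ⟩
    a * 1#                          ≡⟨ *-identityʳ a ⟩
    a                               ∎

  N : ℤ
  N = ℤ.+ Nt q m (suc t′) γ a h

  N≡∑ : N ≡ ∑ L.F (λ x → ι (Tr q t x ≟ c) ℤ.* coset x)
  N≡∑ = begin
    N
      ≡⟨ length-filter _ elements ⟩
    ∑ elements _
      ≡⟨ ∑-cong′ elements (λ x → trans
           (ι-∧ (pow x Q ≟ x) (⌊ Tr q m x ≟ a ⌋ ∧ inCoset q g h (Nm q m x)) _)
           (cong (ι (pow x Q ≟ x) ℤ.*_) (ι-∧ (Tr q m x ≟ a) (inCoset q g h (Nm q m x)) (T? _)))) ⟩
    ∑ elements (λ x → ι (pow x Q ≟ x) ℤ.* (ι (Tr q m x ≟ a) ℤ.* coset x))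
      ≡⟨ sym (∑-filter (λ x → pow x Q ≟ x) elements _) ⟩
    ∑ L.F (λ x → ι (Tr q m x ≟ a) ℤ.* coset x)
      ≡⟨ ∑-cong L.F (λ {x} x∈ → cong (ℤ._* coset x)
           (ι-⇔ (Tr q m x ≟ a) (Tr q t x ≟ c) (Tr≡a⇒Tr≡c x∈) (Tr≡c⇒Tr≡a x∈))) ⟩
    ∑ L.F (λ x → ι (Tr q t x ≟ c) ℤ.* coset x) ∎

  ∑-at-0 : ∑ L.F (λ x → ι (0# ≟ x) ℤ.* ι (Tr q t x ≟ c)) ≡ ι (0# ≟ c)
  ∑-at-0 = trans (Reindexing.∑-δ _≟_ (subfield-unique Q) L.0∈F (λ x → ι (Tr q t x ≟ c)))
    (cong (λ z → ι (z ≟ c)) (additive-0 (Tr-+ t)))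

  -- Summing `2*coset-odd` over the trace fibre of c gives its size, the possible exclusion of x =
  -- 0, and a signed copy of S.
  2N≡ : sign e ≡ -1ℤ → ℤ.+ 2 ℤ.* N ≡ ℤ.+ (q ℕ.^ t′) ℤ.- ι (0# ≟ c) ℤ.+ sign h ℤ.* S c
  2N≡ e-odd = begin
    ℤ.+ 2 ℤ.* N
      ≡⟨ cong (ℤ.+ 2 ℤ.*_) N≡∑ ⟩
    ℤ.+ 2 ℤ.* ∑ L.F (λ x → ι (Tr q t x ≟ c) ℤ.* coset x)
      ≡⟨ sym (∑-*ˡ L.F (ℤ.+ 2) _) ⟩
    ∑ L.F (λ x → ℤ.+ 2 ℤ.* (ι (Tr q t x ≟ c) ℤ.* coset x))
      ≡⟨ ∑-cong L.F (λ {x} x∈ → trans (swap (ι (Tr q t x ≟ c)) (coset x))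
           (trans (cong (ι (Tr q t x ≟ c) ℤ.*_) (2*coset-odd e-odd x∈))
             (expand (ι (Tr q t x ≟ c)) (ι (0# ≟ x)) (sign h) (ρ Q x)))) ⟩
    ∑ L.F (λ x → ι (Tr q t x ≟ c) ℤ.+ (-1ℤ ℤ.* (ι (0# ≟ x) ℤ.* ι (Tr q t x ≟ c)) ℤ.+ sign h ℤ.* (ρ Q x ℤ.* ι (Tr q t x ≟ c))))
      ≡⟨ trans (∑-+ L.F _ _) (cong (ℤ._+_ (traceCount c)) (trans (∑-+ L.F _ _) (cong₂ ℤ._+_ (∑-*ˡ L.F -1ℤ _) (∑-*ˡ L.F (sign h) _)))) ⟩
    traceCount c ℤ.+ (-1ℤ ℤ.* ∑ L.F (λ x → ι (0# ≟ x) ℤ.* ι (Tr q t x ≟ c)) ℤ.+ sign h ℤ.* S c)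
      ≡⟨ cong₂ (λ u v → u ℤ.+ (-1ℤ ℤ.* v ℤ.+ sign h ℤ.* S c)) (traceCount≡ c∈K) ∑-at-0 ⟩
    ℤ.+ (q ℕ.^ t′) ℤ.+ (-1ℤ ℤ.* ι (0# ≟ c) ℤ.+ sign h ℤ.* S c)
      ≡⟨ collect (ℤ.+ (q ℕ.^ t′)) (ι (0# ≟ c)) (sign h ℤ.* S c) ⟩
    ℤ.+ (q ℕ.^ t′) ℤ.- ι (0# ≟ c) ℤ.+ sign h ℤ.* S c ∎
    where
    swap : ∀ i k → ℤ.+ 2 ℤ.* (i ℤ.* k) ≡ i ℤ.* (ℤ.+ 2 ℤ.* k)
    swap = solve-∀
    expand : ∀ i z s r → i ℤ.* (1ℤ ℤ.- z ℤ.+ s ℤ.* r) ≡ i ℤ.+ (-1ℤ ℤ.* (z ℤ.* i) ℤ.+ s ℤ.* (r ℤ.* i))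
    expand = solve-∀
    collect : ∀ x z y → x ℤ.+ (-1ℤ ℤ.* z ℤ.+ y) ≡ x ℤ.- z ℤ.+ y
    collect = solve-∀

  N≡ : sign e ≡ 1ℤ → h ≡ 0 → N ≡ ℤ.+ (q ℕ.^ t′) ℤ.- ι (0# ≟ c)
  N≡ e-even h≡0 = begin
    N
      ≡⟨ N≡∑ ⟩
    ∑ L.F (λ x → ι (Tr q t x ≟ c) ℤ.* coset x)
      ≡⟨ ∑-cong L.F (λ {x} x∈ → trans (cong (ι (Tr q t x ≟ c) ℤ.*_) (coset-even e-even h≡0 x∈))
           (expand (ι (Tr q t x ≟ c)) (ι (0# ≟ x)))) ⟩
    ∑ L.F (λ x → ι (Tr q t x ≟ c) ℤ.+ -1ℤ ℤ.* (ι (0# ≟ x) ℤ.* ι (Tr q t x ≟ c)))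
      ≡⟨ trans (∑-+ L.F _ _) (cong (ℤ._+_ (traceCount c)) (∑-*ˡ L.F -1ℤ _)) ⟩
    traceCount c ℤ.+ -1ℤ ℤ.* ∑ L.F (λ x → ι (0# ≟ x) ℤ.* ι (Tr q t x ≟ c))
      ≡⟨ cong₂ (λ u v → u ℤ.+ v) (traceCount≡ c∈K) (trans (cong (-1ℤ ℤ.*_) ∑-at-0) (ℤ.-1*i≡-i _)) ⟩
    ℤ.+ (q ℕ.^ t′) ℤ.- ι (0# ≟ c) ∎
    where
    expand : ∀ i z → i ℤ.* (1ℤ ℤ.- z) ≡ i ℤ.+ -1ℤ ℤ.* (z ℤ.* i)
    expand = solve-∀

  -- The cases of the theorem

  ι-zero : a ≡ 0# → ι (0# ≟ c) ≡ 1ℤ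
  ι-zero refl = ι-yes (0# ≟ c) (sym (zeroˡ _))

  ι-nonzero : a ≢ 0# → ι (0# ≟ c) ≡ 0ℤ
  ι-nonzero a≢0 = ι-no (0# ≟ c) (*-≢0 a≢0 (⁻¹-≢0 fromℕ-e≢0) ∘ sym)

  -- The trace condition produces a/e, the formula to be proved contains e/a; a quadratic character
  -- does not distinguish them.
  ρ-c : a ≢ 0# → ρ q c ≡ ρ q (fromℕ e * a ⁻¹)
  ρ-c a≢0 = begin
    ρ q (a * fromℕ e ⁻¹)               ≡⟨ K.ρ-* a∈F e⁻¹∈K ⟩
    ρ q a ℤ.* ρ q (fromℕ e ⁻¹)         ≡⟨ cong₂ ℤ._*_ (sym (K.ρ-⁻¹ a∈F a≢0)) (K.ρ-⁻¹ (fromℕ∈K e) fromℕ-e≢0) ⟩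
    ρ q (a ⁻¹) ℤ.* ρ q (fromℕ e)       ≡⟨ ℤ.*-comm (ρ q (a ⁻¹)) _ ⟩
    ρ q (fromℕ e) ℤ.* ρ q (a ⁻¹)       ≡⟨ sym (K.ρ-* (fromℕ∈K e) (K.⁻¹∈F a∈F a≢0)) ⟩
    ρ q (fromℕ e * a ⁻¹)               ∎

  zero-odd : sign e ≡ -1ℤ → ∀ n → t′ ≡ n ℕ.+ n → a ≡ 0# → ℤ.+ 2 ℤ.* N ≡ ℤ.+ (q ℕ.^ t′) ℤ.- 1ℤ
  zero-odd e-odd n t′≡ a≡0 = begin
    ℤ.+ 2 ℤ.* N                                             ≡⟨ 2N≡ e-odd ⟩
    ℤ.+ (q ℕ.^ t′) ℤ.- ι (0# ≟ c) ℤ.+ sign h ℤ.* S c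
      ≡⟨ cong₂ (λ u v → ℤ.+ (q ℕ.^ t′) ℤ.- u ℤ.+ sign h ℤ.* v) (ι-zero a≡0)
           (trans (S-odd n t′≡ c∈K) (cong (λ v → ρ q (pow (- 1#) n) ℤ.* (ℤ.+ (q ℕ.^ n) ℤ.* v))
             (trans (cong (ρ q) (trans (cong (_* fromℕ e ⁻¹) a≡0) (zeroˡ _))) (ρ-0 q)))) ⟩
    ℤ.+ (q ℕ.^ t′) ℤ.- 1ℤ ℤ.+ sign h ℤ.* (ρ q (pow (- 1#) n) ℤ.* (ℤ.+ (q ℕ.^ n) ℤ.* 0ℤ))
      ≡⟨ vanish (ℤ.+ (q ℕ.^ t′)) (sign h) (ρ q (pow (- 1#) n)) (ℤ.+ (q ℕ.^ n)) ⟩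
    ℤ.+ (q ℕ.^ t′) ℤ.- 1ℤ                                   ∎
    where
    vanish : ∀ x s r y → x ℤ.- 1ℤ ℤ.+ s ℤ.* (r ℤ.* (y ℤ.* 0ℤ)) ≡ x ℤ.- 1ℤ
    vanish = solve-∀

  -- With n = (t - 2)/2, the factor q - 1 arises as q^(n+1) - q^n = (q - 1) q^n, since c = 0 keeps
  -- both terms of `S-even`.
  zero-even : sign e ≡ -1ℤ → ∀ n → t ≡ suc n ℕ.+ suc n → a ≡ 0# →
    ℤ.+ 2 ℤ.* N ≡ ℤ.+ (q ℕ.^ t′) ℤ.- 1ℤ ℤ.- (ℤ.+ q ℤ.- 1ℤ) ℤ.* sign h ℤ.* ℤ.+ (q ℕ.^ n) ℤ.* ρ q (pow (- 1#) (suc n))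
  zero-even e-odd n t≡ a≡0 = begin
    ℤ.+ 2 ℤ.* N                                             ≡⟨ 2N≡ e-odd ⟩
    ℤ.+ (q ℕ.^ t′) ℤ.- ι (0# ≟ c) ℤ.+ sign h ℤ.* S c
      ≡⟨ cong (λ v → ℤ.+ (q ℕ.^ t′) ℤ.- ι (0# ≟ c) ℤ.+ sign h ℤ.* v) (S-even n t≡ c∈K) ⟩
    ℤ.+ (q ℕ.^ t′) ℤ.- ι (0# ≟ c) ℤ.+ sign h ℤ.* (ℤ.- R ℤ.* (ℤ.+ (q ℕ.^ suc n) ℤ.* ι (0# ≟ c) ℤ.- ℤ.+ (q ℕ.^ n)))
      ≡⟨ cong₂ (λ u v → ℤ.+ (q ℕ.^ t′) ℤ.- u ℤ.+ sign h ℤ.* (ℤ.- R ℤ.* (v ℤ.* u ℤ.- ℤ.+ (q ℕ.^ n)))) (ι-zero a≡0) (pos-^-suc q n) ⟩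
    ℤ.+ (q ℕ.^ t′) ℤ.- 1ℤ ℤ.+ sign h ℤ.* (ℤ.- R ℤ.* (ℤ.+ q ℤ.* ℤ.+ (q ℕ.^ n) ℤ.* 1ℤ ℤ.- ℤ.+ (q ℕ.^ n)))
      ≡⟨ arith (ℤ.+ (q ℕ.^ t′)) (sign h) R (ℤ.+ q) (ℤ.+ (q ℕ.^ n)) ⟩
    ℤ.+ (q ℕ.^ t′) ℤ.- 1ℤ ℤ.- (ℤ.+ q ℤ.- 1ℤ) ℤ.* sign h ℤ.* ℤ.+ (q ℕ.^ n) ℤ.* R ∎
    where
    R : ℤ
    R = ρ q (pow (- 1#) (suc n))
    arith : ∀ x s r q y → x ℤ.- 1ℤ ℤ.+ s ℤ.* (ℤ.- r ℤ.* (q ℤ.* y ℤ.* 1ℤ ℤ.- y)) ≡ x ℤ.- 1ℤ ℤ.- (q ℤ.- 1ℤ) ℤ.* s ℤ.* y ℤ.* r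
    arith = solve-∀

  nonzero-odd : sign e ≡ -1ℤ → ∀ n → t′ ≡ n ℕ.+ n → a ≢ 0# →
    ℤ.+ 2 ℤ.* N ≡ ℤ.+ (q ℕ.^ t′) ℤ.+ sign h ℤ.* ℤ.+ (q ℕ.^ n) ℤ.* ρ q (pow (- 1#) n * (fromℕ e * a ⁻¹))
  nonzero-odd e-odd n t′≡ a≢0 = begin
    ℤ.+ 2 ℤ.* N                                             ≡⟨ 2N≡ e-odd ⟩
    ℤ.+ (q ℕ.^ t′) ℤ.- ι (0# ≟ c) ℤ.+ sign h ℤ.* S c
      ≡⟨ cong₂ (λ u v → ℤ.+ (q ℕ.^ t′) ℤ.- u ℤ.+ sign h ℤ.* v) (ι-nonzero a≢0) (S-odd n t′≡ c∈K) ⟩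
    ℤ.+ (q ℕ.^ t′) ℤ.- 0ℤ ℤ.+ sign h ℤ.* (ρ q (pow (- 1#) n) ℤ.* (ℤ.+ (q ℕ.^ n) ℤ.* ρ q c))
      ≡⟨ arith (ℤ.+ (q ℕ.^ t′)) (sign h) (ρ q (pow (- 1#) n)) (ℤ.+ (q ℕ.^ n)) (ρ q c) ⟩
    ℤ.+ (q ℕ.^ t′) ℤ.+ sign h ℤ.* ℤ.+ (q ℕ.^ n) ℤ.* (ρ q (pow (- 1#) n) ℤ.* ρ q c)
      ≡⟨ cong (λ v → ℤ.+ (q ℕ.^ t′) ℤ.+ sign h ℤ.* ℤ.+ (q ℕ.^ n) ℤ.* v)
           (trans (cong (ρ q (pow (- 1#) n) ℤ.*_) (ρ-c a≢0))
             (sym (K.ρ-* (pow-neg∈K n) (K.*∈F (fromℕ∈K e) (K.⁻¹∈F a∈F a≢0))))) ⟩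
    ℤ.+ (q ℕ.^ t′) ℤ.+ sign h ℤ.* ℤ.+ (q ℕ.^ n) ℤ.* ρ q (pow (- 1#) n * (fromℕ e * a ⁻¹)) ∎
    where
    arith : ∀ x s r y z → x ℤ.- 0ℤ ℤ.+ s ℤ.* (r ℤ.* (y ℤ.* z)) ≡ x ℤ.+ s ℤ.* y ℤ.* (r ℤ.* z)
    arith = solve-∀

  nonzero-even : sign e ≡ -1ℤ → ∀ n → t ≡ suc n ℕ.+ suc n → a ≢ 0# →
    ℤ.+ 2 ℤ.* N ≡ ℤ.+ (q ℕ.^ t′) ℤ.+ sign h ℤ.* ℤ.+ (q ℕ.^ n) ℤ.* ρ q (pow (- 1#) (suc n))
  nonzero-even e-odd n t≡ a≢0 = begin
    ℤ.+ 2 ℤ.* N                                             ≡⟨ 2N≡ e-odd ⟩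
    ℤ.+ (q ℕ.^ t′) ℤ.- ι (0# ≟ c) ℤ.+ sign h ℤ.* S c
      ≡⟨ cong (λ v → ℤ.+ (q ℕ.^ t′) ℤ.- ι (0# ≟ c) ℤ.+ sign h ℤ.* v) (S-even n t≡ c∈K) ⟩
    ℤ.+ (q ℕ.^ t′) ℤ.- ι (0# ≟ c) ℤ.+ sign h ℤ.* (ℤ.- R ℤ.* (ℤ.+ (q ℕ.^ suc n) ℤ.* ι (0# ≟ c) ℤ.- ℤ.+ (q ℕ.^ n)))
      ≡⟨ cong (λ u → ℤ.+ (q ℕ.^ t′) ℤ.- u ℤ.+ sign h ℤ.* (ℤ.- R ℤ.* (ℤ.+ (q ℕ.^ suc n) ℤ.* u ℤ.- ℤ.+ (q ℕ.^ n)))) (ι-nonzero a≢0) ⟩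
    ℤ.+ (q ℕ.^ t′) ℤ.- 0ℤ ℤ.+ sign h ℤ.* (ℤ.- R ℤ.* (ℤ.+ (q ℕ.^ suc n) ℤ.* 0ℤ ℤ.- ℤ.+ (q ℕ.^ n)))
      ≡⟨ arith (ℤ.+ (q ℕ.^ t′)) (sign h) R (ℤ.+ (q ℕ.^ suc n)) (ℤ.+ (q ℕ.^ n)) ⟩
    ℤ.+ (q ℕ.^ t′) ℤ.+ sign h ℤ.* ℤ.+ (q ℕ.^ n) ℤ.* R ∎
    where
    R : ℤ
    R = ρ q (pow (- 1#) (suc n))
    arith : ∀ x s r z y → x ℤ.- 0ℤ ℤ.+ s ℤ.* (ℤ.- r ℤ.* (z ℤ.* 0ℤ ℤ.- y)) ≡ x ℤ.+ s ℤ.* y ℤ.* r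
    arith = solve-∀

half-odd : ∀ t′ → ¬ (2 ∣ suc t′) → t′ ≡ t′ / 2 ℕ.+ t′ / 2
half-odd t′ 2∤t with parity t′
... | even k = trans (cong (k ℕ.+_) (ℕ.+-identityʳ k)) (sym (cong₂ ℕ._+_ half half))
  where
  half : 2 ℕ.* k / 2 ≡ k
  half = trans (cong (_/ 2) (ℕ.*-comm 2 k)) (m*n/n≡m k 2)
... | odd k  = contradiction (divides (suc k) (cong (suc ∘ suc) (ℕ.*-comm 2 k))) 2∤t

-- The expression (t′ ∸ 1)/2 is what (t ∸ 2)/2 computes to for t = suc t′, so the exponents of q
-- match without rewriting.
half-even : ∀ t′ → 2 ∣ suc t′ → let n = (t′ ℕ.∸ 1) / 2 in suc t′ ≡ suc n ℕ.+ suc n × suc t′ / 2 ≡ suc n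
half-even t′ (divides (suc k) refl) =
    trans (trans (ℕ.*-comm (suc k) 2) (cong (suc k ℕ.+_) (ℕ.+-identityʳ (suc k)))) (cong (λ n → suc n ℕ.+ suc n) (sym half))
  , trans (m*n/n≡m (suc k) 2) (cong suc (sym half))
  where
  half : k ℕ.* 2 / 2 ≡ k
  half = m*n/n≡m k 2

2∣⇒sign : ∀ {n} → 2 ∣ n → sign n ≡ 1ℤ
2∣⇒sign (divides k refl) = trans (cong sign (ℕ.*-comm k 2)) (sign-2* k)

2∤⇒sign : ∀ {n} → ¬ (2 ∣ n) → sign n ≡ -1ℤ
2∤⇒sign {n} 2∤n with parity n
... | even k = contradiction (divides k (ℕ.*-comm 2 k)) 2∤n
... | odd k  = sign-1+2* k

-- For e even, 2 divides the greatest common divisor, so h = 1 is impossible.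
gcd∣h⇒h≡0 : ∀ {e h} → 2 ∣ e → h ≤ 1 → gcd e 2 ∣ h → h ≡ 0
gcd∣h⇒h≡0 {h = zero}  _   _ _ = refl
gcd∣h⇒h≡0 {h = suc zero} 2∣e _ gcd∣1 = contradiction (∣⇒≤ (∣-trans (gcd-greatest 2∣e ∣-refl) gcd∣1)) λ { (ℕ.s≤s ()) }
gcd∣h⇒h≡0 {h = suc (suc _)} _ (ℕ.s≤s ()) _

open import Data.Integer using (+_)

theorem1 : (E : FiniteField) → let open FiniteField E in
    (p r q m : ℕ) → Prime p → p ≢ 2 → q ≡ p ℕ.^ r → 2 ≤ m → card ≡ q ℕ.^ m →
    (γ : Carrier) → Primitive γ →
    (h : ℕ) → h ≤ 1 →
    (a : Carrier) → inSub q 1 a ≡ true →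
    (t e : ℕ) → m ≡ e ℕ.* t → ¬ (p ∣ e) → gcd e 2 ∣ h →
    let N = + Nt q m t γ a h
        sg = ℤ.-1ℤ ℤ.^ h
    in
      (a ≡ 0# → ¬ (2 ∣ e) → ¬ (2 ∣ t) →
        + 2 ℤ.* N ≡ + (q ℕ.^ (t ℕ.∸ 1)) ℤ.- + 1)
    × (a ≡ 0# → ¬ (2 ∣ e) → 2 ∣ t →
        + 2 ℤ.* N ≡ + (q ℕ.^ (t ℕ.∸ 1)) ℤ.- + 1
                     ℤ.- (+ q ℤ.- + 1) ℤ.* sg ℤ.* + (q ℕ.^ ((t ℕ.∸ 2) ℕ./ 2))
                         ℤ.* ρ q (pow (- 1#) (t ℕ./ 2)))
    × (a ≡ 0# → 2 ∣ e →
        N ≡ + (q ℕ.^ (t ℕ.∸ 1)) ℤ.- + 1)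
    × (a ≢ 0# → ¬ (2 ∣ e) → ¬ (2 ∣ t) →
        + 2 ℤ.* N ≡ + (q ℕ.^ (t ℕ.∸ 1))
                     ℤ.+ sg ℤ.* + (q ℕ.^ ((t ℕ.∸ 1) ℕ./ 2))
                         ℤ.* ρ q (pow (- 1#) ((t ℕ.∸ 1) ℕ./ 2) * (fromℕ e * (a ⁻¹))))
    × (a ≢ 0# → ¬ (2 ∣ e) → 2 ∣ t →
        + 2 ℤ.* N ≡ + (q ℕ.^ (t ℕ.∸ 1))
                     ℤ.+ sg ℤ.* + (q ℕ.^ ((t ℕ.∸ 2) ℕ./ 2))
                         ℤ.* ρ q (pow (- 1#) (t ℕ./ 2)))
    × (a ≢ 0# → 2 ∣ e →
        N ≡ + (q ℕ.^ (t ℕ.∸ 1)))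
theorem1 E p r q m p-prime p≢2 q≡p^r 2≤m card≡ γ γ-primitive h h≤1 a a∈K zero e m≡e*0 _ _ =
  contradiction (subst (2 ≤_) (trans m≡e*0 (ℕ.*-zeroʳ e)) 2≤m) λ ()
theorem1 E p r q _ p-prime p≢2 q≡p^r 2≤m card≡ γ γ-primitive h h≤1 a a∈K (suc t′) e refl p∤e gcd∣h =
    (λ a≡0 2∤e 2∤t → zero-odd (2∤⇒sign 2∤e) (t′ / 2) (half-odd t′ 2∤t) a≡0)
  , (λ a≡0 2∤e 2∣t → let t≡ , t/2≡ = half-even t′ 2∣t in
      trans (zero-even (2∤⇒sign 2∤e) n t≡ a≡0)
        (cong (λ j → + (q ℕ.^ t′) ℤ.- 1ℤ ℤ.- (+ q ℤ.- 1ℤ) ℤ.* sign h ℤ.* + (q ℕ.^ n) ℤ.* ρ q (pow (- 1#) j)) (sym t/2≡)))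
  , (λ a≡0 2∣e → trans (N≡ (2∣⇒sign 2∣e) (gcd∣h⇒h≡0 2∣e h≤1 gcd∣h))
      (cong (λ i → + (q ℕ.^ t′) ℤ.- i) (ι-zero a≡0)))
  , (λ a≢0 2∤e 2∤t → nonzero-odd (2∤⇒sign 2∤e) (t′ / 2) (half-odd t′ 2∤t) a≢0)
  , (λ a≢0 2∤e 2∣t → let t≡ , t/2≡ = half-even t′ 2∣t in
      trans (nonzero-even (2∤⇒sign 2∤e) n t≡ a≢0)
        (cong (λ j → + (q ℕ.^ t′) ℤ.+ sign h ℤ.* + (q ℕ.^ n) ℤ.* ρ q (pow (- 1#) j)) (sym t/2≡)))
  , (λ a≢0 2∣e → trans (N≡ (2∣⇒sign 2∣e) (gcd∣h⇒h≡0 2∣e h≤1 gcd∣h))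
      (trans (cong (λ i → + (q ℕ.^ t′) ℤ.- i) (ι-nonzero a≢0)) (ℤ.+-identityʳ _)))
  where
  open FiniteField E
  n : ℕ
  n = (t′ ℕ.∸ 1) / 2

  q-odd : ∃ λ hq → q ≡ suc (2 ℕ.* hq)
  q-odd = let hp , p≡ = odd-prime p-prime p≢2
              hq , eq = odd^ hp r
          in hq , trans q≡p^r (trans (cong (ℕ._^ r) p≡) eq)

  open Counting E p-prime {q} {r} q≡p^r {proj₁ q-odd} (proj₂ q-odd) {e} {t′} card≡ (ℕ.<-trans ℕ.z<s 2≤m)
    {γ} γ-primitive {h} h≤1 {a} a∈K p∤e
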